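{- For $i=1,2$, let $G_i$ be a 4-regular graph gadget with signature $(\alpha_i,\beta_i,\gamma_i)\in S$, where $\alpha_1\alpha_2\neq1$. Let $G_3$ be the 2-glue of $G_1$ and $G_2$, with signature $(\alpha_3,\beta_3,\gamma_3)$ given by $$\alpha_3=\frac{\alpha_1\beta_2+\alpha_1\gamma_2+\beta_1\alpha_2+\gamma_1\alpha_2}{1-\alpha_1\alpha_2},\quad \beta_3=\frac{\beta_1\gamma_2+\gamma_1\beta_2}{1-\alpha_1\alpha_2},\quad \gamma_3=\frac{\beta_1\beta_2+\gamma_1\gamma_2}{1-\alpha_1\alpha_2}.$$ Then $(\alpha_3,\beta_3,\gamma_3)\in S$.
   Context: The set $S\subseteq\mathbb{R}^3$ consists of all vectors $P(\alpha,\beta,\gamma)^{\mathrm T}$, where $P$ is a $3\times3$ permutation matrix, $\alpha\ge\beta\ge\gamma\ge0$, $\alpha+\beta+\gamma=1$, and $\gamma\ge f(\beta)$, where $f(x)=\frac12(1-x)\bigl(1-\exp(2x/(x-1))\bigr)$. A 4-regular graph gadget is a finite undirected graph (parallel edges and loops allowed) together with exactly four half-edges, labelled $0,1,2,3$, each incident with exactly one vertex, such that every vertex has degree 4 (counting half-edges, and loops twice). A route is a trail (no repeated edges, repeated vertices allowed) starting with one half-edge and ending with another. A valid set of routes is a set of two routes such that every edge and every half-edge is travelled exactly once (routes are considered up to reversal); equivalently, it is a choice at every vertex of a perfect matching of the four edge-ends/half-edges at it such that following the matchings yields two trails joining the four half-edges in pairs and no closed trails. $\mathrm{VR}(\{a,b\},\{c,d\})$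 denotes the set of valid sets of routes in which one route connects half-edges $a,b$ and the other connects $c,d$. The signature of a gadget is the triple $(\alpha,\beta,\gamma)$ with $\alpha=|\mathrm{VR}(\{0,1\},\{2,3\})|/N$, $\beta=|\mathrm{VR}(\{0,2\},\{1,3\})|/N$, $\gamma=|\mathrm{VR}(\{0,3\},\{1,2\})|/N$, where $N$ is the sum of the three cardinalities (defined when $N>0$). The 2-glue of gadgets $G_1,G_2$ is the gadget obtained from their disjoint union by connecting half-edge $3$ of $G_1$ with half-edge $0$ of $G_2$ and half-edge $2$ of $G_1$ with half-edge $1$ of $G_2$ (each connected pair becomes one edge); its half-edges $0,1$ are half-edges $0,1$ of $G_1$ and its half-edges $2,3$ are half-edges $2,3$ of $G_2$. -}

module Defs where

open import Data.Bool.Base using (Bool; true; false; not)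
open import Data.Empty using (⊥-elim)
open import Data.Fin.Base using (Fin; zero; suc)
open import Data.Fin.Patterns using (0F; 1F; 2F; 3F)
open import Data.Fin.Properties using (+↔⊎)
open import Data.Fin.Permutation using (Permutation′; _⟨$⟩ʳ_)
open import Data.Integer.Base using (+_; +≤+)
import Data.Integer.Base as ℤ
import Data.Integer.Properties as ℤ
open import Data.List.Base using (List; []; _∷_)
open import Data.List.Membership.Propositional using (_∈_)
open import Data.Nat.Base as ℕ using (ℕ; zero; suc)
import Data.Nat.Properties as ℕ
open import Data.Product.Base using (Σ; ∃; _×_; _,_; uncurry; ∃-syntax; Σ-syntax)
open import Data.Rational.Base
  using (ℚ; mkℚ; 0ℚ; 1ℚ; ½; _+_; _*_; _-_; -_; _/_; 1/_; ∣_∣; _≤_; _<_; *≤*;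
         Positive; NonNegative; NonZero; positive; nonNegative; ≢-nonZero; toℚᵘ)
open import Data.Rational.Properties
open import Data.Rational.Solver using (module +-*-Solver)
open import Data.Rational.Unnormalised.Base using (mkℚᵘ; *≡*)
import Data.Rational.Unnormalised.Base as ℚᵘ
import Data.Rational.Unnormalised.Properties as ℚᵘ
open import Data.Sum.Base using (_⊎_; inj₁; inj₂; [_,_]′)
open import Data.Sum.Function.Propositional using (_⊎-↔_)
open import Data.Vec.Functional using (Vector)
open import Function.Base using (_∘_)
open import Function.Bundles using (_↔_; Inverse; mk↔ₛ′)
open import Function.Properties.Inverse using (↔-refl; ↔-sym; ↔-trans)
open import Level using (0ℓ)
open import Relation.Binary.Bundles using (Setoid)
open import Relation.Binary.PropositionalEquality as ≡
  using (_≡_; _≢_; refl; sym; trans; cong; cong₂; subst; subst₂)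
open import Relation.Nullary using (yes; no)
open import Relation.Unary using (Pred)

fromℕ : ℕ → ℚ
fromℕ n = + n / 1

2ℚ : ℚ
2ℚ = 1ℚ + 1ℚ

toℚᵘ-/ : ∀ p d → toℚᵘ (p / suc d) ℚᵘ.≃ mkℚᵘ p d
toℚᵘ-/ p d = toℚᵘ-fromℚᵘ (mkℚᵘ p d)

fromℕ-mono : ∀ {m n} → m ℕ.≤ n → fromℕ m ≤ fromℕ n
fromℕ-mono {m} {n} m≤n = toℚᵘ-cancel-≤
  (ℚᵘ.≤-respˡ-≃ (ℚᵘ.≃-sym (toℚᵘ-/ (+ m) 0)) (ℚᵘ.≤-respʳ-≃ (ℚᵘ.≃-sym (toℚᵘ-/ (+ n) 0))
    (ℚᵘ.*≤* (subst₂ ℤ._≤_ (sym (ℤ.*-identityʳ (+ m))) (sym (ℤ.*-identityʳ (+ n))) (+≤+ m≤n)))))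

fromℕ-suc : ∀ n → fromℕ (suc n) ≡ fromℕ n + 1ℚ
fromℕ-suc n = toℚᵘ-injective (ℚᵘ.≃-trans (toℚᵘ-/ (+ suc n) 0)
  (ℚᵘ.≃-trans (*≡* (cong (ℤ._* (+ 1)) (trans (cong +_ (ℕ.+-comm 1 n))
                 (cong (ℤ._+ (+ 1)) (sym (ℤ.*-identityʳ (+ n)))))))
  (ℚᵘ.≃-sym (ℚᵘ.≃-trans (toℚᵘ-homo-+ (fromℕ n) 1ℚ) (ℚᵘ.+-congˡ (toℚᵘ 1ℚ) (toℚᵘ-/ (+ n) 0))))))

1/suc*suc : ∀ k → (+ 1 / suc k) * fromℕ (suc k) ≡ 1ℚ
1/suc*suc k = toℚᵘ-injective (ℚᵘ.≃-trans (toℚᵘ-homo-* (+ 1 / suc k) (fromℕ (suc k)))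
  (ℚᵘ.≃-trans (ℚᵘ.*-cong (toℚᵘ-/ (+ 1) k) (toℚᵘ-/ (+ suc k) 0))
    (*≡* (trans (ℤ.*-identityʳ _) (trans (ℤ.*-identityˡ (+ suc k))
      (sym (trans (ℤ.*-identityˡ _) (cong +_ (ℕ.*-identityʳ (suc k))))))))))

archimedean : ∀ q → ∃[ n ] q ≤ fromℕ n
archimedean q@(mkℚ p d c) = ℤ.∣ p ∣ , toℚᵘ-cancel-≤
  (ℚᵘ.≤-respʳ-≃ (ℚᵘ.≃-sym (toℚᵘ-/ (+ ℤ.∣ p ∣) 0)) (ℚᵘ.*≤* (lemma p)))
  where
  lemma : ∀ p → p ℤ.* (+ 1) ℤ.≤ (+ ℤ.∣ p ∣) ℤ.* (+ suc d)
  lemma (+ n) rewrite ℤ.*-identityʳ (+ n) | sym (ℤ.pos-* n (suc d)) = +≤+ (ℕ.m≤m*n n (suc d))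
  lemma ℤ.-[1+ n ] = ℤ.≤-trans (ℤ.≤-reflexive (ℤ.*-identityʳ ℤ.-[1+ n ])) ℤ.-≤+

*-monoʳ-0≤ : ∀ {p q r} → 0ℚ ≤ r → p ≤ q → p * r ≤ q * r
*-monoʳ-0≤ {r = r} 0≤r = *-monoʳ-≤-nonNeg r {{nonNegative 0≤r}}

*-mono-0≤ : ∀ {p q r s} → 0ℚ ≤ r → 0ℚ ≤ q → p ≤ q → r ≤ s → p * r ≤ q * s
*-mono-0≤ {p} {q} {r} {s} 0≤r 0≤q p≤q r≤s =
  ≤-trans (*-monoʳ-0≤ 0≤r p≤q) (*-monoˡ-≤-nonNeg q {{nonNegative 0≤q}} r≤s)

0≤* : ∀ {p q} → 0ℚ ≤ p → 0ℚ ≤ q → 0ℚ ≤ p * q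
0≤* {p} {q} 0≤p 0≤q = ≤-trans (≤-reflexive (sym (*-zeroˡ q))) (*-monoʳ-0≤ 0≤q 0≤p)

0<* : ∀ {p q} → 0ℚ < p → 0ℚ < q → 0ℚ < p * q
0<* {p} {q} 0<p 0<q = positive⁻¹ (p * q) {{pos*pos⇒pos p {{positive 0<p}} q {{positive 0<q}}}}

triangle₃ : ∀ a b c d → ∣ a - d ∣ ≤ ∣ a - b ∣ + ∣ b - c ∣ + ∣ c - d ∣
triangle₃ a b c d = ≤-trans
  (≤-reflexive (cong ∣_∣ (solve 4 (λ a b c d → a :- d := (a :- b) :+ (b :- c) :+ (c :- d)) refl a b c d)))
  (≤-trans (∣p+q∣≤∣p∣+∣q∣ (a - b + (b - c)) (c - d))
           (+-monoˡ-≤ ∣ c - d ∣ (∣p+q∣≤∣p∣+∣q∣ (a - b) (b - c))))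
  where open +-*-Solver

∣-∣-comm : ∀ p q → ∣ p - q ∣ ≡ ∣ q - p ∣
∣-∣-comm p q = trans (sym (∣-p∣≡∣p∣ (p - q)))
  (cong ∣_∣ (solve 2 (λ p q → :- (p :- q) := q :- p) refl p q))
  where open +-*-Solver

p≤∣p∣ : ∀ p → p ≤ ∣ p ∣
p≤∣p∣ p with ≤-total 0ℚ p
... | inj₁ 0≤p = ≤-reflexive (sym (0≤p⇒∣p∣≡p 0≤p))
... | inj₂ p≤0 = ≤-trans p≤0 (0≤∣p∣ p)

-- The inverse of ℚ, with the junk value 0 at 0.
inv : ℚ → ℚ
inv q with q ≟ 0ℚ
... | yes _   = 0ℚ
... | no  q≢0 = (1/ q) {{≢-nonZero q≢0}}

inv-inverse : ∀ {q} → q ≢ 0ℚ → inv q * q ≡ 1ℚ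
inv-inverse {q} q≢0 with q ≟ 0ℚ
... | yes q≡0 = ⊥-elim (q≢0 q≡0)
... | no  q≢0 = *-inverseˡ q {{≢-nonZero q≢0}}

0<inv : ∀ {q} → 0ℚ < q → 0ℚ < inv q
0<inv {q} 0<q with q ≟ 0ℚ
... | yes refl = 0<q
... | no  q≢0  = positive⁻¹ _ {{1/pos⇒pos q {{positive 0<q}}}}

Eventually : (ℕ → Set) → Set
Eventually P = ∃[ N ] ∀ n → N ℕ.≤ n → P n

record IsCauchy (x : ℕ → ℚ) : Set where
  constructor mkCauchy
  field
    modulus : ∀ ε → 0ℚ < ε → ∃[ N ] ∀ m n → N ℕ.≤ m → N ℕ.≤ n → ∣ x m - x n ∣ < ε

open IsCauchy public

scale : ∀ {x} K → 0ℚ < K →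
        (∀ ε → 0ℚ < ε → ∃[ N ] ∀ m n → N ℕ.≤ m → N ℕ.≤ n → ∣ x m - x n ∣ ≤ K * ε) →
        IsCauchy x
scale {x} K 0<K h = mkCauchy λ ε 0<ε →
  let N , close = h (δ ε) (0<δ 0<ε) in
  N , λ m n N≤m N≤n → ≤-<-trans (close m n N≤m N≤n) (subst (_< ε) (sym (Kδ≡ε½ ε)) (ε½<ε 0<ε))
  where
  open +-*-Solver
  δ : ℚ → ℚ
  δ ε = inv K * (ε * ½)
  0<ε½ : ∀ {ε} → 0ℚ < ε → 0ℚ < ε * ½
  0<ε½ 0<ε = 0<* 0<ε (positive⁻¹ ½)
  0<δ : ∀ {ε} → 0ℚ < ε → 0ℚ < δ ε
  0<δ 0<ε = 0<* (0<inv 0<K) (0<ε½ 0<ε)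
  Kδ≡ε½ : ∀ ε → K * δ ε ≡ ε * ½
  Kδ≡ε½ ε = trans (solve 3 (λ k i e → k :* (i :* e) := (i :* k) :* e) refl K (inv K) (ε * ½))
    (trans (cong (_* (ε * ½)) (inv-inverse (λ K≡0 → <-irrefl (sym K≡0) 0<K)))
           (*-identityˡ (ε * ½)))
  ε½<ε : ∀ {ε} → 0ℚ < ε → ε * ½ < ε
  ε½<ε {ε} 0<ε = <-respʳ-≡ (trans (sym (*-distribˡ-+ ε ½ ½)) (*-identityʳ ε))
           (<-respˡ-≡ (+-identityʳ (ε * ½)) (+-monoʳ-< (ε * ½) (0<ε½ 0<ε)))

bounded : ∀ {x} → IsCauchy x → ∃[ B ] 0ℚ < B × Eventually (λ n → ∣ x n ∣ ≤ B)
bounded {x} c = let N , close = modulus c 1ℚ (positive⁻¹ 1ℚ) in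
  ∣ x N ∣ + 1ℚ ,
  ≤-<-trans (0≤∣p∣ (x N)) (<-respˡ-≡ (+-identityʳ ∣ x N ∣) (+-monoʳ-< ∣ x N ∣ (positive⁻¹ 1ℚ))) ,
  N , λ n N≤n → ≤-trans (≤-reflexive (cong ∣_∣ (split (x n) (x N))))
    (≤-trans (∣p+q∣≤∣p∣+∣q∣ (x N) (x n - x N))
             (+-monoʳ-≤ ∣ x N ∣ (<⇒≤ (close n N N≤n ℕ.≤-refl))))
  where
  open +-*-Solver
  split : ∀ p q → p ≡ q + (p - q)
  split = solve 2 (λ p q → p := q :+ (p :- q)) refl

⊔≤ˡ : ∀ {m n k} → m ℕ.⊔ n ℕ.≤ k → m ℕ.≤ k
⊔≤ˡ {m} {n} = ℕ.≤-trans (ℕ.m≤m⊔n m n)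

⊔≤ʳ : ∀ {m n k} → m ℕ.⊔ n ℕ.≤ k → n ℕ.≤ k
⊔≤ʳ {m} {n} = ℕ.≤-trans (ℕ.m≤n⊔m m n)

const-cauchy : ∀ q → IsCauchy (λ _ → q)
const-cauchy q = mkCauchy λ ε 0<ε → 0 , λ _ _ _ _ → subst (_< ε) (sym (cong ∣_∣ (+-inverseʳ q))) 0<ε

neg-cauchy : ∀ {x} → IsCauchy x → IsCauchy (λ n → - x n)
neg-cauchy {x} c = mkCauchy λ ε 0<ε → let N , close = modulus c ε 0<ε in
  N , λ m n N≤m N≤n → subst (_< ε)
    (trans (sym (∣-p∣≡∣p∣ (x m - x n))) (cong ∣_∣ (neg-distrib-+ (x m) (- x n))))
    (close m n N≤m N≤n)

+-cauchy : ∀ {x y} → IsCauchy x → IsCauchy y → IsCauchy (λ n → x n + y n)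
+-cauchy {x} {y} c d = scale 2ℚ (positive⁻¹ 2ℚ) λ ε 0<ε →
  let N , close  = modulus c ε 0<ε
      M , close′ = modulus d ε 0<ε
  in N ℕ.⊔ M , λ m n ≤m ≤n → ≤-trans
       (≤-reflexive (cong ∣_∣ (regroup (x m) (y m) (x n) (y n))))
       (≤-trans (∣p+q∣≤∣p∣+∣q∣ (x m - x n) (y m - y n))
       (≤-trans (+-mono-≤ (<⇒≤ (close m n (⊔≤ˡ ≤m) (⊔≤ˡ ≤n)))
                          (<⇒≤ (close′ m n (⊔≤ʳ {N} ≤m) (⊔≤ʳ {N} ≤n))))
                (≤-reflexive (double ε))))
  where
  open +-*-Solver
  regroup : ∀ a b c d → (a + b) - (c + d) ≡ (a - c) + (b - d)
  regroup = solve 4 (λ a b c d → (a :+ b) :- (c :+ d) := (a :- c) :+ (b :- d)) refl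
  double : ∀ ε → ε + ε ≡ 2ℚ * ε
  double = solve 1 (λ e → e :+ e := con 2ℚ :* e) refl

*-cauchy : ∀ {x y} → IsCauchy x → IsCauchy y → IsCauchy (λ n → x n * y n)
*-cauchy {x} {y} c d =
  let B , 0<B , N₁ , x≤B = bounded c
      C , 0<C , N₂ , y≤C = bounded d
  in scale (B + C) (+-mono-< 0<B 0<C) λ ε 0<ε →
    let N₃ , close  = modulus c ε 0<ε
        N₄ , close′ = modulus d ε 0<ε
    in (N₁ ℕ.⊔ N₂) ℕ.⊔ (N₃ ℕ.⊔ N₄) , λ m n ≤m ≤n → ≤-trans
       (≤-reflexive (cong ∣_∣ (regroup (x m) (y m) (x n) (y n))))
       (≤-trans (∣p+q∣≤∣p∣+∣q∣ (x m * (y m - y n)) ((x m - x n) * y n))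
       (≤-trans (+-mono-≤
          (≤-trans (≤-reflexive (∣p*q∣≡∣p∣*∣q∣ (x m) (y m - y n)))
            (*-mono-0≤ (0≤∣p∣ (y m - y n)) (<⇒≤ 0<B) (x≤B m (⊔≤ˡ (⊔≤ˡ ≤m)))
              (<⇒≤ (close′ m n (⊔≤ʳ {N₃} (⊔≤ʳ {N₁ ℕ.⊔ N₂} ≤m))
                               (⊔≤ʳ {N₃} (⊔≤ʳ {N₁ ℕ.⊔ N₂} ≤n))))))
          (≤-trans (≤-reflexive (∣p*q∣≡∣p∣*∣q∣ (x m - x n) (y n)))
            (*-mono-0≤ (0≤∣p∣ (y n)) (<⇒≤ 0<ε)
              (<⇒≤ (close m n (⊔≤ˡ (⊔≤ʳ {N₁ ℕ.⊔ N₂} ≤m)) (⊔≤ˡ (⊔≤ʳ {N₁ ℕ.⊔ N₂} ≤n))))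
              (y≤C n (⊔≤ʳ {N₁} (⊔≤ˡ ≤n))))))
        (≤-reflexive (collect B C ε))))
  where
  open +-*-Solver
  regroup : ∀ a b c d → a * b - c * d ≡ a * (b - d) + (a - c) * d
  regroup = solve 4 (λ a b c d → a :* b :- c :* d := a :* (b :- d) :+ (a :- c) :* d) refl
  collect : ∀ B C ε → B * ε + ε * C ≡ (B + C) * ε
  collect = solve 3 (λ B C ε → B :* ε :+ ε :* C := (B :+ C) :* ε) refl

AwayFromZero : (ℕ → ℚ) → Set
AwayFromZero x = ∃[ δ ] 0ℚ < δ × Eventually (λ n → δ ≤ ∣ x n ∣)

inv-cauchy : ∀ {x} → AwayFromZero x → IsCauchy x → IsCauchy (inv ∘ x)
inv-cauchy {x} (δ , 0<δ , N , δ≤x) c = scale (D * D) (0<* 0<D 0<D) λ ε 0<ε →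
  let M , close = modulus c ε 0<ε
  in N ℕ.⊔ M , λ m n ≤m ≤n →
    let δ≤xm = δ≤x m (⊔≤ˡ ≤m); δ≤xn = δ≤x n (⊔≤ˡ ≤n) in ≤-trans
    (≤-reflexive (trans (cong ∣_∣ (difference (x m) (x n) (≢0 δ≤xm) (≢0 δ≤xn)))
      (trans (∣p*q∣≡∣p∣*∣q∣ (inv (x m) * inv (x n)) (x n - x m))
        (cong₂ _*_ (∣p*q∣≡∣p∣*∣q∣ (inv (x m)) (inv (x n))) (∣-∣-comm (x n) (x m))))))
    (*-mono-0≤ (0≤∣p∣ (x m - x n)) (<⇒≤ (0<* 0<D 0<D))
      (*-mono-0≤ (0≤∣p∣ (inv (x n))) (<⇒≤ 0<D) (∣inv∣≤D δ≤xm) (∣inv∣≤D δ≤xn))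
      (<⇒≤ (close m n (⊔≤ʳ {N} ≤m) (⊔≤ʳ {N} ≤n))))
  where
  open +-*-Solver
  D = inv δ
  0<D : 0ℚ < D
  0<D = 0<inv 0<δ
  ≢0 : ∀ {q} → δ ≤ ∣ q ∣ → q ≢ 0ℚ
  ≢0 δ≤∣q∣ refl = <-irrefl refl (<-≤-trans 0<δ δ≤∣q∣)
  ∣inv∣≤D : ∀ {q} → δ ≤ ∣ q ∣ → ∣ inv q ∣ ≤ D
  ∣inv∣≤D {q} δ≤∣q∣ = ≤-trans
    (≤-reflexive (sym (trans (cong (∣ inv q ∣ *_) (trans (*-comm δ D) (inv-inverse {δ} λ δ≡0 → <-irrefl (sym δ≡0) 0<δ)))
                             (*-identityʳ ∣ inv q ∣))))
    (≤-trans (*-monoˡ-≤-nonNeg ∣ inv q ∣ {{nonNegative (0≤∣p∣ (inv q))}} (*-monoʳ-0≤ (<⇒≤ 0<D) δ≤∣q∣))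
    (≤-reflexive (trans (sym (*-assoc ∣ inv q ∣ ∣ q ∣ D))
      (trans (cong (_* D) (trans (sym (∣p*q∣≡∣p∣*∣q∣ (inv q) q)) (cong ∣_∣ (inv-inverse (≢0 δ≤∣q∣)))))
             (*-identityˡ D)))))
  difference : ∀ p q → p ≢ 0ℚ → q ≢ 0ℚ → inv p - inv q ≡ (inv p * inv q) * (q - p)
  difference p q p≢0 q≢0 = sym (trans
    (solve 4 (λ i j p q → (i :* j) :* (q :- p) := i :* (j :* q) :- j :* (i :* p)) refl (inv p) (inv q) p q)
    (cong₂ _-_ (trans (cong (inv p *_) (inv-inverse q≢0)) (*-identityʳ (inv p)))
               (trans (cong (inv q *_) (inv-inverse p≢0)) (*-identityʳ (inv q)))))

-- qᵏ / k!
expTerm : ℚ → ℕ → ℚ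
expTerm q zero    = 1ℚ
expTerm q (suc k) = expTerm q k * (q * (+ 1 / suc k))

-- ∑_{k < n} qᵏ / k!
expSum : ℚ → ℕ → ℚ
expSum q zero    = 0ℚ
expSum q (suc n) = expSum q n + expTerm q n

expTerm-cauchy : ∀ {x} → IsCauchy x → ∀ k → IsCauchy (λ n → expTerm (x n) k)
expTerm-cauchy c zero    = const-cauchy 1ℚ
expTerm-cauchy c (suc k) = *-cauchy (expTerm-cauchy c k) (*-cauchy c (const-cauchy (+ 1 / suc k)))

expSum-cauchy : ∀ {x} → IsCauchy x → ∀ k → IsCauchy (λ n → expSum (x n) k)
expSum-cauchy c zero    = const-cauchy 0ℚ
expSum-cauchy c (suc k) = +-cauchy (expSum-cauchy c k) (expTerm-cauchy c k)

0≤1/suc : ∀ k → 0ℚ ≤ + 1 / suc k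
0≤1/suc k = nonNegative⁻¹ _ {{normalize-nonNeg 1 (suc k)}}

∣factor∣ : ∀ q k → ∣ q * (+ 1 / suc k) ∣ ≡ ∣ q ∣ * (+ 1 / suc k)
∣factor∣ q k = trans (∣p*q∣≡∣p∣*∣q∣ q (+ 1 / suc k)) (cong (∣ q ∣ *_) (0≤p⇒∣p∣≡p (0≤1/suc k)))

expTerm-nonNeg : ∀ {B} → 0ℚ ≤ B → ∀ k → 0ℚ ≤ expTerm B k
expTerm-nonNeg 0≤B zero    = nonNegative⁻¹ 1ℚ
expTerm-nonNeg 0≤B (suc k) = 0≤* (expTerm-nonNeg 0≤B k) (0≤* 0≤B (0≤1/suc k))

expTerm-mono : ∀ {q B} → ∣ q ∣ ≤ B → ∀ k → ∣ expTerm q k ∣ ≤ expTerm B k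
expTerm-mono         q≤B zero    = ≤-refl
expTerm-mono {q} {B} q≤B (suc k) = ≤-trans
  (≤-reflexive (trans (∣p*q∣≡∣p∣*∣q∣ (expTerm q k) _) (cong (∣ expTerm q k ∣ *_) (∣factor∣ q k))))
  (*-mono-0≤ (0≤* (0≤∣p∣ q) (0≤1/suc k)) (expTerm-nonNeg (≤-trans (0≤∣p∣ q) q≤B) k)
    (expTerm-mono q≤B k) (*-monoʳ-0≤ (0≤1/suc k) q≤B))

module Tail {q B M} (q≤B : ∣ q ∣ ≤ B) (2B≤M : 2ℚ * B ≤ fromℕ M) where
  open +-*-Solver

  term : ℕ → ℚ
  term k = ∣ expTerm q k ∣

  halve : ∀ {k} → M ℕ.≤ k → 2ℚ * term (suc k) ≤ term k
  halve {k} M≤k = ≤-trans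
    (≤-reflexive (trans
      (cong (2ℚ *_) (trans (∣p*q∣≡∣p∣*∣q∣ (expTerm q k) _) (cong (term k *_) (∣factor∣ q k))))
      (solve 3 (λ t q r → con 2ℚ :* (t :* (q :* r)) := t :* (r :* (con 2ℚ :* q))) refl
        (term k) ∣ q ∣ (+ 1 / suc k))))
    (≤-trans
      (*-monoˡ-≤-nonNeg (term k) {{nonNegative (0≤∣p∣ (expTerm q k))}}
        (*-monoˡ-≤-nonNeg (+ 1 / suc k) {{nonNegative (0≤1/suc k)}}
          (≤-trans (*-monoˡ-≤-nonNeg 2ℚ q≤B)
            (≤-trans 2B≤M (fromℕ-mono (ℕ.m≤n⇒m≤1+n M≤k))))))
      (≤-reflexive (trans (cong (term k *_) (1/suc*suc k)) (*-identityʳ (term k)))))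

  tail : ∀ {L} → M ℕ.≤ L → ∀ j →
         ∣ expSum q (j ℕ.+ L) - expSum q L ∣ + 2ℚ * term (j ℕ.+ L) ≤ 2ℚ * term L
  tail {L} M≤L zero = ≤-reflexive (trans (cong (_+ 2ℚ * term L) (cong ∣_∣ (+-inverseʳ (expSum q L))))
                                         (+-identityˡ (2ℚ * term L)))
  tail {L} M≤L (suc j) = ≤-trans
    (+-mono-≤ (≤-trans (≤-reflexive (cong ∣_∣ (regroup (expSum q k) (expTerm q k) (expSum q L))))
                       (∣p+q∣≤∣p∣+∣q∣ (expSum q k - expSum q L) (expTerm q k)))
              (halve (ℕ.≤-trans M≤L (ℕ.m≤n+m L j))))
    (≤-trans (≤-reflexive (collect ∣ expSum q k - expSum q L ∣ (term k))) (tail M≤L j))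
    where
    k = j ℕ.+ L
    regroup : ∀ a b c → (a + b) - c ≡ (a - c) + b
    regroup = solve 3 (λ a b c → (a :+ b) :- c := (a :- c) :+ b) refl
    collect : ∀ a b → (a + b) + b ≡ a + 2ℚ * b
    collect = solve 2 (λ a b → (a :+ b) :+ b := a :+ con 2ℚ :* b) refl

  remainder : ∀ {L n} → M ℕ.≤ L → L ℕ.≤ n → ∣ expSum q n - expSum q L ∣ ≤ 2ℚ * term L
  remainder {L} {n} M≤L L≤n with ℕ.m∸n+n≡m L≤n | tail M≤L (n ℕ.∸ L)
  ... | eq | t rewrite eq = ≤-trans
    (≤-trans (≤-reflexive (sym (+-identityʳ _)))
             (+-monoʳ-≤ ∣ expSum q n - expSum q L ∣ (0≤* (nonNegative⁻¹ 2ℚ) (0≤∣p∣ (expTerm q n)))))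
    t

  decay : ∀ j → fromℕ (suc j) * term (j ℕ.+ M) ≤ term M
  decay zero = ≤-reflexive (*-identityˡ (term M))
  decay (suc j) = ≤-trans
    (*-monoʳ-0≤ (0≤∣p∣ (expTerm q (suc (j ℕ.+ M)))) bound)
    (≤-trans (≤-reflexive (*-assoc (fromℕ (suc j)) 2ℚ _))
    (≤-trans (*-monoˡ-≤-nonNeg (fromℕ (suc j)) {{normalize-nonNeg (suc j) 1}} (halve (ℕ.m≤n+m M j)))
             (decay j)))
    where
    bound : fromℕ (suc (suc j)) ≤ fromℕ (suc j) * 2ℚ
    bound = ≤-trans (≤-reflexive (fromℕ-suc (suc j)))
      (≤-trans (+-monoʳ-≤ (fromℕ (suc j)) (fromℕ-mono {1} {suc j} (ℕ.s≤s ℕ.z≤n)))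
        (≤-reflexive (solve 1 (λ a → a :+ a := a :* con 2ℚ) refl (fromℕ (suc j)))))

exp-cauchy : ∀ {x} → IsCauchy x → IsCauchy (λ n → expSum (x n) n)
exp-cauchy {x} c =
  let B , 0<B , N , x≤B = bounded c
      M , 2B≤M = archimedean (2ℚ * B)
  in scale 5ℚ (positive⁻¹ 5ℚ) λ ε 0<ε →
    let T         = expTerm B M
        j , T/ε≤j = archimedean (T * inv ε)
        L         = j ℕ.+ M
        K , close = modulus (expSum-cauchy c L) ε 0<ε
        T≤        : T ≤ fromℕ (suc j) * ε
        T≤        = ≤-trans (≤-reflexive (sym (trans (*-assoc T (inv ε) ε)
                      (trans (cong (T *_) (inv-inverse {ε} λ ε≡0 → <-irrefl (sym ε≡0) 0<ε)) (*-identityʳ T)))))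
                      (*-monoʳ-0≤ (<⇒≤ 0<ε) (≤-trans T/ε≤j (fromℕ-mono (ℕ.n≤1+n j))))
        small     : ∀ n → N ℕ.≤ n → L ℕ.≤ n → ∣ expSum (x n) n - expSum (x n) L ∣ ≤ 2ℚ * ε
        small     = λ n N≤n L≤n →
          let open Tail {x n} {B} {M} (x≤B n N≤n) 2B≤M in
          ≤-trans (remainder (ℕ.m≤n+m M j) L≤n)
            (*-monoˡ-≤-nonNeg 2ℚ
              (*-cancelˡ-≤-pos (fromℕ (suc j)) {{normalize-pos (suc j) 1}}
                (≤-trans (decay j) (≤-trans (expTerm-mono (x≤B n N≤n) M) T≤))))
    in N ℕ.⊔ (L ℕ.⊔ K) , λ m n ≤m ≤n → ≤-trans
       (triangle₃ (expSum (x m) m) (expSum (x m) L) (expSum (x n) L) (expSum (x n) n))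
       (≤-trans (+-mono-≤ (+-mono-≤
           (small m (⊔≤ˡ ≤m) (⊔≤ˡ (⊔≤ʳ {N} ≤m)))
           (<⇒≤ (close m n (⊔≤ʳ {L} (⊔≤ʳ {N} ≤m)) (⊔≤ʳ {L} (⊔≤ʳ {N} ≤n)))))
           (≤-trans (≤-reflexive (∣-∣-comm (expSum (x n) L) (expSum (x n) n)))
                    (small n (⊔≤ˡ ≤n) (⊔≤ˡ (⊔≤ʳ {N} ≤n)))))
         (≤-reflexive (solve 1 (λ e → con 2ℚ :* e :+ e :+ con 2ℚ :* e := con 5ℚ :* e) refl ε)))
  where
  open +-*-Solver
  5ℚ : ℚ
  5ℚ = 2ℚ + 1ℚ + 2ℚ

record ℝ : Set where
  constructor mkℝ
  field
    seq    : ℕ → ℚ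
    cauchy : IsCauchy seq

open ℝ public

infix  4 _≤ᴿ_ _≥ᴿ_ _<ᴿ_ _≃ᴿ_
infixl 6 _+ᴿ_ _-ᴿ_
infixl 7 _*ᴿ_

ι : ℚ → ℝ
ι q = mkℝ (λ _ → q) (const-cauchy q)

_+ᴿ_ _-ᴿ_ _*ᴿ_ : ℝ → ℝ → ℝ
x +ᴿ y = mkℝ (λ n → seq x n + seq y n) (+-cauchy (cauchy x) (cauchy y))
x -ᴿ y = mkℝ (λ n → seq x n - seq y n) (+-cauchy (cauchy x) (neg-cauchy (cauchy y)))
x *ᴿ y = mkℝ (λ n → seq x n * seq y n) (*-cauchy (cauchy x) (cauchy y))

invᴿ : (x : ℝ) → AwayFromZero (seq x) → ℝ
invᴿ x x#0 = mkℝ (inv ∘ seq x) (inv-cauchy x#0 (cauchy x))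

-- The diagonal n ↦ ∑_{k < n} xₙᵏ / k! converges to the sum of the exponential
-- series, which converges uniformly on bounded sets.
exp : ℝ → ℝ
exp x = mkℝ (λ n → expSum (seq x n) n) (exp-cauchy (cauchy x))

_≤ᴿ_ _≥ᴿ_ _<ᴿ_ _≃ᴿ_ : ℝ → ℝ → Set
x ≤ᴿ y = ∀ ε → 0ℚ < ε → Eventually (λ n → seq x n ≤ seq y n + ε)
x ≥ᴿ y = y ≤ᴿ x
x <ᴿ y = ∃[ ε ] 0ℚ < ε × Eventually (λ n → seq x n + ε ≤ seq y n)
x ≃ᴿ y = x ≤ᴿ y × y ≤ᴿ x

x-1#0 : ∀ {x} → x <ᴿ ι 1ℚ → AwayFromZero (seq (x -ᴿ ι 1ℚ))
x-1#0 {x} (ε , 0<ε , N , x+ε≤1) = ε , 0<ε , N , λ n N≤n →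
  ≤-trans (≤-reflexive (shift (seq x n) ε))
  (≤-trans (+-monoˡ-≤ (- seq x n) (x+ε≤1 n N≤n))
  (≤-trans (p≤∣p∣ (1ℚ - seq x n)) (≤-reflexive (∣-∣-comm 1ℚ (seq x n)))))
  where
  open +-*-Solver
  shift : ∀ a e → e ≡ (a + e) - a
  shift = solve 2 (λ a e → e := (a :+ e) :- a) refl

f : (x : ℝ) → x <ᴿ ι 1ℚ → ℝ
f x x<1 = ι ½ *ᴿ (ι 1ℚ -ᴿ x) *ᴿ (ι 1ℚ -ᴿ exp (ι (1ℚ + 1ℚ) *ᴿ x *ᴿ invᴿ (x -ᴿ ι 1ℚ) (x-1#0 {x} x<1)))

-- α ≥ β ≥ γ ≥ 0 and α + β + γ = 1 imply β ≤ 1/2, so that f is defined at β.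
β<1 : ∀ {α β γ} → α ≥ᴿ β → γ ≥ᴿ ι 0ℚ → α +ᴿ β +ᴿ γ ≃ᴿ ι 1ℚ → β <ᴿ ι 1ℚ
β<1 {α} {β} {γ} α≥β γ≥0 (sum≤1 , _) =
  let N₁ , h₁ = α≥β δ 0<δ
      N₂ , h₂ = γ≥0 δ 0<δ
      N₃ , h₃ = sum≤1 δ 0<δ
  in δ , 0<δ , N₁ ℕ.⊔ (N₂ ℕ.⊔ N₃) , λ n N≤n →
     lemma (seq α n) (seq β n) (seq γ n)
       (h₁ n (⊔≤ˡ N≤n)) (h₂ n (⊔≤ˡ (⊔≤ʳ {N₁} N≤n))) (h₃ n (⊔≤ʳ {N₂} (⊔≤ʳ {N₁} N≤n)))
  where
  open +-*-Solver
  δ : ℚ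
  δ = + 1 / 5
  0<δ : 0ℚ < δ
  0<δ = positive⁻¹ δ
  lemma : ∀ a b c → b ≤ a + δ → 0ℚ ≤ c + δ → a + b + c ≤ 1ℚ + δ → b + δ ≤ 1ℚ
  lemma a b c b≤a 0≤c s = *-cancelˡ-≤-pos 2ℚ (≤-trans
    (≤-reflexive (solve 1 (λ b → con 2ℚ :* (b :+ con δ) := (b :+ con 0ℚ) :+ b :+ con (2ℚ * δ)) refl b))
    (≤-trans (+-monoˡ-≤ (2ℚ * δ) (+-monoˡ-≤ b (+-mono-≤ b≤a 0≤c)))
    (≤-trans (≤-reflexive (solve 3 (λ a b c → (a :+ con δ :+ (c :+ con δ)) :+ b :+ con (2ℚ * δ)
                := (a :+ b :+ c) :+ con (2ℚ * (2ℚ * δ))) refl a b c))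
             (+-monoˡ-≤ (2ℚ * (2ℚ * δ)) s))))

record Sorted∈S (α β γ : ℝ) : Set where
  field
    α≥β   : α ≥ᴿ β
    β≥γ   : β ≥ᴿ γ
    γ≥0   : γ ≥ᴿ ι 0ℚ
    sum≃1 : α +ᴿ β +ᴿ γ ≃ᴿ ι 1ℚ
    γ≥fβ  : γ ≥ᴿ f β (β<1 {α} {β} {γ} α≥β γ≥0 sum≃1)

-- v = P (α , β , γ)ᵀ for a permutation matrix P exactly when (α , β , γ) lists
-- the entries of v in some order.
S : Pred (Vector ℝ 3) 0ℓ
S v = Σ[ π ∈ Permutation′ 3 ] Sorted∈S (v (π ⟨$⟩ʳ 0F)) (v (π ⟨$⟩ʳ 1F)) (v (π ⟨$⟩ʳ 2F))
-- An edge has two ends (e , false) and (e , true), so that a loop contributes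
-- two ends at its vertex; the order of the ends carries no meaning.
record Gadget : Set₁ where
  field
    V E      : Set
    finite-V : ∃[ n ] (V ↔ Fin n)
    finite-E : ∃[ m ] (E ↔ Fin m)
    endpoint : E → Bool → V
    half     : Fin 4 → V

  End : Set
  End = (E × Bool) ⊎ Fin 4

  vertexOf : End → V
  vertexOf = [ uncurry endpoint , half ]′

  field
    regular : ∀ v → (Σ[ x ∈ End ] vertexOf x ≡ v) ↔ Fin 4

-- A perfect matching of the four ends at every vertex.
record Matching (G : Gadget) : Set where
  open Gadget G
  field
    mate            : End → End
    mate-involutive : ∀ x → mate (mate x) ≡ x
    mate-irrefl     : ∀ x → mate x ≢ x
    mate-local      : ∀ x → vertexOf (mate x) ≡ vertexOf x

module _ {G : Gadget} (μ : Matching G) where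
  open Gadget G
  open Matching μ

  -- Trail x es h: following the matching after arriving at a vertex along the
  -- end x, one travels the edges es and leaves through the half-edge h.
  data Trail : End → List E → Fin 4 → Set where
    stop : ∀ {x h} → mate x ≡ inj₂ h → Trail x [] h
    step : ∀ {x e s es h} → mate x ≡ inj₁ (e , s) →
           Trail (inj₁ (e , not s)) es h → Trail x (e ∷ es) h

-- Since mate is an involution without fixed points, trails from distinct
-- half-edges to distinct half-edges never repeat an edge nor share one, so
-- covers says that every edge is travelled exactly once, that is, that the
-- matching has no closed trails.
record ValidRoutes (G : Gadget) (a b c d : Fin 4) : Set where
  open Gadget G
  field
    matching      : Matching G
    {edges₁}      : List E
    {edges₂}      : List E
    route₁        : Trail matching (inj₂ a) edges₁ b
    route₂        : Trail matching (inj₂ c) edges₂ d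
    covers        : ∀ e → e ∈ edges₁ ⊎ e ∈ edges₂

-- VR({a,b},{c,d}); a valid set of routes is determined by its matching.
VR : Gadget → (a b c d : Fin 4) → Setoid 0ℓ 0ℓ
VR G a b c d = record
  { Carrier       = ValidRoutes G a b c d
  ; _≈_           = λ r s → ∀ x → mate (matching r) x ≡ mate (matching s) x
  ; isEquivalence = record
    { refl  = λ _ → refl
    ; sym   = λ p x → sym (p x)
    ; trans = λ p q x → trans (p x) (q x)
    }
  }
  where
  open Matching
  open ValidRoutes

HasCardinality : Setoid 0ℓ 0ℓ → ℕ → Set
HasCardinality A n = Inverse A (≡.setoid (Fin n))

record HasSignature (G : Gadget) (α β γ : ℚ) : Set where
  field
    a b c  : ℕ
    card-a : HasCardinality (VR G 0F 1F 2F 3F) a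
    card-b : HasCardinality (VR G 0F 2F 1F 3F) b
    card-c : HasCardinality (VR G 0F 3F 1F 2F) c

  N : ℕ
  N = a ℕ.+ b ℕ.+ c

  field
    {{N≢0}} : ℕ.NonZero N
    α≡a/N   : α ≡ + a / N
    β≡b/N   : β ≡ + b / N
    γ≡c/N   : γ ≡ + c / N

⊎-finite : ∀ {A B : Set} → ∃[ m ] (A ↔ Fin m) → ∃[ n ] (B ↔ Fin n) → ∃[ k ] ((A ⊎ B) ↔ Fin k)
⊎-finite (m , A↔m) (n , B↔n) = m ℕ.+ n , ↔-trans (A↔m ⊎-↔ B↔n) (↔-sym +↔⊎)

module _ (G₁ G₂ : Gadget) where
  module G₁ = Gadget G₁
  module G₂ = Gadget G₂

  GlueE : Set
  GlueE = (G₁.E ⊎ G₂.E) ⊎ Fin 2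

  glueEndpoint : GlueE → Bool → G₁.V ⊎ G₂.V
  glueEndpoint (inj₁ (inj₁ e)) s     = inj₁ (G₁.endpoint e s)
  glueEndpoint (inj₁ (inj₂ e)) s     = inj₂ (G₂.endpoint e s)
  glueEndpoint (inj₂ 0F)       false = inj₁ (G₁.half 3F)
  glueEndpoint (inj₂ 0F)       true  = inj₂ (G₂.half 0F)
  glueEndpoint (inj₂ 1F)       false = inj₁ (G₁.half 2F)
  glueEndpoint (inj₂ 1F)       true  = inj₂ (G₂.half 1F)

  glueHalf : Fin 4 → G₁.V ⊎ G₂.V
  glueHalf 0F = inj₁ (G₁.half 0F)
  glueHalf 1F = inj₁ (G₁.half 1F)
  glueHalf 2F = inj₂ (G₂.half 2F)
  glueHalf 3F = inj₂ (G₂.half 3F)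

  GlueEnd : Set
  GlueEnd = (GlueE × Bool) ⊎ Fin 4

  glueVertexOf : GlueEnd → G₁.V ⊎ G₂.V
  glueVertexOf = [ uncurry glueEndpoint , glueHalf ]′

  inEnd₁ : G₁.End → GlueEnd
  inEnd₁ (inj₁ (e , s)) = inj₁ (inj₁ (inj₁ e) , s)
  inEnd₁ (inj₂ 0F)      = inj₂ 0F
  inEnd₁ (inj₂ 1F)      = inj₂ 1F
  inEnd₁ (inj₂ 2F)      = inj₁ (inj₂ 1F , false)
  inEnd₁ (inj₂ 3F)      = inj₁ (inj₂ 0F , false)

  inEnd₂ : G₂.End → GlueEnd
  inEnd₂ (inj₁ (e , s)) = inj₁ (inj₁ (inj₂ e) , s)
  inEnd₂ (inj₂ 0F)      = inj₁ (inj₂ 0F , true)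
  inEnd₂ (inj₂ 1F)      = inj₁ (inj₂ 1F , true)
  inEnd₂ (inj₂ 2F)      = inj₂ 2F
  inEnd₂ (inj₂ 3F)      = inj₂ 3F

  fibre₁ : ∀ v → (Σ[ x ∈ GlueEnd ] glueVertexOf x ≡ inj₁ v) ↔ (Σ[ x ∈ G₁.End ] G₁.vertexOf x ≡ v)
  fibre₁ v = mk↔ₛ′ to from to∘from from∘to
    where
    to : ∀ {v} → (Σ[ x ∈ GlueEnd ] glueVertexOf x ≡ inj₁ v) → (Σ[ x ∈ G₁.End ] G₁.vertexOf x ≡ v)
    to (inj₁ (inj₁ (inj₁ e) , s) , refl) = inj₁ (e , s) , refl
    to (inj₁ (inj₂ 0F , false)   , refl) = inj₂ 3F , refl
    to (inj₁ (inj₂ 1F , false)   , refl) = inj₂ 2F , refl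
    to (inj₂ 0F                  , refl) = inj₂ 0F , refl
    to (inj₂ 1F                  , refl) = inj₂ 1F , refl
    to (inj₂ 2F                  , ())
    to (inj₂ 3F                  , ())
    from : ∀ {v} → (Σ[ x ∈ G₁.End ] G₁.vertexOf x ≡ v) → (Σ[ x ∈ GlueEnd ] glueVertexOf x ≡ inj₁ v)
    from (x@(inj₁ _)  , refl) = inEnd₁ x , refl
    from (x@(inj₂ 0F) , refl) = inEnd₁ x , refl
    from (x@(inj₂ 1F) , refl) = inEnd₁ x , refl
    from (x@(inj₂ 2F) , refl) = inEnd₁ x , refl
    from (x@(inj₂ 3F) , refl) = inEnd₁ x , refl
    to∘from : ∀ {v} (p : Σ[ x ∈ G₁.End ] G₁.vertexOf x ≡ v) → to (from p) ≡ p
    to∘from (inj₁ _  , refl) = refl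
    to∘from (inj₂ 0F , refl) = refl
    to∘from (inj₂ 1F , refl) = refl
    to∘from (inj₂ 2F , refl) = refl
    to∘from (inj₂ 3F , refl) = refl
    from∘to : ∀ {v} (p : Σ[ x ∈ GlueEnd ] glueVertexOf x ≡ inj₁ v) → from (to p) ≡ p
    from∘to (inj₁ (inj₁ (inj₁ e) , s) , refl) = refl
    from∘to (inj₁ (inj₂ 0F , false)   , refl) = refl
    from∘to (inj₁ (inj₂ 1F , false)   , refl) = refl
    from∘to (inj₂ 0F                  , refl) = refl
    from∘to (inj₂ 1F                  , refl) = refl
    from∘to (inj₂ 2F                  , ())
    from∘to (inj₂ 3F                  , ())

  fibre₂ : ∀ v → (Σ[ x ∈ GlueEnd ] glueVertexOf x ≡ inj₂ v) ↔ (Σ[ x ∈ G₂.End ] G₂.vertexOf x ≡ v)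
  fibre₂ v = mk↔ₛ′ to from to∘from from∘to
    where
    to : ∀ {v} → (Σ[ x ∈ GlueEnd ] glueVertexOf x ≡ inj₂ v) → (Σ[ x ∈ G₂.End ] G₂.vertexOf x ≡ v)
    to (inj₁ (inj₁ (inj₂ e) , s) , refl) = inj₁ (e , s) , refl
    to (inj₁ (inj₂ 0F , true)    , refl) = inj₂ 0F , refl
    to (inj₁ (inj₂ 1F , true)    , refl) = inj₂ 1F , refl
    to (inj₂ 2F                  , refl) = inj₂ 2F , refl
    to (inj₂ 3F                  , refl) = inj₂ 3F , refl
    from : ∀ {v} → (Σ[ x ∈ G₂.End ] G₂.vertexOf x ≡ v) → (Σ[ x ∈ GlueEnd ] glueVertexOf x ≡ inj₂ v)
    from (x@(inj₁ _)  , refl) = inEnd₂ x , refl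
    from (x@(inj₂ 0F) , refl) = inEnd₂ x , refl
    from (x@(inj₂ 1F) , refl) = inEnd₂ x , refl
    from (x@(inj₂ 2F) , refl) = inEnd₂ x , refl
    from (x@(inj₂ 3F) , refl) = inEnd₂ x , refl
    to∘from : ∀ {v} (p : Σ[ x ∈ G₂.End ] G₂.vertexOf x ≡ v) → to (from p) ≡ p
    to∘from (inj₁ _  , refl) = refl
    to∘from (inj₂ 0F , refl) = refl
    to∘from (inj₂ 1F , refl) = refl
    to∘from (inj₂ 2F , refl) = refl
    to∘from (inj₂ 3F , refl) = refl
    from∘to : ∀ {v} (p : Σ[ x ∈ GlueEnd ] glueVertexOf x ≡ inj₂ v) → from (to p) ≡ p
    from∘to (inj₁ (inj₁ (inj₂ e) , s) , refl) = refl
    from∘to (inj₁ (inj₂ 0F , true)    , refl) = refl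
    from∘to (inj₁ (inj₂ 1F , true)    , refl) = refl
    from∘to (inj₂ 2F                  , refl) = refl
    from∘to (inj₂ 3F                  , refl) = refl

  glueRegular : ∀ v → (Σ[ x ∈ GlueEnd ] glueVertexOf x ≡ v) ↔ Fin 4
  glueRegular (inj₁ v) = ↔-trans (fibre₁ v) (G₁.regular v)
  glueRegular (inj₂ v) = ↔-trans (fibre₂ v) (G₂.regular v)

  2-glue : Gadget
  2-glue = record
    { V        = G₁.V ⊎ G₂.V
    ; E        = GlueE
    ; finite-V = ⊎-finite G₁.finite-V G₂.finite-V
    ; finite-E = ⊎-finite (⊎-finite G₁.finite-E G₂.finite-E) (2 , ↔-refl)
    ; endpoint = glueEndpoint
    ; half     = glueHalf
    ; regular  = glueRegular
    }

1-p≢0 : ∀ {p} → p ≢ 1ℚ → NonZero (1ℚ - p)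
1-p≢0 {p} p≢1 = ≢-nonZero {1ℚ - p} λ 1-p≡0 → p≢1 (sym (trans (split p) (trans (cong (_+ p) 1-p≡0) (+-identityˡ p))))
  where
  open +-*-Solver
  split : ∀ p → 1ℚ ≡ (1ℚ - p) + p
  split = solve 1 (λ p → con 1ℚ := (con 1ℚ :- p) :+ p) refl

{-# OPTIONS --safe #-}

-- A gadget state of signature (α, β, γ) behaves like the element γ 1 + β s + α e of the Brauer algebra on two strands
-- with loop value 0, and the 2-glue multiplies these elements. Hence t = α / (β + γ) is additive and
-- r = (γ - β) / (γ + β) is multiplicative. Write p and q for the larger and the smaller of β and γ, scaled so that
-- p + q = 1. A sorted triple a ≥ b ≥ c lies in S iff a - c ≤ (a + c) exp (- 2 b / (a + c)); when t lies between q and p,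
-- this says |r| ≤ exp (- 2 t), which is stable under the glue. When t₃ is the smallest entry the conditions of the
-- two factors multiply directly, because (1 - v₁) (1 - v₂) / ((1 + v₁) (1 + v₂)) ≥ (1 - v₁ - v₂) / (1 + v₁ + v₂) for
-- v = t / p. When t₃ is the largest one, a factor with |r| ≤ exp (- 2 t) acts on a factor with t ≥ p as a shift of t,
-- which linear and quadratic lower bounds for exp control, and two factors with t ≥ p have so small an |r| that
-- (p₃ - q₃) t₃ ≤ q₃², which suffices.
-- Since all data are rational, b ≤ c exp (- a) for a ≥ 0 is replaced throughout by b S_n(a) ≤ c for all partial
-- sums S_n of the exponential series, and only polynomial inequalities over ℚ remain.
module Submission where

open import Data.Bool.Base using (true; false; not)
open import Data.Bool.Properties using (not-involutive)
open import Data.Empty using (⊥; ⊥-elim)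
open import Data.Fin.Base using (Fin)
open import Data.Fin.Patterns using (0F; 1F; 2F; 3F)
open import Data.Fin.Permutation using (_⟨$⟩ʳ_; _⟨$⟩ˡ_; inverseʳ; id; transpose; _∘ₚ_)
open import Data.Fin.Properties as Fin using (all?; +↔⊎; *↔×)
import Data.Integer.Base as ℤ
import Data.Integer.Properties as ℤ
open import Data.List.Base using (List; _ʳ++_; length) renaming ([] to []ˡ; _∷_ to _∷ˡ_)
open import Data.List.Membership.Propositional using (_∈_)
open import Data.List.Relation.Unary.Any using (here; there)
open import Data.List.Relation.Unary.Any.Properties using (reverse⁻)
open import Data.Maybe.Base using (Maybe; just; nothing)
import Data.Maybe.Properties as Maybe
open import Data.Nat.Base as ℕ using (ℕ; zero; suc)
import Data.Nat.Properties as ℕ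
open import Data.Product.Base using (_×_; _,_; ∃-syntax; proj₁; proj₂)
open import Data.Rational.Base
open import Data.Rational.Properties
open import Data.Rational.Solver using (module +-*-Solver)
import Data.Rational.Unnormalised.Base as ℚᵘ
import Data.Rational.Unnormalised.Properties as ℚᵘ
open import Data.Sum.Base as Sum using (inj₁; inj₂; _⊎_; [_,_]′)
open import Data.Sum.Function.Propositional using (_⊎-↔_)
open import Data.Sum.Properties using (inj₁-injective; inj₂-injective)
open import Data.Vec.Functional using (_∷_; [])
open import Defs
open import Function.Base using (_∘_)
open import Function.Bundles using (_↔_; Inverse; mk↔ₛ′)
open import Function.Properties.Inverse using (↔-sym; ↔-trans)
open import Level using (0ℓ)
open import Relation.Binary.Bundles using (Setoid)
open import Relation.Binary.PropositionalEquality
open import Relation.Nullary using (Dec; yes; no)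
open import Relation.Nullary.Decidable using (toWitness; _×-dec_)
open +-*-Solver

-- Partial sums of the exponential series

-- Substituting `1 - b = a + c` makes the condition `c ≥ f(b)` homogeneous in the triple, which is
-- what permits the scaling to `p + q = 1`. The difficulty is that this condition changes its form
-- with the rank of `t` among the three entries, while the rank of `t₃` does not determine the ranks
-- of `t₁` and `t₂`. Each form is therefore also established outside its own range wherever a factor
-- may need it. Partial sums can stand in for the exponential because the truncations of
-- `exp a * exp b` and of `exp (a + b)` bracket each other up to a shift of index, and the
-- hypotheses hold for every index. On the side of the gadgets, the absence of closed trails is used
-- in the form that every end leads out to a half-edge. Unlike a list of covered edges, this form
-- can be cut at the two glued edges and put together again.

0≤1 : 0ℚ ≤ 1ℚ
0≤1 = nonNegative⁻¹ 1ℚ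

0≤2 : 0ℚ ≤ 2ℚ
0≤2 = nonNegative⁻¹ 2ℚ

0≤+ : ∀ {p q} → 0ℚ ≤ p → 0ℚ ≤ q → 0ℚ ≤ p + q
0≤+ {p} {q} 0≤p 0≤q = subst (_≤ p + q) (+-identityˡ 0ℚ) (+-mono-≤ 0≤p 0≤q)

0≤diff : ∀ {p q} → p ≤ q → 0ℚ ≤ q - p
0≤diff {p} {q} p≤q = subst (_≤ q - p) (+-inverseʳ p) (+-monoˡ-≤ (- p) p≤q)

≤-by : ∀ {p q d} → 0ℚ ≤ d → q ≡ p + d → p ≤ q
≤-by {p} {q} {d} 0≤d q≡p+d = subst₂ _≤_ (+-identityʳ p) (sym q≡p+d) (+-monoʳ-≤ p 0≤d)

*-monoˡ-0≤ : ∀ {p q r} → 0ℚ ≤ r → p ≤ q → r * p ≤ r * q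
*-monoˡ-0≤ {r = r} 0≤r = *-monoˡ-≤-nonNeg r {{nonNegative 0≤r}}

cancelʳ-≤ : ∀ {p q} r → 0ℚ < r → p * r ≤ q * r → p ≤ q
cancelʳ-≤ r 0<r = *-cancelʳ-≤-pos r {{positive 0<r}}

cancelʳ-≡ : ∀ {p q} r → 0ℚ < r → p * r ≡ q * r → p ≡ q
cancelʳ-≡ r 0<r pr≡qr = ≤-antisym (cancelʳ-≤ r 0<r (≤-reflexive pr≡qr)) (cancelʳ-≤ r 0<r (≤-reflexive (sym pr≡qr)))

expTerm-suc : ∀ q k → fromℕ (suc k) * expTerm q (suc k) ≡ q * expTerm q k
expTerm-suc q k = trans
  (solve 4 (λ n t q i → n :* (t :* (q :* i)) := (i :* n) :* (q :* t)) refl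
    (fromℕ (suc k)) (expTerm q k) q (ℤ.+ 1 / suc k))
  (trans (cong (_* (q * expTerm q k)) (1/suc*suc k)) (*-identityˡ (q * expTerm q k)))

0<fromℕ-suc : ∀ k → 0ℚ < fromℕ (suc k)
0<fromℕ-suc k = positive⁻¹ _ {{normalize-pos (suc k) 1}}

fromℕ-+ : ∀ m n → fromℕ (m ℕ.+ n) ≡ fromℕ m + fromℕ n
fromℕ-+ zero    n = sym (+-identityˡ (fromℕ n))
fromℕ-+ (suc m) n = trans (fromℕ-suc (m ℕ.+ n)) (trans (cong (_+ 1ℚ) (fromℕ-+ m n))
  (trans (solve 2 (λ m n → m :+ n :+ con 1ℚ := m :+ con 1ℚ :+ n) refl (fromℕ m) (fromℕ n))
         (cong (_+ fromℕ n) (sym (fromℕ-suc m)))))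

module _ (a b : ℚ) where

  -- ∑_{k ≤ i} aⁱ⁻ᵏ/(i-k)! · bʲ⁺ᵏ/(j+k)!
  convolve : ℕ → ℕ → ℚ
  convolve zero    j = expTerm a 0 * expTerm b j
  convolve (suc i) j = expTerm a (suc i) * expTerm b j + convolve i (suc j)

  -- Each product of a term in `a` and a term in `b` arises from its two neighbours, and
  -- `expTerm-suc` weights these by its two degrees, which add up to `suc i + j`. Only the leading
  -- product lacks a neighbour; the extra summand supplies its missing weight `j`.
  convolve-suc : ∀ i j → (a + b) * convolve i j + fromℕ j * (expTerm a (suc i) * expTerm b j)
                 ≡ fromℕ (suc i ℕ.+ j) * convolve (suc i) j
  convolve-suc zero j = trans
    (solve 6 (λ a b j x y z → (a :+ b) :* (con 1ℚ :* y) :+ j :* (x :* y)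
                := (a :* con 1ℚ) :* y :+ b :* y :+ j :* (x :* y)) refl a b (fromℕ j) (expTerm a 1) (expTerm b j) (expTerm b (suc j)))
    (trans (cong₂ (λ u v → u * expTerm b j + v + fromℕ j * (expTerm a 1 * expTerm b j))
              (sym (expTerm-suc a 0)) (sym (expTerm-suc b j)))
    (trans (cong (λ m → 1ℚ * expTerm a 1 * expTerm b j + m * expTerm b (suc j) + fromℕ j * (expTerm a 1 * expTerm b j)) (fromℕ-suc j))
    (trans (solve 4 (λ j x y z → con 1ℚ :* x :* y :+ (j :+ con 1ℚ) :* z :+ j :* (x :* y)
                      := (j :+ con 1ℚ) :* (x :* y :+ con 1ℚ :* z)) refl
             (fromℕ j) (expTerm a 1) (expTerm b j) (expTerm b (suc j)))
           (cong (_* convolve 1 j) (sym (fromℕ-suc j))))))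
  convolve-suc (suc i) j = trans
    (solve 7 (λ a b j x y z c → (a :+ b) :* (x :* y :+ c) :+ j :* (z :* y)
        := (a :* x) :* y :+ (b :* y) :* x :+ ((a :+ b) :* c) :+ j :* (z :* y)) refl
        a b (fromℕ j) (expTerm a (suc i)) (expTerm b j) (expTerm a (suc (suc i))) (convolve i (suc j)))
    (trans (cong₂ (λ u v → u * expTerm b j + v * expTerm a (suc i) + (a + b) * convolve i (suc j)
                             + fromℕ j * (expTerm a (suc (suc i)) * expTerm b j))
              (sym (expTerm-suc a (suc i))) (sym (expTerm-suc b j)))
    (trans (solve 8 (λ n m j x y z w c → n :* z :* y :+ m :* w :* x :+ c :+ j :* (z :* y)
              := (n :+ j) :* (z :* y) :+ (c :+ m :* (x :* w))) refl
              (fromℕ (suc (suc i))) (fromℕ (suc j)) (fromℕ j) (expTerm a (suc i)) (expTerm b j)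
              (expTerm a (suc (suc i))) (expTerm b (suc j)) ((a + b) * convolve i (suc j)))
    (trans (cong₂ _+_ (cong (_* (expTerm a (suc (suc i)) * expTerm b j)) (sym (fromℕ-+ (suc (suc i)) j)))
                      (trans (convolve-suc i (suc j))
                             (cong (λ m → fromℕ (suc m) * convolve (suc i) (suc j)) (ℕ.+-suc i j))))
           (sym (*-distribˡ-+ (fromℕ (suc (suc i) ℕ.+ j)) (expTerm a (suc (suc i)) * expTerm b j)
                  (convolve (suc i) (suc j)))))))

  binomial : ∀ n → convolve n 0 ≡ expTerm (a + b) n
  binomial zero    = refl
  binomial (suc n) = cancelʳ-≡ (fromℕ (suc n)) (0<fromℕ-suc n) (trans
    (trans (*-comm _ (fromℕ (suc n)))
    (trans (cong (λ m → fromℕ (suc m) * convolve (suc n) 0) (sym (ℕ.+-identityʳ n)))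
    (trans (sym (convolve-suc n 0))
    (trans (cong ((a + b) * convolve n 0 +_) (*-zeroˡ (expTerm a (suc n) * expTerm b 0)))
    (trans (+-identityʳ _) (cong ((a + b) *_) (binomial n)))))))
    (trans (sym (expTerm-suc (a + b) n)) (*-comm (fromℕ (suc n)) _)))

  -- ∑_{k ≤ i} aⁱ⁻ᵏ/(i-k)! · S_{j+k}(b), where S_n is the n-th partial sum of exp.
  triangle : ℕ → ℕ → ℚ
  triangle zero    j = expTerm a 0 * expSum b j
  triangle (suc i) j = expTerm a (suc i) * expSum b j + triangle i (suc j)

  triangle-suc : ∀ i j → triangle i (suc j) ≡ triangle i j + convolve i j
  triangle-suc zero    j = *-distribˡ-+ (expTerm a 0) (expSum b j) (expTerm b j)
  triangle-suc (suc i) j = trans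
    (cong ((expTerm a (suc i) * expSum b (suc j)) +_) (triangle-suc i (suc j)))
    (solve 5 (λ x s y u v → x :* (s :+ y) :+ (u :+ v) := (x :* s :+ u) :+ (x :* y :+ v)) refl
       (expTerm a (suc i)) (expSum b j) (expTerm b j) (triangle i (suc j)) (convolve i (suc j)))

  -- `triangle n 0` collects the products whose degrees add up to less than `n`, so passing to
  -- `suc n` adds one antidiagonal, which `binomial` evaluates.
  expSum-+ : ∀ n → triangle n 0 ≡ expSum (a + b) n
  expSum-+ zero    = refl
  expSum-+ (suc n) = trans (cong (_+ triangle n 1) (*-zeroʳ (expTerm a (suc n))))
    (trans (+-identityˡ (triangle n 1))
    (trans (triangle-suc n 0) (cong₂ _+_ (expSum-+ n) (binomial n))))

expSum-nonNeg : ∀ {a} → 0ℚ ≤ a → ∀ n → 0ℚ ≤ expSum a n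
expSum-nonNeg 0≤a zero    = ≤-refl
expSum-nonNeg 0≤a (suc n) = 0≤+ (expSum-nonNeg 0≤a n) (expTerm-nonNeg 0≤a n)

expSum-monoⁿ : ∀ {a} → 0ℚ ≤ a → ∀ m n → expSum a n ≤ expSum a (m ℕ.+ n)
expSum-monoⁿ 0≤a zero    n = ≤-refl
expSum-monoⁿ 0≤a (suc m) n = ≤-trans (expSum-monoⁿ 0≤a m n) (≤-by (expTerm-nonNeg 0≤a (m ℕ.+ n)) refl)

expTerm-monoᵃ : ∀ {a b} → 0ℚ ≤ a → a ≤ b → ∀ n → expTerm a n ≤ expTerm b n
expTerm-monoᵃ {a} {b} 0≤a a≤b n =
  ≤-trans (p≤∣p∣ (expTerm a n)) (expTerm-mono (subst (_≤ b) (sym (0≤p⇒∣p∣≡p 0≤a)) a≤b) n)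

expSum-monoᵃ : ∀ {a b} → 0ℚ ≤ a → a ≤ b → ∀ n → expSum a n ≤ expSum b n
expSum-monoᵃ 0≤a a≤b zero    = ≤-refl
expSum-monoᵃ 0≤a a≤b (suc n) = +-mono-≤ (expSum-monoᵃ 0≤a a≤b n) (expTerm-monoᵃ 0≤a a≤b n)

triangle≤square : ∀ {a b} → 0ℚ ≤ a → 0ℚ ≤ b → ∀ i j → triangle a b i j ≤ expSum a (suc i) * expSum b (i ℕ.+ j)
triangle≤square {a} {b} 0≤a 0≤b zero    j = ≤-reflexive (cong (_* expSum b j) {x = expTerm a 0} refl)
triangle≤square {a} {b} 0≤a 0≤b (suc i) j = ≤-trans
  (+-mono-≤ (*-monoˡ-0≤ (expTerm-nonNeg 0≤a (suc i)) (expSum-monoⁿ 0≤b (suc i) j))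
            (subst (λ m → triangle a b i (suc j) ≤ expSum a (suc i) * expSum b m) (ℕ.+-suc i j)
                   (triangle≤square 0≤a 0≤b i (suc j))))
  (≤-reflexive (solve 3 (λ x y z → x :* z :+ y :* z := (y :+ x) :* z) refl
    (expTerm a (suc i)) (expSum a (suc i)) (expSum b (suc (i ℕ.+ j)))))

-- The triangle of degree pairs with sum below `n` lies inside the rectangle of the product.
expSum-*-≥ : ∀ {a b} → 0ℚ ≤ a → 0ℚ ≤ b → ∀ n → expSum (a + b) n ≤ expSum a (suc n) * expSum b n
expSum-*-≥ {a} {b} 0≤a 0≤b n = subst₂ _≤_ (expSum-+ a b n)
  (cong (λ m → expSum a (suc n) * expSum b m) (ℕ.+-identityʳ n)) (triangle≤square 0≤a 0≤b n 0)

triangle-peel : ∀ {a b} → 0ℚ ≤ a → 0ℚ ≤ b → ∀ m i j → triangle a b i (m ℕ.+ j) ≤ triangle a b (m ℕ.+ i) j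
triangle-peel         0≤a 0≤b zero    i j = ≤-refl
triangle-peel {a} {b} 0≤a 0≤b (suc m) i j = ≤-trans
  (≤-trans (≤-reflexive (cong (triangle a b i) (sym (ℕ.+-suc m j)))) (triangle-peel 0≤a 0≤b m i (suc j)))
  (≤-by (0≤* (expTerm-nonNeg 0≤a (suc (m ℕ.+ i))) (expSum-nonNeg 0≤b j)) (+-comm _ (triangle a b (m ℕ.+ i) (suc j))))

square≤triangle : ∀ {a b} → 0ℚ ≤ a → 0ℚ ≤ b → ∀ i j → expSum a (suc i) * expSum b j ≤ triangle a b i j
square≤triangle         0≤a 0≤b zero    j = ≤-refl
square≤triangle {a} {b} 0≤a 0≤b (suc i) j = ≤-trans
  (≤-reflexive (solve 3 (λ x y z → (y :+ x) :* z := x :* z :+ y :* z) refl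
    (expTerm a (suc i)) (expSum a (suc i)) (expSum b j)))
  (+-monoʳ-≤ (expTerm a (suc i) * expSum b j) (≤-trans
    (*-monoˡ-0≤ (expSum-nonNeg 0≤a (suc i)) (expSum-monoⁿ 0≤b 1 j))
    (square≤triangle 0≤a 0≤b i (suc j))))

-- Degrees at most `m` and below `n` have a sum below `n + m`, so now the rectangle lies inside the
-- triangle.
expSum-*-≤ : ∀ {a b} → 0ℚ ≤ a → 0ℚ ≤ b → ∀ m n → expSum a (suc m) * expSum b n ≤ expSum (a + b) (n ℕ.+ m)
expSum-*-≤ {a} {b} 0≤a 0≤b m n = ≤-trans
  (subst (λ k → expSum a (suc m) * expSum b n ≤ triangle a b m k) (sym (ℕ.+-identityʳ n)) (square≤triangle 0≤a 0≤b m n))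
  (≤-trans (triangle-peel 0≤a 0≤b n m 0) (≤-reflexive (expSum-+ a b (n ℕ.+ m))))

0≤fromℕ : ∀ n → 0ℚ ≤ fromℕ n
0≤fromℕ n = nonNegative⁻¹ _ {{normalize-nonNeg n 1}}

-- No coefficient of the series of (1 - a) eᵃ beyond the constant term is positive.
expSum-1- : ∀ {a} → 0ℚ ≤ a → ∀ n → (1ℚ - a) * expSum a n ≤ 1ℚ
expSum-1- {a} 0≤a zero    = ≤-by 0≤1 (solve 1 (λ a → con 1ℚ := (con 1ℚ :- a) :* con 0ℚ :+ con 1ℚ) refl a)
expSum-1- {a} 0≤a (suc n) = ≤-trans (≤-by (0≤* 0≤a (expTerm-nonNeg 0≤a n)) refl) (sharp n)
  where
  -- Truncation leaves the incomplete top coefficient `- a * expTerm a n`. Adding it back leaves the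
  -- sum of `(1 - k) aᵏ / k!` over `k ≤ n`, and the induction step contributes the coefficient
  -- `- n`.
  sharp : ∀ n → (1ℚ - a) * expSum a (suc n) + a * expTerm a n ≤ 1ℚ
  sharp zero    = ≤-reflexive (solve 1 (λ a → (con 1ℚ :- a) :* (con 0ℚ :+ con 1ℚ) :+ a :* con 1ℚ := con 1ℚ) refl a)
  sharp (suc n) = ≤-trans
    (≤-by (0≤* (0≤fromℕ n) (expTerm-nonNeg 0≤a (suc n)))
      (trans (cong ((1ℚ - a) * expSum a (suc n) +_)
                (trans (sym (expTerm-suc a n)) (cong (_* expTerm a (suc n)) (fromℕ-suc n))))
             (solve 4 (λ a s t n → (con 1ℚ :- a) :* s :+ (n :+ con 1ℚ) :* t
                := (con 1ℚ :- a) :* (s :+ t) :+ a :* t :+ n :* t) refl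
                a (expSum a (suc n)) (expTerm a (suc n)) (fromℕ n))))
    (sharp n)

-- No coefficient of the series of (1 - x) e²ˣ beyond the linear term is positive.
expSum-1-/1+ : ∀ {x} → 0ℚ ≤ x → x ≤ 1ℚ → ∀ n → (1ℚ - x) * expSum (2ℚ * x) n ≤ 1ℚ + x
expSum-1-/1+ {x} 0≤x x≤1 n = ≤-trans
  (≤-trans (*-monoˡ-0≤ (0≤diff x≤1) (expSum-monoⁿ 0≤2x 2 n))
           (≤-by (0≤* 0≤x (expTerm-nonNeg 0≤2x (suc n))) refl))
  (sharp n)
  where
  0≤2x : 0ℚ ≤ 2ℚ * x
  0≤2x = 0≤* 0≤2 0≤x
  T : ℕ → ℚ
  T = expTerm (2ℚ * x)
  -- `x * T k` is half of `(k + 1) * T (k + 1)`, so the completed sum is that of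
  -- `(1 - k / 2) (2 x)ᵏ / k!` over `k ≤ n + 1`. The terms for `k = 0` and `k = 1` give `1 + x`, the
  -- one for `k = 2` vanishes.
  sharp : ∀ n → (1ℚ - x) * expSum (2ℚ * x) (suc (suc n)) + x * T (suc n) ≤ 1ℚ + x
  sharp zero    = ≤-reflexive (solve 1
    (λ x → (con 1ℚ :- x) :* (con 0ℚ :+ con 1ℚ :+ con 1ℚ :* (con 2ℚ :* x :* con 1ℚ)) :+ x :* (con 1ℚ :* (con 2ℚ :* x :* con 1ℚ))
             := con 1ℚ :+ x) refl x)
  sharp (suc n) = ≤-trans
    (≤-by (0≤* (0≤* (nonNegative⁻¹ ½) (0≤fromℕ n)) (expTerm-nonNeg 0≤2x (suc (suc n))))
      (trans (trans
        (solve 3 (λ x s t → (con 1ℚ :- x) :* s :+ x :* t := (con 1ℚ :- x) :* s :+ con ½ :* (con 2ℚ :* x :* t)) refl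
           x (expSum (2ℚ * x) (suc (suc n))) (T (suc n)))
        (cong (λ u → (1ℚ - x) * expSum (2ℚ * x) (suc (suc n)) + ½ * u)
           (trans (sym (expTerm-suc (2ℚ * x) (suc n)))
                  (cong (_* T (suc (suc n))) (trans (fromℕ-suc (suc n)) (cong (_+ 1ℚ) (fromℕ-suc n)))))))
        (solve 4 (λ x s t n → (con 1ℚ :- x) :* s :+ con ½ :* ((n :+ con 1ℚ :+ con 1ℚ) :* t)
            := (con 1ℚ :- x) :* (s :+ t) :+ x :* t :+ con ½ :* n :* t) refl
            x (expSum (2ℚ * x) (suc (suc n))) (T (suc (suc n))) (fromℕ n))))
    (sharp n)

∣∣≤⇒-≤ : ∀ {p q} → ∣ p ∣ ≤ q → - q ≤ p
∣∣≤⇒-≤ {p} {q} ∣p∣≤q = subst (- q ≤_) (solve 1 (λ p → :- (:- p) := p) refl p)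
  (neg-antimono-≤ (≤-trans (subst (- p ≤_) (∣-p∣≡∣p∣ p) (p≤∣p∣ (- p))) ∣p∣≤q))

≤-approx : ∀ {p q} L → 0ℚ < L → (∀ ε → 0ℚ < ε → p ≤ q + L * ε) → p ≤ q
≤-approx {p} {q} L 0<L h = ≮⇒≥ λ q<p →
  let ε    = inv L * (½ * (p - q))
      0<ε  = 0<* (0<inv 0<L) (0<* (positive⁻¹ ½) (0<-- q<p))
      Lε   : q + L * ε ≡ ½ * (p + q)
      Lε   = trans (solve 4 (λ p q l i → q :+ l :* (i :* (con ½ :* (p :- q))) := q :+ (i :* l) :* (con ½ :* (p :- q))) refl p q L (inv L))
               (trans (cong (λ u → q + u * (½ * (p - q))) (inv-inverse λ L≡0 → <-irrefl (sym L≡0) 0<L))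
                 (solve 2 (λ p q → q :+ con 1ℚ :* (con ½ :* (p :- q)) := con ½ :* (p :+ q)) refl p q))
  in <-irrefl refl (<-≤-trans q<p (≤-by (0≤* 0≤2 (0≤diff (≤-trans (h ε 0<ε) (≤-reflexive Lε))))
       (solve 2 (λ p q → q := p :+ con 2ℚ :* (con ½ :* (p :+ q) :- p)) refl p q)))
  where
  0<-- : ∀ {p q} → q < p → 0ℚ < p - q
  0<-- {p} {q} q<p = subst (_< p - q) (+-inverseʳ q) (+-monoˡ-< (- q) q<p)

expSum-abs : ∀ {a b} → ∣ a ∣ ≤ b → ∀ n → ∣ expSum a n ∣ ≤ expSum b n
expSum-abs         ∣a∣≤b zero    = ≤-refl
expSum-abs {a} {b} ∣a∣≤b (suc n) = ≤-trans (∣p+q∣≤∣p∣+∣q∣ (expSum a n) (expTerm a n))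
  (+-mono-≤ (expSum-abs ∣a∣≤b n) (expTerm-mono ∣a∣≤b n))

expSum-cauchyℚ : ∀ a → IsCauchy (expSum a)
expSum-cauchyℚ a = exp-cauchy (const-cauchy a)

-- Only the weights in `a` need a sign. Below, `b` is `- a`, whose partial sums can have either
-- sign.
triangle-≤ : ∀ {a} b {σ} → 0ℚ ≤ a → ∀ i j → (∀ k → j ℕ.≤ k → expSum b k ≤ σ) →
             triangle a b i j ≤ σ * expSum a (suc i)
triangle-≤ {a} b {σ} 0≤a zero    j h = ≤-trans (*-monoˡ-0≤ 0≤1 (h j ℕ.≤-refl)) (≤-reflexive (*-comm 1ℚ σ))
triangle-≤ {a} b {σ} 0≤a (suc i) j h = ≤-trans
  (+-mono-≤ (*-monoˡ-0≤ (expTerm-nonNeg 0≤a (suc i)) (h j ℕ.≤-refl))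
            (triangle-≤ b 0≤a i (suc j) λ k 1+j≤k → h k (ℕ.≤-trans (ℕ.n≤1+n j) 1+j≤k)))
  (≤-reflexive (solve 3 (λ x s σ → x :* σ :+ σ :* s := σ :* (s :+ x)) refl (expTerm a (suc i)) (expSum a (suc i)) σ))

triangle-≥ : ∀ {a} b {σ} → 0ℚ ≤ a → ∀ i j → (∀ k → j ℕ.≤ k → σ ≤ expSum b k) →
             σ * expSum a (suc i) ≤ triangle a b i j
triangle-≥ {a} b {σ} 0≤a zero    j h = ≤-trans (≤-reflexive (*-comm σ 1ℚ)) (*-monoˡ-0≤ 0≤1 (h j ℕ.≤-refl))
triangle-≥ {a} b {σ} 0≤a (suc i) j h = ≤-trans
  (≤-reflexive (solve 3 (λ x s σ → σ :* (s :+ x) := x :* σ :+ σ :* s) refl (expTerm a (suc i)) (expSum a (suc i)) σ))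
  (+-mono-≤ (*-monoˡ-0≤ (expTerm-nonNeg 0≤a (suc i)) (h j ℕ.≤-refl))
            (triangle-≥ b 0≤a i (suc j) λ k 1+j≤k → h k (ℕ.≤-trans (ℕ.n≤1+n j) 1+j≤k)))

-- The rows in which the two triangles differ carry the early partial sums at `b`, but their weights
-- come from the tail of the series at `a`.
triangle-head : ∀ {a} b {B} → 0ℚ ≤ a → ∀ k i j → (∀ l → l ℕ.< k ℕ.+ j → ∣ expSum b l ∣ ≤ B) →
                ∣ triangle a b (k ℕ.+ i) j - triangle a b i (k ℕ.+ j) ∣
                  ≤ (expSum a (suc (k ℕ.+ i)) - expSum a (suc i)) * B
triangle-head {a} b {B} 0≤a zero i j h = ≤-reflexive (trans
  (cong ∣_∣ (+-inverseʳ (triangle a b i j)))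
  (solve 2 (λ s B → con 0ℚ := (s :- s) :* B) refl (expSum a (suc i)) B))
triangle-head {a} b {B} 0≤a (suc k) i j h = ≤-trans
  (≤-reflexive (cong ∣_∣ (trans
    (cong (λ m → triangle a b (suc k ℕ.+ i) j - triangle a b i m) (sym (ℕ.+-suc k j)))
    (+-assoc (expTerm a (suc (k ℕ.+ i)) * expSum b j) (triangle a b (k ℕ.+ i) (suc j)) _))))
  (≤-trans (∣p+q∣≤∣p∣+∣q∣ (expTerm a (suc (k ℕ.+ i)) * expSum b j)
             (triangle a b (k ℕ.+ i) (suc j) - triangle a b i (k ℕ.+ suc j)))
  (≤-trans (+-mono-≤
      (≤-trans (≤-reflexive (trans (∣p*q∣≡∣p∣*∣q∣ (expTerm a (suc (k ℕ.+ i))) (expSum b j))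
                  (cong (_* ∣ expSum b j ∣) (0≤p⇒∣p∣≡p 0≤e))))
               (*-monoˡ-0≤ 0≤e (h j (ℕ.s≤s (ℕ.m≤n+m j k)))))
      (triangle-head b 0≤a k i (suc j) λ l l< → h l (subst (l ℕ.<_) (ℕ.+-suc k j) l<)))
    (≤-reflexive (solve 4 (λ x s t B → x :* B :+ (s :- t) :* B := (s :+ x :- t) :* B) refl
      (expTerm a (suc (k ℕ.+ i))) (expSum a (suc (k ℕ.+ i))) (expSum a (suc i)) B))))
  where
  0≤e = expTerm-nonNeg 0≤a (suc (k ℕ.+ i))

expSum-zero : ∀ n → expSum 0ℚ (suc n) ≡ 1ℚ
expSum-zero zero    = refl
expSum-zero (suc n) = trans
  (cong (expSum 0ℚ (suc n) +_) (trans (cong (expTerm 0ℚ n *_) (*-zeroˡ (ℤ.+ 1 / suc n))) (*-zeroʳ (expTerm 0ℚ n))))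
  (trans (+-identityʳ (expSum 0ℚ (suc n))) (expSum-zero n))

-- In the triangle that expands eᵃ e⁻ᵃ = 1, the terms with S_k(-a) for k ≥ K carry all but ε of the sum.
triangle-inverse : ∀ {a} → 0ℚ ≤ a → ∀ K ε → 0ℚ < ε →
                   ∃[ M ] ∀ m → M ℕ.≤ m → ∣ 1ℚ - triangle a (- a) (suc m) K ∣ ≤ ε
triangle-inverse {a} 0≤a K ε 0<ε =
  -- `B` bounds `expSum (- a) l` in absolute value for all `l < K`; the 1 keeps it positive when
  -- `K = 0`.
  let B         = expSum a K + 1ℚ
      0<B       = <-≤-trans (positive⁻¹ 1ℚ) (≤-by (expSum-nonNeg 0≤a K) (+-comm (expSum a K) 1ℚ))
      M , close = modulus (expSum-cauchyℚ a) (ε * inv B) (0<* 0<ε (0<inv 0<B))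
  in M , λ m M≤m → ≤-trans
    (≤-reflexive (cong (λ u → ∣ u - triangle a (- a) (suc m) K ∣) (sym (trans
      (expSum-+ a (- a) (K ℕ.+ suc m)) (trans (cong₂ expSum (+-inverseʳ a) (ℕ.+-suc K m)) (expSum-zero (K ℕ.+ m)))))))
    (≤-trans
      (subst (λ k → ∣ triangle a (- a) (K ℕ.+ suc m) 0 - triangle a (- a) (suc m) k ∣
                      ≤ (expSum a (suc (K ℕ.+ suc m)) - expSum a (suc (suc m))) * B) (ℕ.+-identityʳ K)
        (triangle-head (- a) 0≤a K (suc m) 0 λ l l<K → ≤-trans
          (expSum-abs (≤-reflexive (trans (∣-p∣≡∣p∣ a) (0≤p⇒∣p∣≡p 0≤a))) l)
          (≤-trans (subst (λ k → expSum a l ≤ expSum a k)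
                     (trans (ℕ.m∸n+n≡m (ℕ.<⇒≤ l<K)) (ℕ.+-identityʳ K)) (expSum-monoⁿ 0≤a (K ℕ.+ 0 ℕ.∸ l) l))
                   (≤-by 0≤1 refl))))
    (≤-trans
      (*-monoʳ-0≤ (<⇒≤ 0<B) (≤-trans (p≤∣p∣ _) (<⇒≤ (close (suc (K ℕ.+ suc m)) (suc (suc m))
        (ℕ.≤-trans M≤m (ℕ.≤-trans (ℕ.m≤n+m m (suc K)) (ℕ.≤-trans (ℕ.≤-reflexive (sym (ℕ.+-suc K m))) (ℕ.n≤1+n _))))
        (ℕ.≤-trans M≤m (ℕ.≤-trans (ℕ.n≤1+n m) (ℕ.n≤1+n _)))))))
      (≤-reflexive (trans (*-assoc ε (inv B) B)
        (trans (cong (ε *_) (inv-inverse λ B≡0 → <-irrefl (sym B≡0) 0<B)) (*-identityʳ ε))))))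

-- b ≤ c exp(-a), through the partial sums of the series at -a or at a.
module _ {a} (0≤a : 0ℚ ≤ a) (b c : ℚ) (0<c : 0ℚ < c) where

  private
    1≤expSum : ∀ n → 1ℚ ≤ expSum a (suc n)
    1≤expSum n = subst (λ k → 1ℚ ≤ expSum a k) (ℕ.+-comm n 1) (expSum-monoⁿ 0≤a n 1)

  -- The triangle that expands `exp a * exp (- a)` mediates. Its rows from `K` on carry partial sums
  -- of at least `(b - ε) / c`, so this number times a partial sum at `a` is at most the triangle,
  -- which is at most `1 + ε`. Then `ε` tends to 0.
  ≤exp-⇒ : (∀ ε → 0ℚ < ε → Eventually (λ n → b ≤ c * expSum (- a) n + ε)) → ∀ n → b * expSum a n ≤ c
  ≤exp-⇒ h n with ≤-total 0ℚ b
  ... | inj₂ b≤0 = ≤-trans (≤-trans (*-monoʳ-0≤ (expSum-nonNeg 0≤a n) b≤0) (≤-reflexive (*-zeroˡ (expSum a n)))) (<⇒≤ 0<c)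
  ... | inj₁ 0≤b =
    let C , 0<C , N , S≤C = bounded (expSum-cauchyℚ a)
    in ≤-approx (c + C) (+-mono-< 0<c 0<C) λ ε 0<ε →
    let K , lower = h ε 0<ε
        M , near  = triangle-inverse 0≤a K ε 0<ε
        m         = n ℕ.⊔ (M ℕ.⊔ N)
        S         = expSum a (suc (suc m))
        T         = triangle a (- a) (suc m) K
        ic        = inv c
        eq        : ic * c ≡ 1ℚ
        eq        = inv-inverse λ c≡0 → <-irrefl (sym c≡0) 0<c
        σ≤        : ∀ k → K ℕ.≤ k → ic * (b - ε) ≤ expSum (- a) k
        σ≤ k K≤k  = cancelʳ-≤ c 0<c (≤-by (0≤diff (lower k K≤k)) (trans
                      (solve 4 (λ b c e s → s :* c := (b :- e) :+ (c :* s :+ e :- b)) refl b c ε (expSum (- a) k))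
                      (cong (_+ (c * expSum (- a) k + ε - b)) (trans (sym (*-identityˡ (b - ε)))
                        (trans (cong (_* (b - ε)) (sym eq))
                          (solve 3 (λ i c x → i :* c :* x := i :* x :* c) refl ic c (b - ε)))))))
        bS≤       : (b - ε) * S ≤ c * T
        bS≤       = ≤-trans (≤-reflexive (trans (trans (sym (*-identityˡ _)) (cong (_* ((b - ε) * S)) (sym eq)))
                      (solve 4 (λ i c x s → i :* c :* (x :* s) := c :* (i :* x :* s)) refl ic c (b - ε) S)))
                      (*-monoˡ-0≤ (<⇒≤ 0<c) (triangle-≥ (- a) 0≤a (suc m) K σ≤))
        T≤        : T ≤ 1ℚ + ε
        T≤        = ≤-by (0≤diff (∣∣≤⇒-≤ (near m (ℕ.≤-trans (ℕ.m≤m⊔n M N) (ℕ.m≤n⊔m n _)))))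
                      (solve 2 (λ t e → con 1ℚ :+ e := t :+ (con 1ℚ :- t :- (:- e))) refl T ε)
    in ≤-trans (*-monoˡ-0≤ 0≤b (subst (λ k → expSum a n ≤ expSum a k)
                 (ℕ.m∸n+n≡m (ℕ.≤-trans (ℕ.m≤m⊔n n (M ℕ.⊔ N)) (ℕ.m≤n+m m 2))) (expSum-monoⁿ 0≤a (suc (suc m) ℕ.∸ n) n)))
       (≤-by (0≤+ (0≤diff bS≤) (0≤+ (0≤* (<⇒≤ 0<c) (0≤diff T≤))
               (0≤* (<⇒≤ 0<ε) (0≤diff (≤-trans (p≤∣p∣ S)
                 (S≤C (suc (suc m)) (ℕ.≤-trans (ℕ.m≤n⊔m M N) (ℕ.≤-trans (ℕ.m≤n⊔m n _) (ℕ.m≤n+m m 2)))))))))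
         (solve 6 (λ b c C e s t → c :+ (c :+ C) :* e
            := b :* s :+ ((c :* t :- (b :- e) :* s) :+ (c :* (con 1ℚ :+ e :- t) :+ e :* (C :- s)))) refl b c C ε S T))

  -- The same triangle, bounded from above: its rows exceed `expSum (- a) n` by at most `δ`, and it
  -- is within `δ` of 1. Each of the two errors costs `c * δ`, hence `δ = ε / (2 c)`.
  ≤exp-⇐ : (∀ n → b * expSum a n ≤ c) → ∀ ε → 0ℚ < ε → Eventually (λ n → b ≤ c * expSum (- a) n + ε)
  ≤exp-⇐ h ε 0<ε = K , λ n K≤n → ≤-trans
    (cancelʳ-≤ E 0<E (bound (expSum (- a) n) E T (h (suc (suc M))) (T≤ n K≤n)
      (≤-trans (p≤∣p∣ (1ℚ - T)) (proj₂ inverse M ℕ.≤-refl)) (1≤expSum (suc M))))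
    (≤-reflexive (cong (c * expSum (- a) n +_) 2cδ≡ε))
    where
    0<2c : 0ℚ < 2ℚ * c
    0<2c = 0<* (positive⁻¹ 2ℚ) 0<c
    δ : ℚ
    δ = inv (2ℚ * c) * ε
    0<δ : 0ℚ < δ
    0<δ = 0<* (0<inv 0<2c) 0<ε
    2cδ≡ε : 2ℚ * c * δ ≡ ε
    2cδ≡ε = trans (solve 3 (λ c i e → con 2ℚ :* c :* (i :* e) := i :* (con 2ℚ :* c) :* e) refl c (inv (2ℚ * c)) ε)
              (trans (cong (_* ε) (inv-inverse λ 2c≡0 → <-irrefl (sym 2c≡0) 0<2c)) (*-identityˡ ε))
    limit = modulus (expSum-cauchyℚ (- a)) δ 0<δ
    K : ℕ
    K = proj₁ limit
    inverse = triangle-inverse 0≤a K δ 0<δ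
    M : ℕ
    M = proj₁ inverse
    E T : ℚ
    E = expSum a (suc (suc M))
    T = triangle a (- a) (suc M) K
    0<E : 0ℚ < E
    0<E = <-≤-trans (positive⁻¹ 1ℚ) (1≤expSum (suc M))
    T≤ : ∀ n → K ℕ.≤ n → T ≤ (expSum (- a) n + δ) * E
    T≤ n K≤n = triangle-≤ (- a) 0≤a (suc M) K λ k K≤k →
      ≤-by (0≤diff (≤-trans (p≤∣p∣ (expSum (- a) k - expSum (- a) n)) (<⇒≤ (proj₂ limit k n K≤k K≤n))))
           (solve 3 (λ s d x → s :+ d := x :+ (d :- (x :- s))) refl (expSum (- a) n) δ (expSum (- a) k))
    bound : ∀ s E T → b * E ≤ c → T ≤ (s + δ) * E → 1ℚ - T ≤ δ → 1ℚ ≤ E → b * E ≤ (c * s + 2ℚ * c * δ) * E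
    bound s E T bS≤c T≤ 1-T≤δ 1≤E = ≤-by
      (0≤+ (0≤diff bS≤c) (0≤+ (0≤* (<⇒≤ 0<c) (0≤diff T≤))
      (0≤+ (0≤* (<⇒≤ 0<c) (0≤diff 1-T≤δ)) (0≤* (0≤* (<⇒≤ 0<c) (<⇒≤ 0<δ)) (0≤diff 1≤E)))))
      (solve 6 (λ b c d s E T → (c :* s :+ con 2ℚ :* c :* d) :* E
         := b :* E :+ ((c :- b :* E) :+ (c :* ((s :+ d) :* E :- T)
              :+ (c :* (d :- (con 1ℚ :- T)) :+ c :* d :* (E :- con 1ℚ))))) refl b c δ s E T)

-- The region S in normalised coordinates

½≤larger : ∀ {p q} → p ≡ 1ℚ - q → q ≤ p → ½ ≤ p
½≤larger {_} {q} refl q≤p = ≤-by (0≤* (nonNegative⁻¹ ½) (0≤diff q≤p))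
  (solve 1 (λ q → con 1ℚ :- q := con ½ :+ con ½ :* (con 1ℚ :- q :- q)) refl q)

0<larger : ∀ {p q} → p ≡ 1ℚ - q → q ≤ p → 0ℚ < p
0<larger p≡ q≤p = <-≤-trans (positive⁻¹ ½) (½≤larger p≡ q≤p)

smaller≤½ : ∀ {p q} → p ≡ 1ℚ - q → q ≤ p → q ≤ ½
smaller≤½ {_} {q} refl q≤p = ≤-by (0≤* (nonNegative⁻¹ ½) (0≤diff q≤p))
  (solve 1 (λ q → con ½ := q :+ con ½ :* (con 1ℚ :- q :- q)) refl q)

-- a - c ≤ (a + c) exp (- 2 b / (a + c)), which is c ≥ f(b) when a + b + c = 1.
Balanced : ℚ → ℚ → ℚ → Set
Balanced a b c = ∀ A → A * (a + c) ≡ 2ℚ * b → ∀ n → (a - c) * expSum A n ≤ a + c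

-- r ≤ exp (- 2 t)
Decays : ℚ → ℚ → Set
Decays r t = ∀ n → r * expSum (2ℚ * t) n ≤ 1ℚ

exponent-nonNeg : ∀ {A s} b → A * s ≡ 2ℚ * b → 0ℚ < s → 0ℚ ≤ b → 0ℚ ≤ A
exponent-nonNeg {A} {s} _ As≡2b 0<s 0≤b = cancelʳ-≤ s 0<s
  (subst₂ _≤_ (sym (*-zeroˡ s)) (sym As≡2b) (0≤* 0≤2 0≤b))

exponent-mono : ∀ {A A′ s s′} b b′ → A * s ≡ 2ℚ * b → A′ * s′ ≡ 2ℚ * b′ →
                0ℚ < s → 0ℚ < s′ → b * s′ ≤ b′ * s → A ≤ A′
exponent-mono {A} {A′} {s} {s′} b b′ As≡2b A′s′≡2b′ 0<s 0<s′ bs′≤b′s = cancelʳ-≤ (s * s′) (0<* 0<s 0<s′)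
  (≤-trans (≤-reflexive (trans (sym (*-assoc A s s′)) (trans (cong (_* s′) As≡2b) (*-assoc 2ℚ b s′))))
  (≤-trans (*-monoˡ-0≤ 0≤2 bs′≤b′s)
  (≤-reflexive (trans (sym (*-assoc 2ℚ b′ s)) (trans (cong (_* s) (sym A′s′≡2b′))
    (solve 3 (λ a s s′ → a :* s′ :* s := a :* (s :* s′)) refl A′ s s′))))))

-- With x = q / t, the hypothesis says 2 p / (t + q) ≤ 2 x, and (1 - x) / (1 + x) ≤ exp (- 2 x).
balanced-of-crude : ∀ {t p q} → p ≡ 1ℚ - q → 0ℚ ≤ q → q ≤ p → q ≤ t → 0ℚ < t → (p - q) * t ≤ q * q → Balanced t p q
balanced-of-crude {t} {_} {q} refl 0≤q q≤p q≤t 0<t crude A A≡ n = ≤-trans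
  (*-monoˡ-0≤ (0≤diff q≤t) (expSum-monoᵃ 0≤A A≤2x n))
  (≤-trans (≤-reflexive (trans (cong (λ y → (t - y) * expSum (2ℚ * x) n) (sym xt≡q))
              (solve 3 (λ x t e → (t :- x :* t) :* e := t :* ((con 1ℚ :- x) :* e)) refl x t (expSum (2ℚ * x) n))))
  (≤-trans (*-monoˡ-0≤ (<⇒≤ 0<t) (expSum-1-/1+ 0≤x x≤1 n))
  (≤-reflexive (trans (solve 2 (λ x t → t :* (con 1ℚ :+ x) := t :+ x :* t) refl x t) (cong (t +_) xt≡q)))))
  where
  x : ℚ
  x = inv t * q
  xt≡q : x * t ≡ q
  xt≡q = trans (solve 3 (λ i q t → i :* q :* t := i :* t :* q) refl (inv t) q t)
    (trans (cong (_* q) (inv-inverse λ t≡0 → <-irrefl (sym t≡0) 0<t)) (*-identityˡ q))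
  0<t+q : 0ℚ < t + q
  0<t+q = <-≤-trans 0<t (≤-by 0≤q refl)
  0≤x : 0ℚ ≤ x
  0≤x = 0≤* (<⇒≤ (0<inv 0<t)) 0≤q
  x≤1 : x ≤ 1ℚ
  x≤1 = cancelʳ-≤ t 0<t (subst₂ _≤_ (sym xt≡q) (sym (*-identityˡ t)) q≤t)
  0≤A : 0ℚ ≤ A
  0≤A = exponent-nonNeg (1ℚ - q) A≡ 0<t+q (≤-trans 0≤q q≤p)
  A≤2x : A ≤ 2ℚ * x
  A≤2x = exponent-mono (1ℚ - q) q A≡ (trans (*-assoc 2ℚ x t) (cong (2ℚ *_) xt≡q)) 0<t+q 0<t
    (≤-by (0≤diff crude) (solve 2 (λ t q → q :* (t :+ q)
       := (con 1ℚ :- q) :* t :+ (q :* q :- (con 1ℚ :- q :- q) :* t)) refl t q))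

-- If balanced-of-crude does not apply, use exp d ≥ 1 + d + d² / 2 for d = 2 t - 2 p / (t + q).
balanced-of-decays : ∀ {t p q} → p ≡ 1ℚ - q → 0ℚ ≤ q → q ≤ p → p ≤ t → Decays (p - q) t → Balanced t p q
balanced-of-decays {t} {p} {q} refl 0≤q q≤p p≤t decays with ≤-total ((p - q) * t) (q * q)
... | inj₁ crude = balanced-of-crude refl 0≤q q≤p (≤-trans q≤p p≤t) (<-≤-trans (0<larger refl q≤p) p≤t) crude
-- With `d = 2 t - A` the chain is `(t - q) exp A ≤ s r exp d exp A = s r exp (2 t) ≤ s`.
... | inj₂ steep = λ A A≡ n →
  let open WithExponent A A≡ in
  ≤-trans (*-monoʳ-0≤ (expSum-nonNeg 0≤A n) factor)
  (≤-trans (≤-reflexive (solve 4 (λ s r e x → s :* (r :* e) :* x := s :* (r :* (e :* x))) refl s r (expSum d 3) (expSum A n)))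
  (≤-trans (*-monoˡ-0≤ (<⇒≤ 0<s) (≤-trans (*-monoˡ-0≤ 0≤r (expSum-*-≤ 0≤d 0≤A 2 n))
     (subst (λ x → r * expSum x (n ℕ.+ 2) ≤ 1ℚ) (sym d+A≡2t) (decays (n ℕ.+ 2)))))
  (≤-reflexive (*-identityʳ s))))
  where
  r s u : ℚ
  r = p - q
  s = t + q
  u = t - p
  0≤r : 0ℚ ≤ r
  0≤r = 0≤diff q≤p
  0≤p : 0ℚ ≤ p
  0≤p = ≤-trans 0≤q q≤p
  0≤u : 0ℚ ≤ u
  0≤u = 0≤diff p≤t
  0≤t : 0ℚ ≤ t
  0≤t = ≤-trans 0≤p p≤t
  0<s : 0ℚ < s
  0<s = <-≤-trans (<-≤-trans (0<larger refl q≤p) p≤t) (≤-by 0≤q refl)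
  module WithExponent (A : ℚ) (A≡ : A * s ≡ 2ℚ * p) where
    0≤A : 0ℚ ≤ A
    0≤A = exponent-nonNeg p A≡ 0<s 0≤p
    d : ℚ
    d = 2ℚ * t - A
    d+A≡2t : d + A ≡ 2ℚ * t
    d+A≡2t = solve 2 (λ t a → con 2ℚ :* t :- a :+ a := con 2ℚ :* t) refl t A
    -- Since `p + q = 1`, the difference `t (t + q) - p` factors as `(t - p) (t + 1)`.
    ds≡ : d * s ≡ 2ℚ * (u * (t + 1ℚ))
    ds≡ = trans (solve 3 (λ t a s → (con 2ℚ :* t :- a) :* s := con 2ℚ :* t :* s :- a :* s) refl t A s)
      (trans (cong (λ y → 2ℚ * t * s - y) A≡)
        (solve 2 (λ t q → con 2ℚ :* t :* (t :+ q) :- con 2ℚ :* (con 1ℚ :- q)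
            := con 2ℚ :* ((t :- (con 1ℚ :- q)) :* (t :+ con 1ℚ))) refl t q))
    0≤d : 0ℚ ≤ d
    0≤d = exponent-nonNeg (u * (t + 1ℚ)) ds≡ 0<s (0≤* 0≤u (0≤+ 0≤t 0≤1))
    -- Both sides agree at `t = p`, which explains the factor `u` of the surplus.
    factor : t - q ≤ s * (r * expSum d 3)
    factor = cancelʳ-≤ s 0<s (≤-by
      (0≤* (0≤* 0≤2 0≤u) (0≤+
         (0≤* (0≤diff steep) (0≤+ 0≤2 (0≤* 0≤u (0≤+ 0≤2 (0≤+ 0≤p 0≤u)))))
         (0≤* (0≤* 0≤u 0≤p) (0≤+ 0≤r (0≤+ (0≤* 0≤p 0≤p) (0≤* 0≤p 0≤u))))))
      (trans (solve 3 (λ r s d →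
          s :* (r :* (con 0ℚ :+ con 1ℚ :+ con 1ℚ :* (d :* con 1ℚ) :+ con 1ℚ :* (d :* con 1ℚ) :* (d :* con ½))) :* s
           := r :* (s :* s :+ s :* (d :* s) :+ con ½ :* ((d :* s) :* (d :* s)))) refl r s d)
      (trans (cong (λ y → r * (s * s + s * y + ½ * (y * y))) ds≡)
        (solve 2 (λ t q →
          let p = con 1ℚ :- q; r = p :- q; u = t :- p; s = t :+ q; y = con 2ℚ :* (u :* (t :+ con 1ℚ)) in
          r :* (s :* s :+ s :* y :+ con ½ :* (y :* y)) :=
          (t :- q) :* s :+ con 2ℚ :* u :* ((r :* t :- q :* q) :* (con 2ℚ :+ u :* (con 2ℚ :+ (p :+ u)))
            :+ u :* p :* (r :+ (p :* p :+ p :* u)))) refl t q))))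

-- Serves `crude-or-tangent`, with `r = p - q`. Once `r t ≥ q²`, the right-hand side of the tangent
-- alternative is nonnegative, and where the tangent fails it still makes up for the deficit
-- `r t - q²` of the crude inequality.
steep-gain : ∀ {t p q} → p ≡ 1ℚ - q → 0ℚ ≤ q → q ≤ p → p ≤ t → q * q ≤ (p - q) * t →
             (p - q) * t - q * q ≤ (p - q) * t * (1ℚ + t) - p * q
steep-gain {t} {p} {q} refl 0≤q q≤p p≤t qq≤rt with ≤-total q (p * p)
... | inj₁ q≤pp = ≤-by
  (0≤* (0≤diff q≤p) (0≤+ (0≤diff (*-mono-0≤ 0≤p (≤-trans 0≤p p≤t) p≤t p≤t)) (0≤diff q≤pp)))
  (solve 2 (λ t q → let p = con 1ℚ :- q; r = p :- q in
     r :* t :* (con 1ℚ :+ t) :- p :* q := r :* t :- q :* q :+ r :* (t :* t :- p :* p :+ (p :* p :- q))) refl t q)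
  where
  0≤p : 0ℚ ≤ p
  0≤p = ≤-trans 0≤q q≤p
... | inj₂ pp≤q = ≤-by
  (0≤+ (0≤* (≤-trans (≤-trans 0≤q q≤p) p≤t) (0≤diff qq≤rt))
       (0≤* 0≤q (0≤+ (0≤* (0≤diff p≤t) 0≤q) (0≤diff pp≤q))))
  (solve 2 (λ t q → let p = con 1ℚ :- q; r = p :- q in
     r :* t :* (con 1ℚ :+ t) :- p :* q := r :* t :- q :* q :+
       (t :* (r :* t :- q :* q) :+ q :* ((t :- p) :* q :+ (q :- p :* p)))) refl t q)

-- The second alternative is, up to a positive factor, the inequality that exp d ≥ 1 + d yields in balanced-shift.
crude-or-tangent : ∀ {t p q δ} → p ≡ 1ℚ - q → 0ℚ ≤ q → q ≤ p → p ≤ t → 0ℚ ≤ δ →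
                   (p - q) * (t + δ) * (1ℚ + 2ℚ * δ) ≤ (q + δ) * (q + δ) ⊎
                   δ * (q - (p - q) * t) ≤ (p - q) * t * (1ℚ + t) - p * q
crude-or-tangent {t} {p} {q} {δ} refl 0≤q q≤p p≤t 0≤δ with ≤-total ((p - q) * t) (q * q)
... | inj₁ rt≤qq = inj₁ (≤-by
  (0≤+ (0≤* 0≤δ (0≤+ (0≤* 0≤2 0≤w) (0≤+ 0≤q-r (0≤* 0≤q 0≤r))))
  (0≤+ (0≤* (0≤* 0≤δ 0≤δ) (0≤+ (0≤* 0≤2 0≤q-r) 0≤r)) 0≤w))
  (solve 3 (λ t q δ → let r = con 1ℚ :- q :- q; w = q :* q :- r :* t in
     (q :+ δ) :* (q :+ δ) := r :* (t :+ δ) :* (con 1ℚ :+ con 2ℚ :* δ) :+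
       (δ :* (con 2ℚ :* w :+ (q :- r :+ q :* r)) :+ (δ :* δ :* (con 2ℚ :* (q :- r) :+ r) :+ w))) refl t q δ))
  where
  0≤r : 0ℚ ≤ p - q
  0≤r = 0≤diff q≤p
  0≤w : 0ℚ ≤ q * q - (p - q) * t
  0≤w = 0≤diff rt≤qq
  0≤q-r : 0ℚ ≤ q - (p - q)
  0≤q-r = 0≤diff (cancelʳ-≤ {p - q} {q} p (0<larger refl q≤p)
    (≤-trans (*-monoˡ-0≤ 0≤r p≤t) (≤-trans rt≤qq (*-monoˡ-0≤ 0≤q q≤p))))
... | inj₂ qq≤rt with q - (p - q) * t ≤? 0ℚ | ≤-total (δ * (q - (p - q) * t)) ((p - q) * t * (1ℚ + t) - p * q)
...   | _       | inj₁ tangent = inj₂ tangent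
...   | yes D≤0 | inj₂ _       = inj₂ (≤-trans (≤-trans (*-monoˡ-0≤ 0≤δ D≤0) (≤-reflexive (*-zeroʳ δ)))
                                         (≤-trans (0≤diff qq≤rt) (steep-gain {t} refl 0≤q q≤p p≤t qq≤rt)))
-- With the abbreviations below, `(q + δ)² - r (t + δ) (1 + 2 δ)` is `q² - r t + δ D + δ (δ c - m)`.
-- Failure of the tangent gives `δ D ≥ g ≥ r t - q²`, and `m D ≤ g c ≤ δ D c` gives `m ≤ δ c`.
...   | no  D≰0 | inj₂ g≤δD = inj₁ (≤-by
  (0≤+ (0≤diff (steep-gain {t} refl 0≤q q≤p p≤t qq≤rt)) (0≤+ (0≤diff g≤δD) (0≤* 0≤δ (0≤diff m≤δc))))
  (solve 3 (λ t q δ → let p = con 1ℚ :- q; r = p :- q; m = r :* (con 1ℚ :+ t) :- q; c = con 1ℚ :- con 2ℚ :* r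
                          g = r :* t :* (con 1ℚ :+ t) :- p :* q; D = q :- r :* t in
     (q :+ δ) :* (q :+ δ) := r :* (t :+ δ) :* (con 1ℚ :+ con 2ℚ :* δ) :+
       ((g :- (r :* t :- q :* q)) :+ ((δ :* D :- g) :+ δ :* (δ :* c :- m)))) refl t q δ))
  where
  r u m c g D : ℚ
  r = p - q
  u = t - p
  m = r * (1ℚ + t) - q
  c = 1ℚ - 2ℚ * r
  g = r * t * (1ℚ + t) - p * q
  D = q - r * t
  0≤r : 0ℚ ≤ r
  0≤r = 0≤diff q≤p
  0≤u : 0ℚ ≤ u
  0≤u = 0≤diff p≤t
  0<D : 0ℚ < D
  0<D = ≰⇒> D≰0
  0≤c : 0ℚ ≤ c
  0≤c = subst (0ℚ ≤_)
    (solve 2 (λ t q → let p = con 1ℚ :- q; r = p :- q in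
       (q :- r :* t) :+ (r :* (t :- p) :+ con 2ℚ :* (q :* q)) := con 1ℚ :- con 2ℚ :* r) refl t q)
    (0≤+ (<⇒≤ 0<D) (0≤+ (0≤* 0≤r 0≤u) (0≤* 0≤2 (0≤* 0≤q 0≤q))))
  0≤g : 0ℚ ≤ g
  0≤g = ≤-trans (0≤diff qq≤rt) (steep-gain {t} refl 0≤q q≤p p≤t qq≤rt)
  mD≤gc : m * D ≤ g * c
  mD≤gc with ≤-total m 0ℚ
  ... | inj₁ m≤0 = ≤-trans (≤-trans (*-monoʳ-0≤ (<⇒≤ 0<D) m≤0) (≤-reflexive (*-zeroˡ D))) (0≤* 0≤g 0≤c)
  ... | inj₂ 0≤m = ≤-by
    (0≤+ (0≤* 0≤m (0≤* 0≤q (0≤+ 0≤r (0≤* 0≤2 0≤u)))) (0≤* (0≤* 0≤u 0≤q) 0≤c))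
    (solve 2 (λ t q → let p = con 1ℚ :- q; r = p :- q; u = t :- p; m = r :* (con 1ℚ :+ t) :- q; c = con 1ℚ :- con 2ℚ :* r
                          g = r :* t :* (con 1ℚ :+ t) :- p :* q; D = q :- r :* t in
       g :* c := m :* D :+ (m :* (q :* (r :+ con 2ℚ :* u)) :+ u :* q :* c)) refl t q)
  m≤δc : m ≤ δ * c
  m≤δc = cancelʳ-≤ D 0<D (≤-trans mD≤gc (≤-trans (*-monoʳ-0≤ 0≤c g≤δD)
    (≤-reflexive (solve 3 (λ δ D c → δ :* D :* c := δ :* c :* D) refl δ D c))))

-- Here r′ = p′ - q′ has decayed from r = p - q by a factor 1 / (1 + 2 δ). Either balanced-of-crude applies at
-- t + δ, or exp d ≥ 1 + d suffices, where d is the decrease of the exponent 2 p / (t + q).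
balanced-shift : ∀ {t p q p′ q′ δ} → p ≡ 1ℚ - q → p′ ≡ 1ℚ - q′ → 0ℚ ≤ q → q ≤ p → 0ℚ ≤ q′ → q′ ≤ p′ →
                 p ≤ t → 0ℚ ≤ δ → Balanced t p q → (p′ - q′) * (1ℚ + 2ℚ * δ) ≤ p - q →
                 Balanced (t + δ) p′ q′
balanced-shift {t} {p} {q} {p′} {q′} {δ} refl refl 0≤q q≤p 0≤q′ q′≤p′ p≤t 0≤δ bal r′k≤r
  with crude-or-tangent {t} {p} {q} {δ} refl 0≤q q≤p p≤t 0≤δ
-- `q′ k = q + δ + e / 2`, so multiplying the goal by `k²` reduces it to the crude inequality.
... | inj₁ crude = balanced-of-crude refl 0≤q′ q′≤p′ q′≤t+δ (<-≤-trans 0<t (≤-by 0≤δ refl))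
  (cancelʳ-≤ (k * k) (0<* 0<k 0<k) (≤-by
    (0≤+ (0≤diff crude) (0≤* 0≤e (0≤+ (0≤+ (0≤+ 0≤q 0≤δ) (0≤* (nonNegative⁻¹ (½ * ½)) 0≤e)) (0≤* (0≤+ 0≤t 0≤δ) (<⇒≤ 0<k)))))
    (solve 4 (λ t q q′ δ → let r = con 1ℚ :- q :- q; r′ = con 1ℚ :- q′ :- q′; k = con 1ℚ :+ con 2ℚ :* δ; e = r :- r′ :* k in
       q′ :* q′ :* (k :* k) := r′ :* (t :+ δ) :* (k :* k) :+
         (((q :+ δ) :* (q :+ δ) :- r :* (t :+ δ) :* k) :+ e :* (q :+ δ :+ con (½ * ½) :* e :+ (t :+ δ) :* k)))
       refl t q q′ δ)))
  where
  k e : ℚ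
  k = 1ℚ + 2ℚ * δ
  e = p - q - (p′ - q′) * k
  0≤e : 0ℚ ≤ e
  0≤e = 0≤diff r′k≤r
  0≤t : 0ℚ ≤ t
  0≤t = ≤-trans (≤-trans 0≤q q≤p) p≤t
  0<t : 0ℚ < t
  0<t = <-≤-trans (0<larger refl q≤p) p≤t
  q′≤t+δ : q′ ≤ t + δ
  q′≤t+δ = ≤-trans (≤-trans (smaller≤½ refl q′≤p′) (½≤larger refl q≤p)) (≤-trans p≤t (≤-by 0≤δ refl))
  0<k : 0ℚ < k
  0<k = <-≤-trans (positive⁻¹ 1ℚ) (≤-by (0≤* 0≤2 0≤δ) refl)
-- With `d = A - A′` the chain is `(t + δ - q′) s exp A′ ≤ s′ (t - q) (1 + d) exp A′ ≤ s′ (t - q)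
-- exp A ≤ s′ s`.
... | inj₂ tangent = λ A′ A′≡ n →
  let open WithExponents A′ A′≡ in
  cancelʳ-≤ s 0<s (≤-trans
    (≤-reflexive (solve 3 (λ x e s → x :* e :* s := x :* s :* e) refl (t + δ - q′) (expSum A′ n) s))
    (≤-trans (*-monoʳ-0≤ (expSum-nonNeg 0≤A′ n) factor)
    (≤-trans (≤-reflexive (solve 4 (λ s′ x y e → s′ :* (x :* y) :* e := s′ :* (x :* (y :* e))) refl s′ (t - q) (expSum d 2) (expSum A′ n)))
    (*-monoˡ-0≤ (<⇒≤ 0<s′) (≤-trans
      (*-monoˡ-0≤ (0≤diff q≤t) (≤-trans (expSum-*-≤ 0≤d 0≤A′ 1 n) (≤-reflexive (cong (λ x → expSum x (n ℕ.+ 1)) d+A′≡A))))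
      (bal A A≡ (n ℕ.+ 1)))))))
  where
  k e s s′ A : ℚ
  k = 1ℚ + 2ℚ * δ
  e = p - q - (p′ - q′) * k
  s = t + q
  s′ = t + δ + q′
  A = inv s * (2ℚ * p)
  0≤e : 0ℚ ≤ e
  0≤e = 0≤diff r′k≤r
  0≤p : 0ℚ ≤ p
  0≤p = ≤-trans 0≤q q≤p
  q≤t : q ≤ t
  q≤t = ≤-trans q≤p p≤t
  0<t : 0ℚ < t
  0<t = <-≤-trans (0<larger refl q≤p) p≤t
  0<s : 0ℚ < s
  0<s = <-≤-trans 0<t (≤-by 0≤q refl)
  0<s′ : 0ℚ < s′
  0<s′ = <-≤-trans 0<t (≤-by (0≤+ 0≤δ 0≤q′) (+-assoc t δ q′))
  0<k : 0ℚ < k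
  0<k = <-≤-trans (positive⁻¹ 1ℚ) (≤-by (0≤* 0≤2 0≤δ) refl)
  A≡ : A * s ≡ 2ℚ * p
  A≡ = trans (solve 3 (λ i x s → i :* x :* s := i :* s :* x) refl (inv s) (2ℚ * p) s)
    (trans (cong (_* (2ℚ * p)) (inv-inverse λ s≡0 → <-irrefl (sym s≡0) 0<s)) (*-identityˡ (2ℚ * p)))
  module WithExponents (A′ : ℚ) (A′≡ : A′ * s′ ≡ 2ℚ * p′) where
    0≤A′ : 0ℚ ≤ A′
    0≤A′ = exponent-nonNeg p′ A′≡ 0<s′ (≤-trans 0≤q′ q′≤p′)
    d : ℚ
    d = A - A′
    d+A′≡A : d + A′ ≡ A
    d+A′≡A = solve 2 (λ a a′ → a :- a′ :+ a′ := a) refl A A′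
    p′≤p : p′ ≤ p
    p′≤p = ≤-by (0≤* (nonNegative⁻¹ ½) (0≤+ 0≤e (0≤* (0≤* 0≤2 0≤δ) (0≤diff q′≤p′))))
      (solve 3 (λ q q′ δ → let r = con 1ℚ :- q :- q; r′ = con 1ℚ :- q′ :- q′ in
        con 1ℚ :- q := con 1ℚ :- q′ :+ con ½ :* (r :- r′ :* (con 1ℚ :+ con 2ℚ :* δ) :+ con 2ℚ :* δ :* r′)) refl q q′ δ)
    s≤s′ : s ≤ s′
    s≤s′ = ≤-by (0≤+ 0≤δ (0≤diff p′≤p))
      (solve 4 (λ t q q′ δ → t :+ δ :+ q′ := t :+ q :+ (δ :+ (con 1ℚ :- q :- (con 1ℚ :- q′)))) refl t q q′ δ)
    0≤d : 0ℚ ≤ d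
    0≤d = 0≤diff {A′} {A} (exponent-mono p′ p A′≡ A≡ 0<s′ 0<s (*-mono-0≤ (<⇒≤ 0<s) 0≤p p′≤p s≤s′))
    factor : (t + δ - q′) * s ≤ s′ * ((t - q) * expSum d 2)
    factor = cancelʳ-≤ (s * k) (0<* 0<s 0<k) (≤-by
      (0≤+ (0≤* (0≤* (nonNegative⁻¹ (2ℚ * 2ℚ)) 0≤δ) (0≤diff tangent))
           (0≤* 0≤e (0≤* (nonNegative⁻¹ ½) (0≤+
             (0≤* (0≤diff q≤t) (0≤+ (0≤+ (<⇒≤ 0<s) (0≤* 0≤2 0≤p)) (0≤* 0≤2 (<⇒≤ 0<s))))
             (0≤* (<⇒≤ 0<s) (<⇒≤ 0<s))))))
      (trans (solve 6 (λ s s′ x a a′ k →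
          s′ :* (x :* (con 0ℚ :+ con 1ℚ :+ con 1ℚ :* ((a :- a′) :* con 1ℚ))) :* (s :* k)
           := k :* (x :* (s′ :* s :+ a :* s :* s′ :- a′ :* s′ :* s))) refl s s′ (t - q) A A′ k)
      (trans (cong₂ (λ y z → k * ((t - q) * (s′ * s + y * s′ - z * s))) A≡ A′≡)
        (solve 4 (λ t q q′ δ →
          let p = con 1ℚ :- q; p′ = con 1ℚ :- q′; r = p :- q; s = t :+ q; s′ = t :+ δ :+ q′
              k = con 1ℚ :+ con 2ℚ :* δ; e = r :- (p′ :- q′) :* k in
          k :* ((t :- q) :* (s′ :* s :+ con 2ℚ :* p :* s′ :- con 2ℚ :* p′ :* s)) :=
          (t :+ δ :- q′) :* s :* (s :* k) :+
            (con (2ℚ * 2ℚ) :* δ :* (r :* t :* (con 1ℚ :+ t) :- p :* q :- δ :* (q :- r :* t))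
             :+ e :* (con ½ :* ((t :- q) :* (s :+ con 2ℚ :* p :+ con 2ℚ :* s) :+ s :* s)))) refl t q q′ δ))))

exponent : ∀ s → 0ℚ < s → ∀ b → ∃[ A ] A * s ≡ 2ℚ * b
exponent s 0<s b = inv s * (2ℚ * b) ,
  trans (solve 3 (λ i x s → i :* x :* s := i :* s :* x) refl (inv s) (2ℚ * b) s)
    (trans (cong (_* (2ℚ * b)) (inv-inverse λ s≡0 → <-irrefl (sym s≡0) 0<s)) (*-identityˡ (2ℚ * b)))

module _ {t q} (0≤q : 0ℚ ≤ q) (q≤p : q ≤ 1ℚ - q) (p≤t : 1ℚ - q ≤ t) (bal : Balanced t (1ℚ - q) q) where

  private
    p : ℚ
    p = 1ℚ - q
    s : ℚ
    s = t + q
    0<t : 0ℚ < t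
    0<t = <-≤-trans (0<larger refl q≤p) p≤t
    0<s : 0ℚ < s
    0<s = <-≤-trans 0<t (≤-by 0≤q refl)
    0≤r : 0ℚ ≤ p - q
    0≤r = 0≤diff q≤p

  -- From exp A ≥ 1 + A + A² / 2.
  balanced⇒quadratic : (p - q) * (s * s) + p * (p - 2ℚ * q) * s ≤ 2ℚ * (p * p * q)
  balanced⇒quadratic = let A , A≡ = exponent s 0<s p in ≤-by
    (0≤* (nonNegative⁻¹ ½) (0≤diff (*-monoʳ-0≤ (0≤* (<⇒≤ 0<s) (<⇒≤ 0<s)) (bal A A≡ 3))))
    (trans (solve 2 (λ t q → let s = t :+ q; p = con 1ℚ :- q in
        con 2ℚ :* (p :* p :* q) := (p :- q) :* (s :* s) :+ p :* (p :- con 2ℚ :* q) :* s :+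
          con ½ :* (s :* (s :* s) :- (t :- q) :* (s :* s :+ con 2ℚ :* p :* s :+ con ½ :* (con 2ℚ :* p) :* (con 2ℚ :* p))))
        refl t q)
      (cong (λ x → (p - q) * (s * s) + p * (p - 2ℚ * q) * s + ½ * (s * (s * s) - x))
        (trans (cong (λ y → (t - q) * (s * s + y * s + ½ * y * y)) (sym A≡))
          (solve 3 (λ x a s → x :* (s :* s :+ a :* s :* s :+ con ½ :* (a :* s) :* (a :* s))
            := x :* (con 0ℚ :+ con 1ℚ :+ con 1ℚ :* (a :* con 1ℚ) :+ con 1ℚ :* (a :* con 1ℚ) :* (a :* con ½)) :* (s :* s))
            refl (t - q) A s))))

  -- `t ≥ p` means `s ≥ 1`. If `p ≥ 2 q`, then `s` may be replaced by 1 in `balanced⇒quadratic`,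
  -- which forces `3 q ≥ 1`. So `p ≤ 2 q` in any case.
  3r≤1 : (2ℚ + 1ℚ) * (p - q) ≤ 1ℚ
  3r≤1 with ≤-total ((2ℚ + 1ℚ) * (p - q)) 1ℚ
  ... | inj₁ 3r≤1 = 3r≤1
  ... | inj₂ 1≤3r = ≤-by (0≤* 0≤2 (0≤diff 1≤3q))
    (solve 1 (λ q → con 1ℚ := con (2ℚ + 1ℚ) :* (con 1ℚ :- q :- q) :+ con 2ℚ :* (con (2ℚ + 1ℚ) :* q :- con 1ℚ)) refl q)
    where
    1≤s : 1ℚ ≤ s
    1≤s = ≤-by (0≤diff p≤t) (solve 2 (λ t q → t :+ q := con 1ℚ :+ (t :- (con 1ℚ :- q))) refl t q)
    0≤p-2q : 0ℚ ≤ p - 2ℚ * q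
    0≤p-2q = subst (0ℚ ≤_) (solve 1 (λ q → con ½ :* (con (2ℚ + 1ℚ) :* (con 1ℚ :- q :- q) :- con 1ℚ)
      := con 1ℚ :- q :- con 2ℚ :* q) refl q) (0≤* (nonNegative⁻¹ ½) (0≤diff 1≤3r))
    0≤p : 0ℚ ≤ p
    0≤p = ≤-trans 0≤q q≤p
    1≤3q : 1ℚ ≤ (2ℚ + 1ℚ) * q
    1≤3q = cancelʳ-≤ (2ℚ * p) (0<* (positive⁻¹ 2ℚ) (0<larger refl q≤p)) (≤-by
      (0≤+ (0≤diff balanced⇒quadratic) (0≤+ (0≤* 0≤r (0≤diff (*-mono-0≤ 0≤1 (<⇒≤ 0<s) 1≤s 1≤s)))
        (0≤+ (0≤* (0≤* 0≤p 0≤p-2q) (0≤diff 1≤s)) (0≤* (0≤* 0≤q 0≤q) 0≤r))))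
      (solve 2 (λ t q → let p = con 1ℚ :- q; r = p :- q; s = t :+ q in
        con (2ℚ + 1ℚ) :* q :* (con 2ℚ :* p) := con 1ℚ :* (con 2ℚ :* p) :+
          ((con 2ℚ :* (p :* p :* q) :- (r :* (s :* s) :+ p :* (p :- con 2ℚ :* q) :* s)) :+
           (r :* (s :* s :- con 1ℚ :* con 1ℚ) :+ (p :* (p :- con 2ℚ :* q) :* (s :- con 1ℚ) :+ q :* q :* r)))) refl t q))

  -- Multiplied by `r = p - q`, `balanced⇒quadratic` involves `t` only through `r t`. Together with
  -- `3 r ≤ 1` it excludes `r t ≥ 7/24`: the certificate writes 0 as `11/18` plus nonnegative terms.
  -- Any bound up to `8/27` would serve `balanced-of-flat`.
  rt≤7/24 : (p - q) * t ≤ ℤ.+ 7 / 24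
  rt≤7/24 with ≤-total ((p - q) * t) (ℤ.+ 7 / 24)
  ... | inj₁ rt≤  = rt≤
  ... | inj₂ 7≤24rt = ⊥-elim (<-irrefl refl (<-≤-trans (positive⁻¹ (ℤ.+ 11 / 18)) (≤-by
    (0≤+ (0≤+ (0≤* (nonNegative⁻¹ (ℤ.+ 5 / 9)) 0≤y) (0≤* (0≤* (nonNegative⁻¹ (ℤ.+ 17 / 3)) 0≤r) 0≤y))
    (0≤+ (0≤* (0≤* (nonNegative⁻¹ (ℤ.+ 96 / 1)) 0≤r) (0≤diff balanced⇒quadratic))
    (0≤+ (0≤* (0≤* (nonNegative⁻¹ (ℤ.+ 24 / 1)) 0≤r) (0≤+ (0≤* 0≤r 0≤r) (0≤* (0≤* 0≤r 0≤r) 0≤r)))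
    (0≤+ (0≤* (nonNegative⁻¹ (ℤ.+ 28 / 1)) 0≤h)
         (0≤* (0≤* (nonNegative⁻¹ (ℤ.+ 24 / 1)) (0≤+ 0≤h (0≤* 0≤r 0≤q)))
              (0≤+ (nonNegative⁻¹ (ℤ.+ 1 / 6)) (0≤+ (0≤* (nonNegative⁻¹ (ℤ.+ 4 / 1)) 0≤r) (0≤+ (0≤* 0≤r 0≤r) (0≤* (nonNegative⁻¹ (ℤ.+ 4 / 1)) 0≤h)))))))))
    (solve 2 (λ t q → let p = con 1ℚ :- q; r = p :- q; s = t :+ q; y = con 1ℚ :- con (2ℚ + 1ℚ) :* r
                          h = r :* t :- con (ℤ.+ 7 / 24) in
      con 0ℚ := con (ℤ.+ 11 / 18) :+ (con (ℤ.+ 5 / 9) :* y :+ con (ℤ.+ 17 / 3) :* r :* y :+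
        (con (ℤ.+ 96 / 1) :* r :* (con 2ℚ :* (p :* p :* q) :- (r :* (s :* s) :+ p :* (p :- con 2ℚ :* q) :* s)) :+
        (con (ℤ.+ 24 / 1) :* r :* (r :* r :+ r :* r :* r) :+
        (con (ℤ.+ 28 / 1) :* h :+
         con (ℤ.+ 24 / 1) :* (h :+ r :* q) :* (con (ℤ.+ 1 / 6) :+ (con (ℤ.+ 4 / 1) :* r :+ (r :* r :+ con (ℤ.+ 4 / 1) :* h)))))))) refl t q))))
    where
    0≤y : 0ℚ ≤ 1ℚ - (2ℚ + 1ℚ) * (p - q)
    0≤y = 0≤diff 3r≤1
    0≤h : 0ℚ ≤ (p - q) * t - ℤ.+ 7 / 24
    0≤h = 0≤diff 7≤24rt

-- With `r = p - q`, the left side is at most `7/24 (r₁ + r₂)` and the right side is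
-- `((1 - r₁ r₂) / 2)²`. As `r₁` and `r₂` are at most `1/3`, the worst case is `r₁ = r₂ = 1/3`,
-- where `16/81 - 7/36 = 1/324` remains.
balanced-of-flat : ∀ {t₁ p₁ q₁ t₂ p₂ q₂} → p₁ ≡ 1ℚ - q₁ → p₂ ≡ 1ℚ - q₂ →
                   0ℚ ≤ q₁ → q₁ ≤ p₁ → 0ℚ ≤ q₂ → q₂ ≤ p₂ → p₁ ≤ t₁ → p₂ ≤ t₂ →
                   Balanced t₁ p₁ q₁ → Balanced t₂ p₂ q₂ →
                   (p₁ - q₁) * (p₂ - q₂) * (t₁ + t₂) ≤ (p₁ * q₂ + q₁ * p₂) * (p₁ * q₂ + q₁ * p₂)
balanced-of-flat {t₁} {_} {q₁} {t₂} {_} {q₂} refl refl 0≤q₁ q₁≤p₁ 0≤q₂ q₂≤p₂ p₁≤t₁ p₂≤t₂ bal₁ bal₂ = ≤-by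
  (0≤+ (0≤* 0≤r₂ (0≤diff (rt≤7/24 0≤q₁ q₁≤p₁ p₁≤t₁ bal₁))) (0≤+ (0≤* 0≤r₁ (0≤diff (rt≤7/24 0≤q₂ q₂≤p₂ p₂≤t₂ bal₂)))
  (0≤+ (0≤* (nonNegative⁻¹ (ℤ.+ 7 / 72)) (0≤+ 0≤y₁ 0≤y₂))
  (0≤+ (0≤* 0≤w 0≤w) (0≤+ (0≤* (nonNegative⁻¹ (ℤ.+ 8 / 9)) 0≤w) (nonNegative⁻¹ (ℤ.+ 1 / 324)))))))
  (solve 4 (λ t₁ q₁ t₂ q₂ →
    let p₁ = con 1ℚ :- q₁; p₂ = con 1ℚ :- q₂; r₁ = p₁ :- q₁; r₂ = p₂ :- q₂; q₃ = p₁ :* q₂ :+ q₁ :* p₂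
        y₁ = con 1ℚ :- con 3ℚ :* r₁; y₂ = con 1ℚ :- con 3ℚ :* r₂
        w = con (ℤ.+ 1 / 18) :* (y₁ :+ con 3ℚ :* r₁ :* y₂) in
    q₃ :* q₃ := r₁ :* r₂ :* (t₁ :+ t₂) :+ (r₂ :* (con (ℤ.+ 7 / 24) :- r₁ :* t₁) :+ (r₁ :* (con (ℤ.+ 7 / 24) :- r₂ :* t₂) :+
      (con (ℤ.+ 7 / 72) :* (y₁ :+ y₂) :+ (w :* w :+ (con (ℤ.+ 8 / 9) :* w :+ con (ℤ.+ 1 / 324))))))) refl t₁ q₁ t₂ q₂)
  where
  3ℚ : ℚ
  3ℚ = 2ℚ + 1ℚ
  r₁ r₂ y₁ y₂ w : ℚ
  r₁ = 1ℚ - q₁ - q₁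
  r₂ = 1ℚ - q₂ - q₂
  y₁ = 1ℚ - 3ℚ * r₁
  y₂ = 1ℚ - 3ℚ * r₂
  -- This is `(1 - 9 r₁ r₂) / 18 = q₃ - 4/9`, where `4/9` is the value of `q₃` at `r₁ = r₂ = 1/3`.
  w = ℤ.+ 1 / 18 * (y₁ + 3ℚ * r₁ * y₂)
  0≤r₁ : 0ℚ ≤ r₁
  0≤r₁ = 0≤diff q₁≤p₁
  0≤r₂ : 0ℚ ≤ r₂
  0≤r₂ = 0≤diff q₂≤p₂
  0≤y₁ : 0ℚ ≤ y₁
  0≤y₁ = 0≤diff (3r≤1 0≤q₁ q₁≤p₁ p₁≤t₁ bal₁)
  0≤y₂ : 0ℚ ≤ y₂
  0≤y₂ = 0≤diff (3r≤1 0≤q₂ q₂≤p₂ p₂≤t₂ bal₂)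
  0≤w : 0ℚ ≤ w
  0≤w = 0≤* (nonNegative⁻¹ (ℤ.+ 1 / 18)) (0≤+ 0≤y₁ (0≤* (0≤* (nonNegative⁻¹ 3ℚ) 0≤r₁) 0≤y₂))

p+q≡1 : ∀ {p q} → p ≡ 1ℚ - q → p + q ≡ 1ℚ
p+q≡1 {_} {q} refl = solve 1 (λ q → con 1ℚ :- q :+ q := con 1ℚ) refl q

balanced⇒decays : ∀ {t p q} → p ≡ 1ℚ - q → Balanced p t q → Decays (p - q) t
balanced⇒decays {t} {p} {q} p≡ bal n = subst ((p - q) * expSum (2ℚ * t) n ≤_) (p+q≡1 p≡)
  (bal (2ℚ * t) (trans (cong (2ℚ * t *_) (p+q≡1 p≡)) (*-identityʳ (2ℚ * t))) n)

decays⇒balanced : ∀ {t p q} → p ≡ 1ℚ - q → Decays (p - q) t → Balanced p t q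
decays⇒balanced {t} {p} {q} p≡ decays A A≡ n = subst₂ (λ x y → (p - q) * expSum x n ≤ y)
  (trans (sym A≡) (trans (cong (A *_) (p+q≡1 p≡)) (*-identityʳ A))) (sym (p+q≡1 p≡)) (decays n)

-- Covers `t ≤ q`, where the region demands nothing of this form but
-- `p - q = 1 - 2 q ≤ 1 - 2 t ≤ exp (- 2 t)`.
decays-linear : ∀ {r t} → 0ℚ ≤ t → r ≤ 1ℚ - 2ℚ * t → Decays r t
decays-linear 0≤t r≤1-2t n =
  ≤-trans (*-monoʳ-0≤ (expSum-nonNeg 0≤2t n) r≤1-2t) (expSum-1- 0≤2t n)
  where 0≤2t = 0≤* 0≤2 0≤t

decays-* : ∀ {r₁ t₁ r₂ t₂} → 0ℚ ≤ r₁ → 0ℚ ≤ r₂ → 0ℚ ≤ t₁ → 0ℚ ≤ t₂ →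
           Decays r₁ t₁ → Decays r₂ t₂ → Decays (r₁ * r₂) (t₁ + t₂)
decays-* {r₁} {t₁} {r₂} {t₂} 0≤r₁ 0≤r₂ 0≤t₁ 0≤t₂ d₁ d₂ n = ≤-trans
  (*-monoˡ-0≤ (0≤* 0≤r₁ 0≤r₂) (≤-trans (≤-reflexive (cong (λ x → expSum x n) (*-distribˡ-+ 2ℚ t₁ t₂)))
    (expSum-*-≥ (0≤* 0≤2 0≤t₁) (0≤* 0≤2 0≤t₂) n)))
  (≤-trans (≤-reflexive (solve 4 (λ r₁ r₂ x y → r₁ :* r₂ :* (x :* y) := r₁ :* x :* (r₂ :* y)) refl
              r₁ r₂ (expSum (2ℚ * t₁) (suc n)) (expSum (2ℚ * t₂) n)))
           (*-mono-0≤ (0≤* 0≤r₂ (expSum-nonNeg (0≤* 0≤2 0≤t₂) n)) 0≤1 (d₁ (suc n)) (d₂ n)))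

-- `b ≤ c` bounds `a - c` by `(a + c) (1 - A)`, and `1 - A ≤ exp (- A)`. This extends the condition
-- `t-min` to a factor with `t` above `q`, which `t₃ ≤ q₃` does not exclude.
balanced-of-mid≤min : ∀ {a b c} → 0ℚ < a + c → 0ℚ ≤ b → b ≤ c → Balanced a b c
balanced-of-mid≤min {a} {b} {c} 0<a+c 0≤b b≤c A A≡ n = ≤-trans
  (*-monoʳ-0≤ {a - c} (expSum-nonNeg 0≤A n) (≤-by (0≤* 0≤2 (0≤diff b≤c))
    (trans (solve 2 (λ s x → s :* (con 1ℚ :- x) := s :- x :* s) refl (a + c) A)
    (trans (cong (λ y → a + c - y) A≡)
      (solve 3 (λ a b c → a :+ c :- con 2ℚ :* b := a :- c :+ con 2ℚ :* (c :- b)) refl a b c)))))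
  (≤-trans (≤-reflexive (*-assoc (a + c) (1ℚ - A) (expSum A n)))
  (≤-trans (*-monoˡ-0≤ (<⇒≤ 0<a+c) (expSum-1- 0≤A n)) (≤-reflexive (*-identityʳ (a + c)))))
  where
  0≤A : 0ℚ ≤ A
  0≤A = exponent-nonNeg b A≡ 0<a+c 0≤b

balanced-compose : ∀ {t₁ p₁ q₁ t₂ p₂ q₂} → p₁ ≡ 1ℚ - q₁ → p₂ ≡ 1ℚ - q₂ →
  0ℚ ≤ t₁ → 0ℚ ≤ q₁ → q₁ ≤ p₁ → 0ℚ ≤ t₂ → 0ℚ ≤ q₂ → q₂ ≤ p₂ → t₁ ≤ p₁ → t₂ ≤ p₂ →
  Balanced p₁ q₁ t₁ → Balanced p₂ q₂ t₂ →
  Balanced (p₁ * p₂ + q₁ * q₂) (p₁ * q₂ + q₁ * p₂) (t₁ + t₂)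
balanced-compose {t₁} {p₁} {q₁} {t₂} {p₂} {q₂} refl refl 0≤t₁ 0≤q₁ q₁≤p₁ 0≤t₂ 0≤q₂ q₂≤p₂ t₁≤p₁ t₂≤p₂ bal₁ bal₂ A A≡ n =
  let A₁ , A₁≡ = exponent s₁ 0<s₁ q₁
      A₂ , A₂≡ = exponent s₂ 0<s₂ q₂
      0≤A₁ = exponent-nonNeg q₁ A₁≡ 0<s₁ 0≤q₁
      0≤A₂ = exponent-nonNeg q₂ A₂≡ 0<s₂ 0≤q₂
  in cancelʳ-≤ (s₁ * s₂) (0<* 0<s₁ 0<s₂) (≤-trans
    (≤-trans (≤-reflexive (solve 3 (λ x e s → x :* e :* s := x :* s :* e) refl (p₃ - t₃) (expSum A n) (s₁ * s₂)))
      (*-mono-0≤ (expSum-nonNeg 0≤A n) (0≤* (<⇒≤ 0<s₃) (0≤* 0≤d₁ 0≤d₂)) ratio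
        (≤-trans (expSum-monoᵃ 0≤A (A≤ A₁ A₂ A₁≡ A₂≡ 0≤A₁ 0≤A₂) n) (expSum-*-≥ 0≤A₁ 0≤A₂ n))))
    (≤-trans (≤-reflexive (solve 5 (λ s x y e f → s :* (x :* y) :* (e :* f) := s :* (x :* e :* (y :* f))) refl
               s₃ (p₁ - t₁) (p₂ - t₂) (expSum A₁ (suc n)) (expSum A₂ n)))
      (*-monoˡ-0≤ (<⇒≤ 0<s₃) (*-mono-0≤ (0≤* 0≤d₂ (expSum-nonNeg 0≤A₂ n)) (<⇒≤ 0<s₁) (bal₁ A₁ A₁≡ (suc n)) (bal₂ A₂ A₂≡ n)))))
  where
  t₃ p₃ q₃ s₁ s₂ s₃ : ℚ
  t₃ = t₁ + t₂
  p₃ = p₁ * p₂ + q₁ * q₂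
  q₃ = p₁ * q₂ + q₁ * p₂
  s₁ = p₁ + t₁
  s₂ = p₂ + t₂
  s₃ = p₃ + t₃
  0≤p₁ : 0ℚ ≤ p₁
  0≤p₁ = ≤-trans 0≤q₁ q₁≤p₁
  0≤p₂ : 0ℚ ≤ p₂
  0≤p₂ = ≤-trans 0≤q₂ q₂≤p₂
  0≤d₁ : 0ℚ ≤ p₁ - t₁
  0≤d₁ = 0≤diff t₁≤p₁
  0≤d₂ : 0ℚ ≤ p₂ - t₂
  0≤d₂ = 0≤diff t₂≤p₂
  0<s₁ : 0ℚ < s₁
  0<s₁ = <-≤-trans (0<larger refl q₁≤p₁) (≤-by 0≤t₁ refl)
  0<s₂ : 0ℚ < s₂
  0<s₂ = <-≤-trans (0<larger refl q₂≤p₂) (≤-by 0≤t₂ refl)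
  0<s₃ : 0ℚ < s₃
  0<s₃ = <-≤-trans (0<* (0<larger refl q₁≤p₁) (0<larger refl q₂≤p₂))
    (≤-by (0≤+ (0≤* 0≤q₁ 0≤q₂) (0≤+ 0≤t₁ 0≤t₂)) (+-assoc (p₁ * p₂) (q₁ * q₂) t₃))
  0≤A : 0ℚ ≤ A
  0≤A = exponent-nonNeg q₃ A≡ 0<s₃ (0≤+ (0≤* 0≤p₁ 0≤q₂) (0≤* 0≤q₁ 0≤p₂))
  -- `s₃` is at least `s₁ p₂` and at least `s₂ p₁`, so `(A₁ + A₂) s₃ ≥ 2 q₁ p₂ + 2 q₂ p₁ = 2 q₃`.
  A≤ : ∀ A₁ A₂ → A₁ * s₁ ≡ 2ℚ * q₁ → A₂ * s₂ ≡ 2ℚ * q₂ → 0ℚ ≤ A₁ → 0ℚ ≤ A₂ → A ≤ A₁ + A₂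
  A≤ A₁ A₂ A₁≡ A₂≡ 0≤A₁ 0≤A₂ = cancelʳ-≤ s₃ 0<s₃ (≤-by
    (0≤+ (0≤* 0≤A₁ (0≤+ (0≤* 0≤q₁ 0≤q₂) (0≤+ (0≤* 0≤t₁ 0≤q₂) 0≤t₂)))
         (0≤* 0≤A₂ (0≤+ (0≤* 0≤q₁ 0≤q₂) (0≤+ 0≤t₁ (0≤* 0≤t₂ 0≤q₁)))))
    (trans
      (solve 6 (λ a₁ a₂ t₁ q₁ t₂ q₂ → let p₁ = con 1ℚ :- q₁; p₂ = con 1ℚ :- q₂ in
        (a₁ :+ a₂) :* (p₁ :* p₂ :+ q₁ :* q₂ :+ (t₁ :+ t₂)) :=
        a₁ :* (p₁ :+ t₁) :* p₂ :+ a₂ :* (p₂ :+ t₂) :* p₁ :+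
          (a₁ :* (q₁ :* q₂ :+ (t₁ :* q₂ :+ t₂)) :+ a₂ :* (q₁ :* q₂ :+ (t₁ :+ t₂ :* q₁)))) refl A₁ A₂ t₁ q₁ t₂ q₂)
      (cong (_+ (A₁ * (q₁ * q₂ + (t₁ * q₂ + t₂)) + A₂ * (q₁ * q₂ + (t₁ + t₂ * q₁))))
        (trans (cong₂ (λ x y → x * p₂ + y * p₁) A₁≡ A₂≡)
        (trans (solve 4 (λ p₁ q₁ p₂ q₂ → con 2ℚ :* q₁ :* p₂ :+ con 2ℚ :* q₂ :* p₁ := con 2ℚ :* (p₁ :* q₂ :+ q₁ :* p₂))
                  refl p₁ q₁ p₂ q₂) (sym A≡))))))
  ratio : (p₃ - t₃) * (s₁ * s₂) ≤ s₃ * ((p₁ - t₁) * (p₂ - t₂))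
  ratio = ≤-by (0≤* 0≤2 (0≤+
      (0≤+ (0≤* (0≤* (0≤* 0≤t₂ 0≤p₁) 0≤q₁) (0≤diff q₂≤p₂)) (0≤* (0≤* (0≤* 0≤t₁ 0≤p₂) 0≤q₂) (0≤diff q₁≤p₁)))
      (0≤* (0≤+ 0≤t₁ 0≤t₂) (0≤* 0≤t₁ 0≤t₂))))
    (solve 4 (λ t₁ q₁ t₂ q₂ →
      let p₁ = con 1ℚ :- q₁; p₂ = con 1ℚ :- q₂; t₃ = t₁ :+ t₂; p₃ = p₁ :* p₂ :+ q₁ :* q₂ in
      (p₃ :+ t₃) :* ((p₁ :- t₁) :* (p₂ :- t₂)) := (p₃ :- t₃) :* ((p₁ :+ t₁) :* (p₂ :+ t₂)) :+
        con 2ℚ :* (t₂ :* p₁ :* q₁ :* (p₂ :- q₂) :+ t₁ :* p₂ :* q₂ :* (p₁ :- q₁) :+ t₃ :* (t₁ :* t₂))) refl t₁ q₁ t₂ q₂)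

-- The condition for a triple proportional to (t, p, q), with p ≥ q, to lie in S.
record Region (t p q : ℚ) : Set where
  field
    0≤t   : 0ℚ ≤ t
    0≤q   : 0ℚ ≤ q
    q≤p   : q ≤ p
    t-max : p ≤ t → Balanced t p q
    t-mid : q ≤ t → t ≤ p → Balanced p t q
    t-min : t ≤ q → Balanced p q t

-- `t₃` is at least `t₁` and `t₂`, while `p₃` is at most `p₁` and `p₂`. Hence `t₃ ≤ p₃` forces
-- `t₁ ≤ p₁` and `t₂ ≤ p₂`, and a factor with `t` above `p` has to be treated only under `t-max`.
region-compose : ∀ {t₁ p₁ q₁ t₂ p₂ q₂} → p₁ ≡ 1ℚ - q₁ → p₂ ≡ 1ℚ - q₂ → Region t₁ p₁ q₁ → Region t₂ p₂ q₂ →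
                 Region (t₁ + t₂) (p₁ * p₂ + q₁ * q₂) (p₁ * q₂ + q₁ * p₂)
region-compose {t₁} {p₁} {q₁} {t₂} {p₂} {q₂} p₁≡ p₂≡ R₁ R₂ = record
  { 0≤t = 0≤+ 0≤t₁ 0≤t₂ ; 0≤q = 0≤q₃ ; q≤p = q₃≤p₃
  ; t-max = t-max₃
  ; t-mid = λ q₃≤t₃ t₃≤p₃ → decays⇒balanced {t₁ + t₂} p₃≡
      (decays₃ (≤-trans t₁≤t₃ (≤-trans t₃≤p₃ p₃≤p₁)) (≤-trans t₂≤t₃ (≤-trans t₃≤p₃ p₃≤p₂)))
  ; t-min = λ t₃≤q₃ →
      let t₁≤p₁ = ≤-trans t₁≤t₃ (≤-trans t₃≤q₃ (≤-trans q₃≤p₃ p₃≤p₁))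
          t₂≤p₂ = ≤-trans t₂≤t₃ (≤-trans t₃≤q₃ (≤-trans q₃≤p₃ p₃≤p₂))
      in balanced-compose p₁≡ p₂≡ 0≤t₁ 0≤q₁ q₁≤p₁ 0≤t₂ 0≤q₂ q₂≤p₂ t₁≤p₁ t₂≤p₂
           (min-balanced p₁≡ R₁) (min-balanced p₂≡ R₂)
  }
  where
  open Region R₁ renaming (0≤t to 0≤t₁; 0≤q to 0≤q₁; q≤p to q₁≤p₁; t-max to t-max₁)
  open Region R₂ renaming (0≤t to 0≤t₂; 0≤q to 0≤q₂; q≤p to q₂≤p₂; t-max to t-max₂)
  t₃ p₃ q₃ : ℚ
  t₃ = t₁ + t₂
  p₃ = p₁ * p₂ + q₁ * q₂
  q₃ = p₁ * q₂ + q₁ * p₂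
  0≤p₁ = ≤-trans 0≤q₁ q₁≤p₁
  0≤p₂ = ≤-trans 0≤q₂ q₂≤p₂
  0≤q₃ : 0ℚ ≤ q₃
  0≤q₃ = 0≤+ (0≤* 0≤p₁ 0≤q₂) (0≤* 0≤q₁ 0≤p₂)
  t₁≤t₃ : t₁ ≤ t₃
  t₁≤t₃ = ≤-by 0≤t₂ refl
  t₂≤t₃ : t₂ ≤ t₃
  t₂≤t₃ = ≤-by 0≤t₁ (+-comm t₁ t₂)
  r₃≡ : p₃ - q₃ ≡ (p₁ - q₁) * (p₂ - q₂)
  r₃≡ = solve 4 (λ p₁ q₁ p₂ q₂ → p₁ :* p₂ :+ q₁ :* q₂ :- (p₁ :* q₂ :+ q₁ :* p₂) := (p₁ :- q₁) :* (p₂ :- q₂)) refl p₁ q₁ p₂ q₂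
  q₃≤p₃ : q₃ ≤ p₃
  q₃≤p₃ = ≤-by (0≤* (0≤diff q₁≤p₁) (0≤diff q₂≤p₂))
    (solve 4 (λ p₁ q₁ p₂ q₂ → p₁ :* p₂ :+ q₁ :* q₂ := p₁ :* q₂ :+ q₁ :* p₂ :+ (p₁ :- q₁) :* (p₂ :- q₂)) refl p₁ q₁ p₂ q₂)
  p₃≡ : p₃ ≡ 1ℚ - q₃
  p₃≡ = trans (cong₂ (λ x y → x * y + q₁ * q₂) p₁≡ p₂≡)
    (trans (solve 2 (λ q₁ q₂ → let p₁ = con 1ℚ :- q₁; p₂ = con 1ℚ :- q₂ in
              p₁ :* p₂ :+ q₁ :* q₂ := con 1ℚ :- (p₁ :* q₂ :+ q₁ :* p₂)) refl q₁ q₂)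
           (cong₂ (λ x y → 1ℚ - (x * q₂ + q₁ * y)) (sym p₁≡) (sym p₂≡)))
  p₃≤p₁ : p₃ ≤ p₁
  p₃≤p₁ = ≤-by (0≤* 0≤q₂ (0≤diff q₁≤p₁)) (trans
    (solve 3 (λ p₁ q₁ q₂ → p₁ := p₁ :* (con 1ℚ :- q₂) :+ q₁ :* q₂ :+ q₂ :* (p₁ :- q₁)) refl p₁ q₁ q₂)
    (cong (λ x → p₁ * x + q₁ * q₂ + q₂ * (p₁ - q₁)) (sym p₂≡)))
  p₃≤p₂ : p₃ ≤ p₂
  p₃≤p₂ = ≤-by (0≤* 0≤q₁ (0≤diff q₂≤p₂)) (trans
    (solve 3 (λ p₂ q₁ q₂ → p₂ := (con 1ℚ :- q₁) :* p₂ :+ q₁ :* q₂ :+ q₁ :* (p₂ :- q₂)) refl p₂ q₁ q₂)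
    (cong (λ x → x * p₂ + q₁ * q₂ + q₁ * (p₂ - q₂)) (sym p₁≡)))
  decays-of : ∀ {t p q} → p ≡ 1ℚ - q → Region t p q → t ≤ p → Decays (p - q) t
  decays-of {t} {p} {q} p≡ R t≤p with ≤-total q t
  ... | inj₁ q≤t = balanced⇒decays {t} p≡ (Region.t-mid R q≤t t≤p)
  ... | inj₂ t≤q = decays-linear {p - q} {t} (Region.0≤t R) (≤-by (0≤* 0≤2 (0≤diff t≤q)) (trans
    (solve 2 (λ t q → con 1ℚ :- con 2ℚ :* t := con 1ℚ :- q :- q :+ con 2ℚ :* (q :- t)) refl t q)
    (cong (λ x → x - q + 2ℚ * (q - t)) (sym p≡))))
  min-balanced : ∀ {t p q} → p ≡ 1ℚ - q → Region t p q → Balanced p q t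
  min-balanced {t} {p} {q} p≡ R with ≤-total t q
  ... | inj₁ t≤q = Region.t-min R t≤q
  ... | inj₂ q≤t = balanced-of-mid≤min {p} {q} {t}
    (<-≤-trans (0<larger p≡ (Region.q≤p R)) (≤-by (Region.0≤t R) refl)) (Region.0≤q R) q≤t
  decays₃ : t₁ ≤ p₁ → t₂ ≤ p₂ → Decays (p₃ - q₃) t₃
  decays₃ t₁≤p₁ t₂≤p₂ = subst (λ r → Decays r t₃) (sym r₃≡)
    (decays-* (0≤diff q₁≤p₁) (0≤diff q₂≤p₂) 0≤t₁ 0≤t₂ (decays-of p₁≡ R₁ t₁≤p₁) (decays-of p₂≡ R₂ t₂≤p₂))
  -- The partial sum with two terms is `1 + 2 t`; this is the decay that `balanced-shift` asks for,
  -- with `t` as the shift.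
  slow : ∀ {r t r′} → 0ℚ ≤ r′ → Decays r t → r * r′ * (1ℚ + 2ℚ * t) ≤ r′
  slow {r} {t} {r′} 0≤r′ d = ≤-trans
    (≤-reflexive (solve 3 (λ r t r′ → r :* r′ :* (con 1ℚ :+ con 2ℚ :* t)
       := r :* (con 0ℚ :+ con 1ℚ :+ con 1ℚ :* (con 2ℚ :* t :* con 1ℚ)) :* r′) refl r t r′))
    (≤-trans (*-monoʳ-0≤ 0≤r′ (d 2)) (≤-reflexive (*-identityˡ r′)))
  t-max₃ : p₃ ≤ t₃ → Balanced t₃ p₃ q₃
  t-max₃ p₃≤t₃ with ≤-total t₁ p₁ | ≤-total t₂ p₂
  ... | inj₁ t₁≤p₁ | inj₁ t₂≤p₂ = balanced-of-decays p₃≡ 0≤q₃ q₃≤p₃ p₃≤t₃ (decays₃ t₁≤p₁ t₂≤p₂)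
  ... | inj₁ t₁≤p₁ | inj₂ p₂≤t₂ = subst (λ t → Balanced t p₃ q₃) (+-comm t₂ t₁)
    (balanced-shift p₂≡ p₃≡ 0≤q₂ q₂≤p₂ 0≤q₃ q₃≤p₃ p₂≤t₂ 0≤t₁ (t-max₂ p₂≤t₂)
      (≤-trans (≤-reflexive (cong (_* (1ℚ + 2ℚ * t₁)) r₃≡)) (slow {p₁ - q₁} {t₁} (0≤diff q₂≤p₂) (decays-of p₁≡ R₁ t₁≤p₁))))
  ... | inj₂ p₁≤t₁ | inj₁ t₂≤p₂ =
    balanced-shift p₁≡ p₃≡ 0≤q₁ q₁≤p₁ 0≤q₃ q₃≤p₃ p₁≤t₁ 0≤t₂ (t-max₁ p₁≤t₁)
      (≤-trans (≤-reflexive (cong (_* (1ℚ + 2ℚ * t₂)) (trans r₃≡ (*-comm (p₁ - q₁) (p₂ - q₂)))))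
               (slow {p₂ - q₂} {t₂} (0≤diff q₁≤p₁) (decays-of p₂≡ R₂ t₂≤p₂)))
  ... | inj₂ p₁≤t₁ | inj₂ p₂≤t₂ =
    balanced-of-crude p₃≡ 0≤q₃ q₃≤p₃ (≤-trans q₃≤p₃ p₃≤t₃) (<-≤-trans (0<larger p₃≡ q₃≤p₃) p₃≤t₃)
      (≤-trans (≤-reflexive (cong (_* t₃) r₃≡))
        (balanced-of-flat p₁≡ p₂≡ 0≤q₁ q₁≤p₁ 0≤q₂ q₂≤p₂ p₁≤t₁ p₂≤t₂ (t-max₁ p₁≤t₁) (t-max₂ p₂≤t₂)))

-- From reals to rationals

≤ᴿ⇒≤ : ∀ {p q} → ι p ≤ᴿ ι q → p ≤ q
≤ᴿ⇒≤ {p} {q} h = ≤-approx 1ℚ (positive⁻¹ 1ℚ) λ ε 0<ε →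
  let N , p≤q+ε = h ε 0<ε in ≤-trans (p≤q+ε N ℕ.≤-refl) (≤-reflexive (cong (q +_) (sym (*-identityˡ ε))))

≤⇒≤ᴿ : ∀ {p q} → p ≤ q → ι p ≤ᴿ ι q
≤⇒≤ᴿ p≤q ε 0<ε = 0 , λ _ _ → ≤-trans p≤q (≤-by (<⇒≤ 0<ε) refl)

module _ {a b c} (c≤b : c ≤ b) (b≤a : b ≤ a) (0≤c : 0ℚ ≤ c) (sum≡1 : a + b + c ≡ 1ℚ) where

  private
    0≤b : 0ℚ ≤ b
    0≤b = ≤-trans 0≤c c≤b
    s : ℚ
    s = a + c
    s≡1-b : s ≡ 1ℚ - b
    s≡1-b = trans (solve 3 (λ a b c → a :+ c := a :+ b :+ c :- b) refl a b c) (cong (_- b) sum≡1)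
    0<s : 0ℚ < s
    0<s = *-cancelʳ-<-nonNeg 2ℚ (<-≤-trans (positive⁻¹ 1ℚ) (≤-by (0≤+ 0≤c (0≤diff b≤a))
      (trans (solve 3 (λ a b c → (a :+ c) :* con 2ℚ := a :+ b :+ c :+ (c :+ (a :- b))) refl a b c)
             (cong (_+ (c + (a - b))) sum≡1))))
    b-1≢0 : b - 1ℚ ≢ 0ℚ
    b-1≢0 b-1≡0 = <-irrefl (sym (trans s≡1-b (trans (solve 1 (λ b → con 1ℚ :- b := :- (b :- con 1ℚ)) refl b) (cong -_ b-1≡0)))) 0<s
    x A : ℚ
    x = (1ℚ + 1ℚ) * b * inv (b - 1ℚ)
    A = - x
    A≡ : A * s ≡ 2ℚ * b
    A≡ = trans (cong (A *_) s≡1-b) (trans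
      (solve 2 (λ b i → :- (con (1ℚ + 1ℚ) :* b :* i) :* (con 1ℚ :- b) := con 2ℚ :* b :* (i :* (b :- con 1ℚ))) refl b (inv (b - 1ℚ)))
      (trans (cong (2ℚ * b *_) (inv-inverse b-1≢0)) (*-identityʳ (2ℚ * b))))
    -A≡x : - A ≡ x
    -A≡x = solve 1 (λ x → :- (:- x) := x) refl x
    A-unique : ∀ A′ → A′ * s ≡ 2ℚ * b → A′ ≡ A
    A-unique A′ A′≡ = cancelʳ-≡ s 0<s (trans A′≡ (sym A≡))
    0≤A : 0ℚ ≤ A
    0≤A = exponent-nonNeg b A≡ 0<s 0≤b
    2ε : ∀ {ε} → 0ℚ < ε → 0ℚ < ½ * ε
    2ε = 0<* (positive⁻¹ ½)
    gap : ∀ e ε → (s * e + 2ℚ * ε) + 2ℚ * (½ * (1ℚ - b) * (1ℚ - e)) ≡ (a - c) + 2ℚ * (c + ε)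
    gap e ε = trans (cong (λ y → s * e + 2ℚ * ε + 2ℚ * (½ * y * (1ℚ - e))) (sym s≡1-b))
      (solve 4 (λ a c e ε → ((a :+ c) :* e :+ con 2ℚ :* ε) :+ con 2ℚ :* (con ½ :* (a :+ c) :* (con 1ℚ :- e))
         := (a :- c) :+ con 2ℚ :* (c :+ ε)) refl a c e ε)

  -- The hypothesis is `γ ≥ᴿ f β` unfolded on constant sequences. As `1 - b = a + c`, it bounds
  -- `a - c` by `s` times the exponential up to twice its tolerance, hence the `½ * ε`.
  f≤⇒balanced : (∀ ε → 0ℚ < ε → Eventually (λ n → ½ * (1ℚ - b) * (1ℚ - expSum x n) ≤ c + ε)) → Balanced a b c
  f≤⇒balanced h A′ A′≡ n = subst (λ y → (a - c) * expSum y n ≤ s) (sym (A-unique A′ A′≡))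
    (≤exp-⇒ 0≤A (a - c) s 0<s (λ ε 0<ε → let N , g = h (½ * ε) (2ε 0<ε) in N , λ k N≤k →
      subst (λ y → a - c ≤ s * expSum y k + ε) (sym -A≡x) (≤-by (0≤* 0≤2 (0≤diff (g k N≤k))) (shift (expSum x k) ε))) n)
    where
    shift : ∀ e ε → s * e + ε ≡ a - c + 2ℚ * (c + ½ * ε - ½ * (1ℚ - b) * (1ℚ - e))
    shift e ε = trans (solve 3 (λ y ε g → y :+ ε := (y :+ con 2ℚ :* (con ½ :* ε)) :+ con 2ℚ :* g :- con 2ℚ :* g) refl
                         (s * e) ε (½ * (1ℚ - b) * (1ℚ - e)))
      (trans (cong (_- 2ℚ * (½ * (1ℚ - b) * (1ℚ - e))) (gap e (½ * ε)))
        (solve 3 (λ x y g → x :+ con 2ℚ :* y :- con 2ℚ :* g := x :+ con 2ℚ :* (y :- g)) refl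
          (a - c) (c + ½ * ε) (½ * (1ℚ - b) * (1ℚ - e))))

  balanced⇒f≤ : Balanced a b c → ∀ ε → 0ℚ < ε → Eventually (λ n → ½ * (1ℚ - b) * (1ℚ - expSum x n) ≤ c + ε)
  balanced⇒f≤ bal ε 0<ε =
    let N , g = ≤exp-⇐ 0≤A (a - c) s 0<s (bal A A≡) ε 0<ε
    in N , λ k N≤k → ≤-by {d = ½ * (s * expSum x k + ε - (a - c)) + ½ * ε}
      (0≤+ (0≤* (nonNegative⁻¹ ½) (0≤diff (subst (λ y → a - c ≤ s * expSum y k + ε) -A≡x (g k N≤k))))
           (0≤* (nonNegative⁻¹ ½) (<⇒≤ 0<ε)))
      (shift (expSum x k))
    where
    shift : ∀ e → c + ε ≡ ½ * (1ℚ - b) * (1ℚ - e) + (½ * (s * e + ε - (a - c)) + ½ * ε)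
    shift e = trans (solve 4 (λ a c e ε → c :+ ε := con ½ :* (a :+ c) :* (con 1ℚ :- e)
                      :+ (con ½ :* ((a :+ c) :* e :+ ε :- (a :- c)) :+ con ½ :* ε)) refl a c e ε)
      (cong (λ y → ½ * y * (1ℚ - e) + (½ * (s * e + ε - (a - c)) + ½ * ε)) s≡1-b)

sorted⇒ : ∀ {a b c} → Sorted∈S (ι a) (ι b) (ι c) → b ≤ a × c ≤ b × Balanced a b c
sorted⇒ sorted =
  let b≤a = ≤ᴿ⇒≤ α≥β; c≤b = ≤ᴿ⇒≤ β≥γ in
  b≤a , c≤b , f≤⇒balanced c≤b b≤a (≤ᴿ⇒≤ γ≥0) (≤-antisym (≤ᴿ⇒≤ (proj₁ sum≃1)) (≤ᴿ⇒≤ (proj₂ sum≃1))) γ≥fβ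
  where open Sorted∈S sorted

⇒sorted : ∀ {a b c} → b ≤ a → c ≤ b → 0ℚ ≤ c → a + b + c ≡ 1ℚ → Balanced a b c → Sorted∈S (ι a) (ι b) (ι c)
⇒sorted b≤a c≤b 0≤c sum≡1 bal = record
  { α≥β   = ≤⇒≤ᴿ b≤a
  ; β≥γ   = ≤⇒≤ᴿ c≤b
  ; γ≥0   = ≤⇒≤ᴿ 0≤c
  ; sum≃1 = ≤⇒≤ᴿ (≤-reflexive sum≡1) , ≤⇒≤ᴿ (≤-reflexive (sym sum≡1))
  ; γ≥fβ  = balanced⇒f≤ c≤b b≤a 0≤c sum≡1 bal
  }

-- The orders that sort a triple

Sorted∈S-resp : ∀ {x y z x′ y′ z′} → x ≡ x′ → y ≡ y′ → z ≡ z′ → Sorted∈S x y z → Sorted∈S x′ y′ z′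
Sorted∈S-resp refl refl refl sorted = sorted

-- Ties leave the permutation in `S` undetermined, so the condition is demanded for every order that
-- sorts the triple, and later arguments do not depend on a choice.
record Admissible (a b c : ℚ) : Set where
  field
    abc : b ≤ a → c ≤ b → Balanced a b c
    acb : c ≤ a → b ≤ c → Balanced a c b
    bac : a ≤ b → c ≤ a → Balanced b a c
    bca : c ≤ b → a ≤ c → Balanced b c a
    cab : a ≤ c → b ≤ a → Balanced c a b
    cba : b ≤ c → a ≤ b → Balanced c b a

-- Several orders may sort a triple with ties, but they list the same values. This carries the
-- single condition supplied by `S` over to every sorting order.
sorted-unique : (u : Fin 3 → ℚ) → u 1F ≤ u 0F → u 2F ≤ u 1F → ∀ i j k → i ≢ j → i ≢ k → j ≢ k →
                u j ≤ u i → u k ≤ u j → u 0F ≡ u i × u 1F ≡ u j × u 2F ≡ u k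
sorted-unique u u₁≤u₀ u₂≤u₁ = go
  where
  go : ∀ i j k → i ≢ j → i ≢ k → j ≢ k → u j ≤ u i → u k ≤ u j → u 0F ≡ u i × u 1F ≡ u j × u 2F ≡ u k
  go 0F 0F _  i≢j _ _ = ⊥-elim (i≢j refl)
  go 1F 1F _  i≢j _ _ = ⊥-elim (i≢j refl)
  go 2F 2F _  i≢j _ _ = ⊥-elim (i≢j refl)
  go 0F _  0F _ i≢k _ = ⊥-elim (i≢k refl)
  go 1F _  1F _ i≢k _ = ⊥-elim (i≢k refl)
  go 2F _  2F _ i≢k _ = ⊥-elim (i≢k refl)
  go _  0F 0F _ _ j≢k = ⊥-elim (j≢k refl)
  go _  1F 1F _ _ j≢k = ⊥-elim (j≢k refl)
  go _  2F 2F _ _ j≢k = ⊥-elim (j≢k refl)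
  go 0F 1F 2F _ _ _ _ _ = refl , refl , refl
  go 0F 2F 1F _ _ _ _ u₁≤u₂ = refl , ≤-antisym u₁≤u₂ u₂≤u₁ , ≤-antisym u₂≤u₁ u₁≤u₂
  go 1F 0F 2F _ _ _ u₀≤u₁ _ = ≤-antisym u₀≤u₁ u₁≤u₀ , ≤-antisym u₁≤u₀ u₀≤u₁ , refl
  go 1F 2F 0F _ _ _ _ u₀≤u₂ =
    ≤-antisym (≤-trans u₀≤u₂ u₂≤u₁) u₁≤u₀ , ≤-antisym (≤-trans u₁≤u₀ u₀≤u₂) u₂≤u₁ , ≤-antisym (≤-trans u₂≤u₁ u₁≤u₀) u₀≤u₂
  go 2F 0F 1F _ _ _ u₀≤u₂ _ =
    ≤-antisym u₀≤u₂ (≤-trans u₂≤u₁ u₁≤u₀) , ≤-antisym u₁≤u₀ (≤-trans u₀≤u₂ u₂≤u₁) , ≤-antisym u₂≤u₁ (≤-trans u₁≤u₀ u₀≤u₂)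
  go 2F 1F 0F _ _ _ u₁≤u₂ u₀≤u₁ =
    ≤-antisym (≤-trans u₀≤u₁ u₁≤u₂) (≤-trans u₂≤u₁ u₁≤u₀) , refl , ≤-antisym (≤-trans u₂≤u₁ u₁≤u₀) (≤-trans u₀≤u₁ u₁≤u₂)

S⇒admissible : ∀ {a b c} → S (ι a ∷ ι b ∷ ι c ∷ []) → Admissible a b c
S⇒admissible {a} {b} {c} (π , sorted) = record
  { abc = balanced 0F 1F 2F (λ ()) (λ ()) (λ ())
  ; acb = balanced 0F 2F 1F (λ ()) (λ ()) (λ ())
  ; bac = balanced 1F 0F 2F (λ ()) (λ ()) (λ ())
  ; bca = balanced 1F 2F 0F (λ ()) (λ ()) (λ ())
  ; cab = balanced 2F 0F 1F (λ ()) (λ ()) (λ ())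
  ; cba = balanced 2F 1F 0F (λ ()) (λ ()) (λ ())
  }
  where
  w u : Fin 3 → ℚ
  w = a ∷ b ∷ c ∷ []
  u = w ∘ (π ⟨$⟩ʳ_)
  ι-w : ∀ i → (ι a ∷ ι b ∷ ι c ∷ []) i ≡ ι (w i)
  ι-w 0F = refl
  ι-w 1F = refl
  ι-w 2F = refl
  u-facts : u 1F ≤ u 0F × u 2F ≤ u 1F × Balanced (u 0F) (u 1F) (u 2F)
  u-facts = sorted⇒ (Sorted∈S-resp (ι-w (π ⟨$⟩ʳ 0F)) (ι-w (π ⟨$⟩ʳ 1F)) (ι-w (π ⟨$⟩ʳ 2F)) sorted)
  π⁻¹-≢ : ∀ {i j} → i ≢ j → π ⟨$⟩ˡ i ≢ π ⟨$⟩ˡ j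
  π⁻¹-≢ i≢j eq = i≢j (trans (sym (inverseʳ π)) (trans (cong (π ⟨$⟩ʳ_) eq) (inverseʳ π)))
  u-π⁻¹ : ∀ i → w i ≡ u (π ⟨$⟩ˡ i)
  u-π⁻¹ i = cong w (sym (inverseʳ π))
  balanced : ∀ i j k → i ≢ j → i ≢ k → j ≢ k → w j ≤ w i → w k ≤ w j → Balanced (w i) (w j) (w k)
  balanced i j k i≢j i≢k j≢k wj≤wi wk≤wj =
    let u₁≤u₀ , u₂≤u₁ , bal = u-facts
        e₀ , e₁ , e₂ = sorted-unique u u₁≤u₀ u₂≤u₁ (π ⟨$⟩ˡ i) (π ⟨$⟩ˡ j) (π ⟨$⟩ˡ k)
          (π⁻¹-≢ i≢j) (π⁻¹-≢ i≢k) (π⁻¹-≢ j≢k)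
          (subst₂ _≤_ (u-π⁻¹ j) (u-π⁻¹ i) wj≤wi) (subst₂ _≤_ (u-π⁻¹ k) (u-π⁻¹ j) wk≤wj)
    in subst (λ x → Balanced x (w j) (w k)) (trans e₀ (sym (u-π⁻¹ i)))
         (subst₂ (Balanced (u 0F)) (trans e₁ (sym (u-π⁻¹ j))) (trans e₂ (sym (u-π⁻¹ k))) bal)

admissible⇒S : ∀ {a b c} → 0ℚ ≤ a → 0ℚ ≤ b → 0ℚ ≤ c → a + b + c ≡ 1ℚ → Admissible a b c → S (ι a ∷ ι b ∷ ι c ∷ [])
admissible⇒S {a} {b} {c} 0≤a 0≤b 0≤c sum adm with ≤-total a b | ≤-total b c | ≤-total a c
... | inj₂ b≤a | inj₂ c≤b | _        = id , ⇒sorted b≤a c≤b 0≤c sum (abc b≤a c≤b)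
  where open Admissible adm
... | inj₂ b≤a | inj₁ b≤c | inj₂ c≤a = transpose 1F 2F , ⇒sorted c≤a b≤c 0≤b
    (trans (solve 3 (λ a b c → a :+ c :+ b := a :+ b :+ c) refl a b c) sum) (acb c≤a b≤c)
  where open Admissible adm
... | inj₂ b≤a | inj₁ b≤c | inj₁ a≤c = transpose 1F 2F ∘ₚ transpose 0F 2F , ⇒sorted a≤c b≤a 0≤b
    (trans (solve 3 (λ a b c → c :+ a :+ b := a :+ b :+ c) refl a b c) sum) (cab a≤c b≤a)
  where open Admissible adm
... | inj₁ a≤b | inj₁ b≤c | _        = transpose 0F 2F , ⇒sorted b≤c a≤b 0≤a
    (trans (solve 3 (λ a b c → c :+ b :+ a := a :+ b :+ c) refl a b c) sum) (cba b≤c a≤b)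
  where open Admissible adm
... | inj₁ a≤b | inj₂ c≤b | inj₂ c≤a = transpose 0F 1F , ⇒sorted a≤b c≤a 0≤c
    (trans (solve 3 (λ a b c → b :+ a :+ c := a :+ b :+ c) refl a b c) sum) (bac a≤b c≤a)
  where open Admissible adm
... | inj₁ a≤b | inj₂ c≤b | inj₁ a≤c = transpose 1F 2F ∘ₚ transpose 0F 1F , ⇒sorted c≤b a≤c 0≤a
    (trans (solve 3 (λ a b c → b :+ c :+ a := a :+ b :+ c) refl a b c) sum) (bca c≤b a≤c)
  where open Admissible adm

admissible-swap : ∀ {a b c} → Admissible a b c → Admissible a c b
admissible-swap adm = record { abc = acb ; acb = abc ; bac = cab ; bca = cba ; cab = bac ; cba = bca }
  where open Admissible adm

-- Both sides scale with `μ`, and the exponent `A` is a quotient of degree 0.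
balanced-scale : ∀ {a b c} μ → 0ℚ < μ → Balanced a b c → Balanced (μ * a) (μ * b) (μ * c)
balanced-scale {a} {b} {c} μ 0<μ bal A A≡ n = subst₂ _≤_
  (solve 4 (λ μ a c e → μ :* ((a :- c) :* e) := (μ :* a :- μ :* c) :* e) refl μ a c (expSum A n))
  (*-distribˡ-+ μ a c)
  (*-monoˡ-0≤ (<⇒≤ 0<μ) (bal A (cancelʳ-≡ μ 0<μ (trans
    (solve 4 (λ A a c μ → A :* (a :+ c) :* μ := A :* (μ :* a :+ μ :* c)) refl A a c μ)
    (trans A≡ (solve 2 (λ b μ → con 2ℚ :* (μ :* b) := con 2ℚ :* b :* μ) refl b μ)))) n))

admissible-scale : ∀ {a b c} μ → 0ℚ < μ → Admissible a b c → Admissible (μ * a) (μ * b) (μ * c)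
admissible-scale μ 0<μ adm = record
  { abc = λ x y → balanced-scale μ 0<μ (abc (cancel x) (cancel y))
  ; acb = λ x y → balanced-scale μ 0<μ (acb (cancel x) (cancel y))
  ; bac = λ x y → balanced-scale μ 0<μ (bac (cancel x) (cancel y))
  ; bca = λ x y → balanced-scale μ 0<μ (bca (cancel x) (cancel y))
  ; cab = λ x y → balanced-scale μ 0<μ (cab (cancel x) (cancel y))
  ; cba = λ x y → balanced-scale μ 0<μ (cba (cancel x) (cancel y))
  }
  where
  open Admissible adm
  cancel : ∀ {p q} → μ * p ≤ μ * q → p ≤ q
  cancel {p} {q} = *-cancelˡ-≤-pos μ {{positive 0<μ}}

admissible⇒region : ∀ {t p q} → 0ℚ ≤ t → 0ℚ ≤ q → q ≤ p → Admissible t p q → Region t p q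
admissible⇒region 0≤t 0≤q q≤p adm = record
  { 0≤t = 0≤t ; 0≤q = 0≤q ; q≤p = q≤p
  ; t-max = λ p≤t → abc p≤t q≤p
  ; t-mid = λ q≤t t≤p → bac t≤p q≤t
  ; t-min = λ t≤q → bca q≤p t≤q
  }
  where open Admissible adm

-- An order that puts `q` before `p` sorts the triple only in case of ties, where antisymmetry
-- reduces it to one of the three conditions.
region⇒admissible : ∀ {t p q} → Region t p q → Admissible t p q
region⇒admissible {t} {p} {q} R = record
  { abc = λ p≤t _ → t-max p≤t
  ; acb = λ q≤t p≤q → subst₂ (Balanced t) (≤-antisym p≤q q≤p) (≤-antisym q≤p p≤q) (t-max (≤-trans p≤q q≤t))
  ; bac = λ t≤p q≤t → t-mid q≤t t≤p
  ; bca = λ _ t≤q → t-min t≤q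
  ; cab = λ t≤q p≤t → subst₂ (λ x y → Balanced x t y) (≤-antisym (≤-trans p≤t t≤q) q≤p) (≤-antisym q≤p (≤-trans p≤t t≤q))
                        (t-mid (≤-trans q≤p p≤t) (≤-trans t≤q q≤p))
  ; cba = λ p≤q t≤p → subst₂ (λ x y → Balanced x y t) (≤-antisym p≤q q≤p) (≤-antisym q≤p p≤q) (t-min (≤-trans t≤p p≤q))
  }
  where open Region R

-- The glue formula on rational signatures

≢0⇒0< : ∀ {p} → 0ℚ ≤ p → p ≢ 0ℚ → 0ℚ < p
≢0⇒0< 0≤p p≢0 = ≰⇒> λ p≤0 → p≢0 (≤-antisym p≤0 0≤p)

sum≡0⇒≡0 : ∀ {p q} → 0ℚ ≤ p → 0ℚ ≤ q → p + q ≡ 0ℚ → p ≡ 0ℚ × q ≡ 0ℚ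
sum≡0⇒≡0 {p} {q} 0≤p 0≤q p+q≡0 =
  ≤-antisym (≤-by 0≤q (sym p+q≡0)) 0≤p , ≤-antisym (≤-by 0≤p (trans (sym p+q≡0) (+-comm p q))) 0≤q

record Signature (α β γ : ℚ) : Set where
  field
    0≤α        : 0ℚ ≤ α
    0≤β        : 0ℚ ≤ β
    0≤γ        : 0ℚ ≤ γ
    sum≡1      : α + β + γ ≡ 1ℚ
    admissible : Admissible α β γ

-- The disjunction keeps the sign of `r`, which the passage to a larger `p` and a smaller `q`
-- forgets.
record Normalised (α β γ : ℚ) : Set where
  field
    {λᴺ t p q} : ℚ
    0<λ    : 0ℚ < λᴺ
    p≡1-q  : p ≡ 1ℚ - q
    region : Region t p q
    α≡     : α ≡ λᴺ * t
    βγ≡    : (β ≡ λᴺ * p × γ ≡ λᴺ * q) ⊎ (β ≡ λᴺ * q × γ ≡ λᴺ * p)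

module Scaling {s} (0<s : 0ℚ < s) where
  μ : ℚ
  μ = inv s
  0<μ : 0ℚ < μ
  0<μ = 0<inv 0<s
  0≤μ : 0ℚ ≤ μ
  0≤μ = <⇒≤ 0<μ
  μs≡1 : μ * s ≡ 1ℚ
  μs≡1 = inv-inverse λ s≡0 → <-irrefl (sym s≡0) 0<s
  unscale : ∀ x → x ≡ s * (μ * x)
  unscale x = sym (trans (solve 3 (λ l m x → l :* (m :* x) := m :* l :* x) refl s μ x)
    (trans (cong (_* x) μs≡1) (*-identityˡ x)))
  p≡1-q : ∀ {x y} → x + y ≡ s → μ * x ≡ 1ℚ - μ * y
  p≡1-q {x} {y} refl = trans (solve 3 (λ m x y → m :* x := m :* (x :+ y) :- m :* y) refl μ x y) (cong (_- μ * y) μs≡1)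

toNormalised : ∀ {α β γ} → Signature α β γ → 0ℚ < β + γ → Normalised α β γ
toNormalised {α} {β} {γ} sig 0<λ with ≤-total β γ
... | inj₂ γ≤β = record
  { 0<λ = 0<λ ; p≡1-q = p≡1-q refl
  ; region = admissible⇒region (0≤* 0≤μ 0≤α) (0≤* 0≤μ 0≤γ) (*-monoˡ-0≤ 0≤μ γ≤β) (admissible-scale μ 0<μ admissible)
  ; α≡ = unscale α ; βγ≡ = inj₁ (unscale β , unscale γ)
  }
  where open Signature sig; open Scaling {β + γ} 0<λ
... | inj₁ β≤γ = record
  { 0<λ = 0<λ ; p≡1-q = p≡1-q (+-comm γ β)
  ; region = admissible⇒region (0≤* 0≤μ 0≤α) (0≤* 0≤μ 0≤β) (*-monoˡ-0≤ 0≤μ β≤γ) (admissible-scale μ 0<μ (admissible-swap admissible))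
  ; α≡ = unscale α ; βγ≡ = inj₂ (unscale β , unscale γ)
  }
  where open Signature sig; open Scaling {β + γ} 0<λ

-- `t` is infinite when `β = γ = 0`; a glue with such a factor has this signature again.
admissible-100 : Admissible 1ℚ 0ℚ 0ℚ
admissible-100 = record
  { abc = λ _ _ → balanced ; acb = λ _ _ → balanced
  ; bac = λ 1≤0 _ → absurd 1≤0 ; bca = λ _ 1≤0 → absurd 1≤0 ; cab = λ 1≤0 _ → absurd 1≤0 ; cba = λ _ 1≤0 → absurd 1≤0
  }
  where
  balanced : Balanced 1ℚ 0ℚ 0ℚ
  balanced = balanced-of-mid≤min {1ℚ} {0ℚ} {0ℚ} (positive⁻¹ 1ℚ) ≤-refl ≤-refl
  absurd : ∀ {A : Set} → 1ℚ ≤ 0ℚ → A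
  absurd 1≤0 = ⊥-elim (<-irrefl refl (<-≤-trans (positive⁻¹ 1ℚ) 1≤0))

Admissible-resp : ∀ {a b c a′ b′ c′} → a ≡ a′ → b ≡ b′ → c ≡ c′ → Admissible a b c → Admissible a′ b′ c′
Admissible-resp refl refl refl adm = adm

module GlueSignature {α₁ β₁ γ₁ α₂ β₂ γ₂} (σ₁ : Signature α₁ β₁ γ₁) (σ₂ : Signature α₂ β₂ γ₂)
            (ω : ℚ) (0<ω : 0ℚ < ω) (ωD≡1 : ω * (1ℚ - α₁ * α₂) ≡ 1ℚ) where
  open Signature σ₁ renaming (0≤α to 0≤α₁; 0≤β to 0≤β₁; 0≤γ to 0≤γ₁; sum≡1 to sum₁)
  open Signature σ₂ renaming (0≤α to 0≤α₂; 0≤β to 0≤β₂; 0≤γ to 0≤γ₂; sum≡1 to sum₂)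

  α₃ β₃ γ₃ : ℚ
  α₃ = (α₁ * β₂ + α₁ * γ₂ + β₁ * α₂ + γ₁ * α₂) * ω
  β₃ = (β₁ * γ₂ + γ₁ * β₂) * ω
  γ₃ = (β₁ * β₂ + γ₁ * γ₂) * ω

  sum₃ : α₃ + β₃ + γ₃ ≡ 1ℚ
  sum₃ = trans
    (solve 7 (λ α₁ β₁ γ₁ α₂ β₂ γ₂ ω →
      (α₁ :* β₂ :+ α₁ :* γ₂ :+ β₁ :* α₂ :+ γ₁ :* α₂) :* ω :+ (β₁ :* γ₂ :+ γ₁ :* β₂) :* ω :+ (β₁ :* β₂ :+ γ₁ :* γ₂) :* ω
      := ω :* ((α₁ :+ β₁ :+ γ₁) :* (α₂ :+ β₂ :+ γ₂) :- α₁ :* α₂)) refl α₁ β₁ γ₁ α₂ β₂ γ₂ ω)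
    (trans (cong₂ (λ x y → ω * (x * y - α₁ * α₂)) sum₁ sum₂)
    (trans (cong (λ x → ω * (x - α₁ * α₂)) (*-identityˡ 1ℚ)) ωD≡1))

  admissible-of-zero : β₃ ≡ 0ℚ → γ₃ ≡ 0ℚ → Admissible α₃ β₃ γ₃
  admissible-of-zero β₃≡0 γ₃≡0 = Admissible-resp
    (sym (trans (solve 3 (λ a b c → a := a :+ b :+ c :- b :- c) refl α₃ β₃ γ₃)
      (trans (cong₂ (λ x y → x - β₃ - y) sum₃ γ₃≡0) (cong (λ x → 1ℚ - x - 0ℚ) β₃≡0))))
    (sym β₃≡0) (sym γ₃≡0) admissible-100

  admissible-of-normalised : Normalised α₁ β₁ γ₁ → Normalised α₂ β₂ γ₂ → Admissible α₃ β₃ γ₃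
  admissible-of-normalised
    record { λᴺ = l₁ ; t = t₁ ; q = q₁ ; 0<λ = 0<l₁ ; p≡1-q = refl ; region = R₁ ; α≡ = refl ; βγ≡ = βγ₁ }
    record { λᴺ = l₂ ; t = t₂ ; q = q₂ ; 0<λ = 0<l₂ ; p≡1-q = refl ; region = R₂ ; α≡ = refl ; βγ≡ = βγ₂ } = cases βγ₁ βγ₂
    where
    κ p₁ p₂ p₃ q₃ : ℚ
    κ = l₁ * l₂ * ω
    p₁ = 1ℚ - q₁
    p₂ = 1ℚ - q₂
    p₃ = p₁ * p₂ + q₁ * q₂
    q₃ = p₁ * q₂ + q₁ * p₂
    scaled : Admissible (κ * (t₁ + t₂)) (κ * p₃) (κ * q₃)
    scaled = admissible-scale κ (0<* (0<* 0<l₁ 0<l₂) 0<ω) (region⇒admissible (region-compose {p₁ = p₁} {p₂ = p₂} refl refl R₁ R₂))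
    product : ∀ a b c d → κ * (a * b + c * d) ≡ (l₁ * a * (l₂ * b) + l₁ * c * (l₂ * d)) * ω
    product = solve 7 (λ l₁ l₂ ω a b c d → l₁ :* l₂ :* ω :* (a :* b :+ c :* d)
                := (l₁ :* a :* (l₂ :* b) :+ l₁ :* c :* (l₂ :* d)) :* ω) refl l₁ l₂ ω
    total : ∀ l p q {x y} → p + q ≡ 1ℚ → (x ≡ l * p × y ≡ l * q) ⊎ (x ≡ l * q × y ≡ l * p) → x + y ≡ l
    total l p q p+q≡1 (inj₁ (refl , refl)) = trans (sym (*-distribˡ-+ l p q)) (trans (cong (l *_) p+q≡1) (*-identityʳ l))
    total l p q p+q≡1 (inj₂ (refl , refl)) = trans (+-comm (l * q) (l * p)) (total l p q p+q≡1 (inj₁ (refl , refl)))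
    α₃≡ : κ * (t₁ + t₂) ≡ α₃
    α₃≡ = sym (trans
      (solve 9 (λ l₁ t₁ l₂ t₂ β₁ γ₁ β₂ γ₂ ω →
        (l₁ :* t₁ :* β₂ :+ l₁ :* t₁ :* γ₂ :+ β₁ :* (l₂ :* t₂) :+ γ₁ :* (l₂ :* t₂)) :* ω
        := (l₁ :* t₁ :* (β₂ :+ γ₂) :+ (β₁ :+ γ₁) :* (l₂ :* t₂)) :* ω) refl l₁ t₁ l₂ t₂ β₁ γ₁ β₂ γ₂ ω)
      (trans (cong₂ (λ x y → (l₁ * t₁ * y + x * (l₂ * t₂)) * ω) (total l₁ p₁ q₁ (p+q≡1 {q = q₁} refl) βγ₁) (total l₂ p₂ q₂ (p+q≡1 {q = q₂} refl) βγ₂))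
        (solve 5 (λ l₁ t₁ l₂ t₂ ω → (l₁ :* t₁ :* l₂ :+ l₁ :* (l₂ :* t₂)) :* ω := l₁ :* l₂ :* ω :* (t₁ :+ t₂)) refl l₁ t₁ l₂ t₂ ω)))
    -- `r` is multiplicative with its sign: `γ₃` receives `p₃` when `p₁` and `p₂` sit on the same
    -- side, and `β₃` receives it otherwise.
    cases : (β₁ ≡ l₁ * p₁ × γ₁ ≡ l₁ * q₁) ⊎ (β₁ ≡ l₁ * q₁ × γ₁ ≡ l₁ * p₁) →
            (β₂ ≡ l₂ * p₂ × γ₂ ≡ l₂ * q₂) ⊎ (β₂ ≡ l₂ * q₂ × γ₂ ≡ l₂ * p₂) → Admissible α₃ β₃ γ₃
    cases (inj₁ (refl , refl)) (inj₁ (refl , refl)) = Admissible-resp α₃≡ (product p₁ q₂ q₁ p₂) (product p₁ p₂ q₁ q₂)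
      (admissible-swap scaled)
    cases (inj₁ (refl , refl)) (inj₂ (refl , refl)) = Admissible-resp α₃≡ (product p₁ p₂ q₁ q₂) (product p₁ q₂ q₁ p₂) scaled
    cases (inj₂ (refl , refl)) (inj₁ (refl , refl)) = Admissible-resp α₃≡
      (trans (cong (κ *_) (+-comm (p₁ * p₂) (q₁ * q₂))) (product q₁ q₂ p₁ p₂))
      (trans (cong (κ *_) (+-comm (p₁ * q₂) (q₁ * p₂))) (product q₁ p₂ p₁ q₂)) scaled
    cases (inj₂ (refl , refl)) (inj₂ (refl , refl)) = Admissible-resp α₃≡
      (trans (cong (κ *_) (+-comm (p₁ * q₂) (q₁ * p₂))) (product q₁ p₂ p₁ q₂))
      (trans (cong (κ *_) (+-comm (p₁ * p₂) (q₁ * q₂))) (product q₁ q₂ p₁ p₂)) (admissible-swap scaled)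

  admissible₃ : Admissible α₃ β₃ γ₃
  admissible₃ with β₁ + γ₁ ≟ 0ℚ | β₂ + γ₂ ≟ 0ℚ
  ... | yes λ₁≡0 | _ = let β₁≡0 , γ₁≡0 = sum≡0⇒≡0 0≤β₁ 0≤γ₁ λ₁≡0 in admissible-of-zero
    (trans (cong₂ (λ x y → (x * γ₂ + y * β₂) * ω) β₁≡0 γ₁≡0)
           (solve 3 (λ x y ω → (con 0ℚ :* x :+ con 0ℚ :* y) :* ω := con 0ℚ) refl γ₂ β₂ ω))
    (trans (cong₂ (λ x y → (x * β₂ + y * γ₂) * ω) β₁≡0 γ₁≡0)
           (solve 3 (λ x y ω → (con 0ℚ :* x :+ con 0ℚ :* y) :* ω := con 0ℚ) refl β₂ γ₂ ω))
  ... | no _ | yes λ₂≡0 = let β₂≡0 , γ₂≡0 = sum≡0⇒≡0 0≤β₂ 0≤γ₂ λ₂≡0 in admissible-of-zero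
    (trans (cong₂ (λ x y → (β₁ * y + γ₁ * x) * ω) β₂≡0 γ₂≡0)
           (solve 3 (λ x y ω → (x :* con 0ℚ :+ y :* con 0ℚ) :* ω := con 0ℚ) refl β₁ γ₁ ω))
    (trans (cong₂ (λ x y → (β₁ * x + γ₁ * y) * ω) β₂≡0 γ₂≡0)
           (solve 3 (λ x y ω → (x :* con 0ℚ :+ y :* con 0ℚ) :* ω := con 0ℚ) refl β₁ γ₁ ω))
  ... | no λ₁≢0 | no λ₂≢0 = admissible-of-normalised
    (toNormalised σ₁ (≢0⇒0< (0≤+ 0≤β₁ 0≤γ₁) λ₁≢0)) (toNormalised σ₂ (≢0⇒0< (0≤+ 0≤β₂ 0≤γ₂) λ₂≢0))

  inS : S (ι α₃ ∷ ι β₃ ∷ ι γ₃ ∷ [])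
  inS = admissible⇒S
    (0≤* (0≤+ (0≤+ (0≤+ (0≤* 0≤α₁ 0≤β₂) (0≤* 0≤α₁ 0≤γ₂)) (0≤* 0≤β₁ 0≤α₂)) (0≤* 0≤γ₁ 0≤α₂)) (<⇒≤ 0<ω))
    (0≤* (0≤+ (0≤* 0≤β₁ 0≤γ₂) (0≤* 0≤γ₁ 0≤β₂)) (<⇒≤ 0<ω))
    (0≤* (0≤+ (0≤* 0≤β₁ 0≤β₂) (0≤* 0≤γ₁ 0≤γ₂)) (<⇒≤ 0<ω))
    sum₃ admissible₃

-- Trails in a gadget

module _ {G : Gadget} (μ : Matching G) where
  open Gadget G
  open Matching μ

  Reaches : End → Fin 4 → Set
  Reaches x h = ∃[ es ] Trail μ x es h

  -- Absence of closed trails, in a form that restricts to the factors of a glue and passes from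
  -- them to the glue.
  Exits : Set
  Exits = ∀ x → ∃[ h ] Reaches x h

module _ {G : Gadget} {μ : Matching G} where
  open Gadget G
  open Matching μ

  mate-sym : ∀ {x y} → mate x ≡ y → mate y ≡ x
  mate-sym {x} refl = mate-involutive x

  trail-unique : ∀ {x es es′ h h′} → Trail μ x es h → Trail μ x es′ h′ → es ≡ es′ × h ≡ h′
  trail-unique (stop p)   (stop q)    with refl ← trans (sym p) q = refl , refl
  trail-unique (stop p)   (step q _)  with () ← trans (sym p) q
  trail-unique (step p _) (stop q)    with () ← trans (sym p) q
  trail-unique (step p t) (step q t′) with refl ← trans (sym p) q =
    let es≡es′ , h≡h′ = trail-unique t t′ in cong (_ ∷ˡ_) es≡es′ , h≡h′

  reaches-unique : ∀ {x h h′} → Reaches μ x h → Reaches μ x h′ → h ≡ h′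
  reaches-unique (_ , t) (_ , t′) = proj₂ (trail-unique t t′)

  reach-step : ∀ {z e s h} → mate z ≡ inj₁ (e , not s) → Reaches μ (inj₁ (e , s)) h → Reaches μ z h
  reach-step {e = e} {s} {h} p (es , t) =
    e ∷ˡ es , step p (subst (λ s → Trail μ (inj₁ (e , s)) es h) (sym (not-involutive s)) t)

  -- `mate` is an involution, so a trail can be run backwards. `onward` is what follows after
  -- leaving through the starting end `x`, which explains the accumulator of list reversal.
  retrace : ∀ {x es h acc k} → Trail μ x es h → (∀ z → mate z ≡ x → Trail μ z acc k) → Trail μ (inj₂ h) (es ʳ++ acc) k
  retrace (stop p)           onward = onward _ (mate-sym p)
  retrace (step {e = e} {s} p t) onward = retrace t λ z q →
    step q (subst (λ s → Trail μ (inj₁ (e , s)) _ _) (sym (not-involutive s)) (onward _ (mate-sym p)))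

  reverse-trail : ∀ {a b es} → Trail μ (inj₂ a) es b → Trail μ (inj₂ b) (es ʳ++ []ˡ) a
  reverse-trail t = retrace t λ _ → stop

  reverse-reaches : ∀ {a b} → Reaches μ (inj₂ a) b → Reaches μ (inj₂ b) a
  reverse-reaches (_ , t) = _ , reverse-trail t

  -- Arriving along one end of an edge of the trail continues the trail; arriving along the other
  -- retraces it to its start, where `back` takes over.
  exits-along : ∀ {x es h e} → Trail μ x es h → (∀ z → mate z ≡ x → ∃[ k ] Reaches μ z k) → e ∈ es →
                ∀ s → ∃[ k ] Reaches μ (inj₁ (e , s)) k
  exits-along (step {s = false} p t) back (here refl) false = back _ (mate-sym p)
  exits-along (step {s = false} p t) back (here refl) true  = _ , _ , t
  exits-along (step {s = true}  p t) back (here refl) false = _ , _ , t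
  exits-along (step {s = true}  p t) back (here refl) true  = back _ (mate-sym p)
  exits-along (step {e = e} {s} p t) back (there e∈es) = exits-along t
    (λ z q → let k , r = back _ (mate-sym p) in k , reach-step q r) e∈es

  -- A trail from x that leaves through y, with its last edge outermost.
  data Path (x : End) : ℕ → End → Set where
    start : ∀ {y} → mate x ≡ y → Path x 0 y
    snoc  : ∀ {n e s y} → Path x n (inj₁ (e , s)) → mate (inj₁ (e , not s)) ≡ y → Path x (suc n) y

  cons : ∀ {x n e s y} → mate x ≡ inj₁ (e , s) → Path (inj₁ (e , not s)) n y → Path x (suc n) y
  cons p (start q)  = snoc (start p) q
  cons p (snoc t q) = snoc (cons p t) q

  uncons : ∀ {x n y} → Path x (suc n) y → ∃[ e ] ∃[ s ] mate x ≡ inj₁ (e , s) × Path (inj₁ (e , not s)) n y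
  uncons (snoc (start p)      q) = _ , _ , p , start q
  uncons (snoc (snoc t p) q) = let e , s , p′ , t′ = uncons (snoc t p) in e , s , p′ , snoc t′ q

  -- A trail that leaves through the end it came from is a palindrome: removing its first and last
  -- edge leaves a shorter one of the same kind. At the centre stands a fixed point of `mate` or an
  -- edge whose two ends coincide.
  path-irrefl : ∀ {x} n → Path x n x → ⊥
  path-irrefl zero          (start p)            = mate-irrefl _ p
  path-irrefl (suc zero)    (snoc {s = false} (start p) q) with () ← trans (sym (mate-sym q)) p
  path-irrefl (suc zero)    (snoc {s = true}  (start p) q) with () ← trans (sym (mate-sym q)) p
  path-irrefl (suc (suc n)) (snoc {e = e} {s} t q) with uncons t
  ... | e′ , s′ , p , t′ with refl ← trans (sym (mate-sym q)) p =
    path-irrefl n (subst (λ s′ → Path (inj₁ (e , s′)) n (inj₁ (e , s))) (not-involutive s) t′)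

  trail⇒path : ∀ {x es h} → Trail μ x es h → ∃[ n ] Path x n (inj₂ h)
  trail⇒path (stop p)   = 0 , start p
  trail⇒path (step p t) = let n , t′ = trail⇒path t in suc n , cons p t′

  reaches-irrefl : ∀ {a} → Reaches μ (inj₂ a) a → ⊥
  reaches-irrefl (_ , t) = let n , t′ = trail⇒path t in path-irrefl n t′

-- Routes G A, Routes G B and Routes G C below are VR({0,1},{2,3}), VR({0,2},{1,3}) and VR({0,3},{1,2}).
data Kind : Set where
  A B C : Kind

partner : Kind → Fin 4 → Fin 4
partner A 0F = 1F
partner A 1F = 0F
partner A 2F = 3F
partner A 3F = 2F
partner B 0F = 2F
partner B 1F = 3F
partner B 2F = 0F
partner B 3F = 1F
partner C 0F = 3F
partner C 1F = 2F
partner C 2F = 1F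
partner C 3F = 0F

end₁ end₂ end₃ : Kind → Fin 4
end₁ k = partner k 0F
end₂ A = 2F
end₂ B = 1F
end₂ C = 1F
end₃ k = partner k (end₂ k)

partner-injective : ∀ k l → partner k 0F ≡ partner l 0F → k ≡ l
partner-injective A A _ = refl
partner-injective B B _ = refl
partner-injective C C _ = refl

Routes : Gadget → Kind → Set
Routes G k = ValidRoutes G 0F (end₁ k) (end₂ k) (end₃ k)

-- Compared with `ValidRoutes`, all four half-edges are treated alike and `exits` replaces `covers`,
-- so that no edge lists have to be compared.
record Joins {G : Gadget} (μ : Matching G) (k : Kind) : Set where
  field
    joins : ∀ h → Reaches μ (inj₂ h) (partner k h)
    exits : Exits μ

module _ {G : Gadget} {μ : Matching G} where
  open Gadget G
  open Matching μ

  joins-of : ∀ k → Reaches μ (inj₂ 0F) (end₁ k) → Reaches μ (inj₂ (end₂ k)) (end₃ k) →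
             ∀ h → Reaches μ (inj₂ h) (partner k h)
  joins-of A r r′ 0F = r
  joins-of A r r′ 1F = reverse-reaches r
  joins-of A r r′ 2F = r′
  joins-of A r r′ 3F = reverse-reaches r′
  joins-of B r r′ 0F = r
  joins-of B r r′ 1F = r′
  joins-of B r r′ 2F = reverse-reaches r
  joins-of B r r′ 3F = reverse-reaches r′
  joins-of C r r′ 0F = r
  joins-of C r r′ 1F = r′
  joins-of C r r′ 2F = reverse-reaches r′
  joins-of C r r′ 3F = reverse-reaches r

  -- Both ends of e lead out, so e lies on the trail from one half-edge to another.
  edge-trail : Exits μ → ∀ e → ∃[ h ] ∃[ h′ ] ∃[ es ] Trail μ (inj₂ h) es h′ × e ∈ es
  edge-trail exits e with exits (inj₁ (e , true)) | exits (inj₁ (e , false))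
  ... | h , es , t | h′ , es′ , t′ = h , h′ , es ʳ++ (e ∷ˡ es′) , retrace t (λ z p → step p t′) , ∈-ʳ++ es
    where
    ∈-ʳ++ : ∀ es → e ∈ es ʳ++ (e ∷ˡ es′)
    ∈-ʳ++ = onto (here refl)
      where
      onto : ∀ {acc} → e ∈ acc → ∀ es → e ∈ es ʳ++ acc
      onto e∈ []ˡ       = e∈
      onto e∈ (x ∷ˡ es) = onto (there e∈) es

  trail-covers : ∀ {a b es h es′ h′ e} → Trail μ (inj₂ a) es b → (h ≡ a ⊎ h ≡ b) → Trail μ (inj₂ h) es′ h′ → e ∈ es′ → e ∈ es
  trail-covers t (inj₁ refl) t′ e∈ = subst (_ ∈_) (proj₁ (trail-unique t′ t)) e∈
  trail-covers t (inj₂ refl) t′ e∈ = reverse⁻ (subst (_ ∈_) (proj₁ (trail-unique t′ (reverse-trail t))) e∈)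

  ends-exhaust : ∀ k h → (h ≡ 0F ⊎ h ≡ end₁ k) ⊎ (h ≡ end₂ k ⊎ h ≡ end₃ k)
  ends-exhaust A 0F = inj₁ (inj₁ refl)
  ends-exhaust A 1F = inj₁ (inj₂ refl)
  ends-exhaust A 2F = inj₂ (inj₁ refl)
  ends-exhaust A 3F = inj₂ (inj₂ refl)
  ends-exhaust B 0F = inj₁ (inj₁ refl)
  ends-exhaust B 1F = inj₂ (inj₁ refl)
  ends-exhaust B 2F = inj₁ (inj₂ refl)
  ends-exhaust B 3F = inj₂ (inj₂ refl)
  ends-exhaust C 0F = inj₁ (inj₁ refl)
  ends-exhaust C 1F = inj₂ (inj₁ refl)
  ends-exhaust C 2F = inj₂ (inj₂ refl)
  ends-exhaust C 3F = inj₁ (inj₂ refl)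

  joins⇒routes : ∀ k → Joins μ k → Routes G k
  joins⇒routes k J = record
    { matching = μ ; route₁ = proj₂ (joins 0F) ; route₂ = proj₂ (joins (end₂ k))
    ; covers = λ e → covers (edge-trail exits e) }
    where
    open Joins J
    covers : ∀ {e} → ∃[ h ] ∃[ h′ ] ∃[ es ] Trail μ (inj₂ h) es h′ × e ∈ es → e ∈ proj₁ (joins 0F) ⊎ e ∈ proj₁ (joins (end₂ k))
    covers (h , h′ , es , t , e∈es) with ends-exhaust k h
    ... | inj₁ h∈ = inj₁ (trail-covers (proj₂ (joins 0F)) h∈ t e∈es)
    ... | inj₂ h∈ = inj₂ (trail-covers (proj₂ (joins (end₂ k))) h∈ t e∈es)

routes⇒joins : ∀ {G} k (r : Routes G k) → Joins (ValidRoutes.matching r) k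
routes⇒joins {G} k r = record { joins = joins ; exits = exits }
  where
  open ValidRoutes r
  joins = joins-of k (_ , route₁) (_ , route₂)
  exits : Exits matching
  exits (inj₂ h) = _ , joins h
  exits (inj₁ (e , s)) with covers e
  -- Retracing a route ends at its first half-edge.
  ... | inj₁ e∈ = exits-along route₁ (λ z p → _ , _ , stop p) e∈ s
  ... | inj₂ e∈ = exits-along route₂ (λ z p → _ , _ , stop p) e∈ s

joins-unique : ∀ {G} {μ : Matching G} {k l} → Joins μ k → Joins μ l → k ≡ l
joins-unique {k = k} {l} J J′ = partner-injective k l (reaches-unique (Joins.joins J 0F) (Joins.joins J′ 0F))

-- Being joined by a trail is single-valued, symmetric and irreflexive on the four half-edges, hence
-- one of the three perfect matchings. The trails from 0 and from one further half-edge decide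
-- which.
exits⇒joins : ∀ {G} {μ : Matching G} → Exits μ → ∃[ k ] Joins μ k
exits⇒joins {G} {μ} exits = go (exits (inj₂ 0F))
  where
  differ : ∀ {a b c} → Reaches μ (inj₂ a) b → Reaches μ (inj₂ a) c → b ≢ c → ⊥
  differ r r′ b≢c = b≢c (reaches-unique r r′)
  joined : ∀ k → Reaches μ (inj₂ 0F) (end₁ k) → Reaches μ (inj₂ (end₂ k)) (end₃ k) → ∃[ k ] Joins μ k
  joined k r r′ = k , record { joins = joins-of k r r′ ; exits = exits }
  go : ∃[ h ] Reaches μ (inj₂ 0F) h → ∃[ k ] Joins μ k
  go (0F , r) = ⊥-elim (reaches-irrefl r)
  go (1F , r) with exits (inj₂ 2F)
  ... | 0F , r′ = ⊥-elim (differ r (reverse-reaches r′) λ ())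
  ... | 1F , r′ = ⊥-elim (differ (reverse-reaches r) (reverse-reaches r′) λ ())
  ... | 2F , r′ = ⊥-elim (reaches-irrefl r′)
  ... | 3F , r′ = joined A r r′
  go (2F , r) with exits (inj₂ 1F)
  ... | 0F , r′ = ⊥-elim (differ r (reverse-reaches r′) λ ())
  ... | 1F , r′ = ⊥-elim (reaches-irrefl r′)
  ... | 2F , r′ = ⊥-elim (differ (reverse-reaches r) (reverse-reaches r′) λ ())
  ... | 3F , r′ = joined B r r′
  go (3F , r) with exits (inj₂ 1F)
  ... | 0F , r′ = ⊥-elim (differ r (reverse-reaches r′) λ ())
  ... | 1F , r′ = ⊥-elim (reaches-irrefl r′)
  ... | 2F , r′ = joined C r r′
  ... | 3F , r′ = ⊥-elim (differ (reverse-reaches r) (reverse-reaches r′) λ ())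

-- Matchings of the glued gadget

-- A half-edge of `G` may become an end of an edge of `H`, as it does at the two glued edges. The
-- notion serves both for gluing two matchings and for restricting one.
record Embedding {G H : Gadget} (μ : Matching G) (ν : Matching H) : Set where
  open Gadget
  open Matching
  field
    into      : End G → End H
    intoE     : E G → E H
    into-edge : ∀ e s → into (inj₁ (e , s)) ≡ inj₁ (intoE e , s)
    into-mate : ∀ x → mate ν (into x) ≡ into (mate μ x)

module _ {G H : Gadget} {μ : Matching G} {ν : Matching H} (ε : Embedding μ ν) where
  open Embedding ε
  open Gadget
  open Matching

  lift : ∀ {x k h} → Reaches μ x k → (∀ z → mate ν z ≡ into (inj₂ k) → Reaches ν z h) → Reaches ν (into x) h
  lift (_ , stop p)   onward = onward _ (trans (into-mate _) (cong into p))
  lift (_ , step {e = e} {s} p t) onward =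
    let es , t′ = lift (_ , t) onward in
    intoE e ∷ˡ es , step (trans (into-mate _) (trans (cong into p) (into-edge e s)))
                        (subst (λ y → Trail ν y es _) (into-edge e (not s)) t′)

  -- A trail that starts in the image of G stays there up to a half-edge k of G.
  record Departure (x : End G) (es : List (E H)) (h : Fin 4) : Set where
    field
      {exit} : Fin 4
      inside : Reaches μ x exit
      beyond : into (inj₂ exit) ≡ inj₂ h ⊎
               (∃[ e ] ∃[ s ] ∃[ es′ ] into (inj₂ exit) ≡ inj₁ (e , s) ×
                  Trail ν (inj₁ (e , not s)) es′ h × length es′ ℕ.< length es)

  -- Induction along the trail in `H`. The start is given by an equation because `into-edge`
  -- identifies the next end only propositionally. The strict decrease in length is what `¬joins-AA`
  -- descends on.
  depart : ∀ {x y es h} → Trail ν y es h → y ≡ into x → ∀ m → mate μ x ≡ m → Departure x es h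
  depart {x} t refl m eq = go t m (trans (into-mate x) (cong into eq)) eq
    where
    go : ∀ {es h} → Trail ν (into x) es h → ∀ m → mate ν (into x) ≡ into m → mate μ x ≡ m → Departure x es h
    go (stop q) (inj₂ k) p eq = record { inside = _ , stop eq ; beyond = inj₁ (trans (sym p) q) }
    go (stop q) (inj₁ (e , s)) p eq with () ← trans (sym q) (trans p (into-edge e s))
    go (step q t) (inj₂ k) p eq = record
      { inside = _ , stop eq ; beyond = inj₂ (_ , _ , _ , trans (sym p) q , t , ℕ.≤-refl) }
    go (step q t) (inj₁ (e , s)) p eq with refl ← trans (sym q) (trans p (into-edge e s)) =
      let open Departure (depart t (sym (into-edge e (not s))) _ refl) in record
      { inside = _ , step eq (proj₂ inside)
      ; beyond = Sum.map₂ (λ (e , s , es′ , p , t , es′<es) → e , s , es′ , p , t , ℕ.m<n⇒m<1+n es′<es) beyond }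

module GlueEnds (G₁ G₂ : Gadget) where
  open Matching

  G₃ : Gadget
  G₃ = 2-glue G₁ G₂

  module Γ₁ = Gadget G₁
  module Γ₂ = Gadget G₂
  module Γ₃ = Gadget G₃

  in₁ : Γ₁.End → Γ₃.End
  in₁ = inEnd₁ G₁ G₂

  in₂ : Γ₂.End → Γ₃.End
  in₂ = inEnd₂ G₁ G₂

  join : Γ₁.End ⊎ Γ₂.End → Γ₃.End
  join = [ in₁ , in₂ ]′

  split : Γ₃.End → Γ₁.End ⊎ Γ₂.End
  split (inj₁ (inj₁ (inj₁ e) , s)) = inj₁ (inj₁ (e , s))
  split (inj₁ (inj₁ (inj₂ e) , s)) = inj₂ (inj₁ (e , s))
  split (inj₁ (inj₂ 0F , false))   = inj₁ (inj₂ 3F)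
  split (inj₁ (inj₂ 0F , true))    = inj₂ (inj₂ 0F)
  split (inj₁ (inj₂ 1F , false))   = inj₁ (inj₂ 2F)
  split (inj₁ (inj₂ 1F , true))    = inj₂ (inj₂ 1F)
  split (inj₂ 0F)                  = inj₁ (inj₂ 0F)
  split (inj₂ 1F)                  = inj₁ (inj₂ 1F)
  split (inj₂ 2F)                  = inj₂ (inj₂ 2F)
  split (inj₂ 3F)                  = inj₂ (inj₂ 3F)

  join-split : ∀ x → join (split x) ≡ x
  join-split (inj₁ (inj₁ (inj₁ e) , s)) = refl
  join-split (inj₁ (inj₁ (inj₂ e) , s)) = refl
  join-split (inj₁ (inj₂ 0F , false))   = refl
  join-split (inj₁ (inj₂ 0F , true))    = refl
  join-split (inj₁ (inj₂ 1F , false))   = refl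
  join-split (inj₁ (inj₂ 1F , true))    = refl
  join-split (inj₂ 0F)                  = refl
  join-split (inj₂ 1F)                  = refl
  join-split (inj₂ 2F)                  = refl
  join-split (inj₂ 3F)                  = refl

  split-join : ∀ y → split (join y) ≡ y
  split-join (inj₁ (inj₁ (e , s))) = refl
  split-join (inj₁ (inj₂ 0F))      = refl
  split-join (inj₁ (inj₂ 1F))      = refl
  split-join (inj₁ (inj₂ 2F))      = refl
  split-join (inj₁ (inj₂ 3F))      = refl
  split-join (inj₂ (inj₁ (e , s))) = refl
  split-join (inj₂ (inj₂ 0F))      = refl
  split-join (inj₂ (inj₂ 1F))      = refl
  split-join (inj₂ (inj₂ 2F))      = refl
  split-join (inj₂ (inj₂ 3F))      = refl

  join-injective : ∀ {y z} → join y ≡ join z → y ≡ z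
  join-injective {y} {z} eq = trans (sym (split-join y)) (trans (cong split eq) (split-join z))

  in₁-injective : ∀ {x y} → in₁ x ≡ in₁ y → x ≡ y
  in₁-injective eq with refl ← join-injective {inj₁ _} {inj₁ _} eq = refl

  in₂-injective : ∀ {x y} → in₂ x ≡ in₂ y → x ≡ y
  in₂-injective eq with refl ← join-injective {inj₂ _} {inj₂ _} eq = refl

  vertexOf-join : ∀ y → Γ₃.vertexOf (join y) ≡ Sum.map Γ₁.vertexOf Γ₂.vertexOf y
  vertexOf-join (inj₁ (inj₁ (e , s))) = refl
  vertexOf-join (inj₁ (inj₂ 0F))      = refl
  vertexOf-join (inj₁ (inj₂ 1F))      = refl
  vertexOf-join (inj₁ (inj₂ 2F))      = refl
  vertexOf-join (inj₁ (inj₂ 3F))      = refl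
  vertexOf-join (inj₂ (inj₁ (e , s))) = refl
  vertexOf-join (inj₂ (inj₂ 0F))      = refl
  vertexOf-join (inj₂ (inj₂ 1F))      = refl
  vertexOf-join (inj₂ (inj₂ 2F))      = refl
  vertexOf-join (inj₂ (inj₂ 3F))      = refl

  module _ (μ₁ : Matching G₁) (μ₂ : Matching G₂) where

    private
      swap : Γ₁.End ⊎ Γ₂.End → Γ₁.End ⊎ Γ₂.End
      swap = Sum.map (mate μ₁) (mate μ₂)

      swap-involutive : ∀ y → swap (swap y) ≡ y
      swap-involutive (inj₁ x) = cong inj₁ (mate-involutive μ₁ x)
      swap-involutive (inj₂ x) = cong inj₂ (mate-involutive μ₂ x)

      swap-irrefl : ∀ y → swap y ≢ y
      swap-irrefl (inj₁ x) eq = mate-irrefl μ₁ x (in₁-injective (cong join eq))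
      swap-irrefl (inj₂ x) eq = mate-irrefl μ₂ x (in₂-injective (cong join eq))

      swap-local : ∀ y → Sum.map Γ₁.vertexOf Γ₂.vertexOf (swap y) ≡ Sum.map Γ₁.vertexOf Γ₂.vertexOf y
      swap-local (inj₁ x) = cong inj₁ (mate-local μ₁ x)
      swap-local (inj₂ x) = cong inj₂ (mate-local μ₂ x)

    glueMatching : Matching G₃
    glueMatching = record
      { mate            = λ x → join (swap (split x))
      ; mate-involutive = λ x → trans (cong (λ y → join (swap y)) (split-join (swap (split x))))
                                  (trans (cong join (swap-involutive (split x))) (join-split x))
      ; mate-irrefl     = λ x eq → swap-irrefl (split x) (join-injective (trans eq (sym (join-split x))))
      ; mate-local      = λ x → trans (vertexOf-join (swap (split x))) (trans (swap-local (split x))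
                                  (trans (sym (vertexOf-join (split x))) (cong Γ₃.vertexOf (join-split x))))
      }

    embedding₁ : Embedding μ₁ glueMatching
    embedding₁ = record
      { into = in₁ ; intoE = λ e → inj₁ (inj₁ e) ; into-edge = λ _ _ → refl
      ; into-mate = λ x → cong (λ y → join (swap y)) (split-join (inj₁ x)) }

    embedding₂ : Embedding μ₂ glueMatching
    embedding₂ = record
      { into = in₂ ; intoE = λ e → inj₁ (inj₂ e) ; into-edge = λ _ _ → refl
      ; into-mate = λ x → cong (λ y → join (swap y)) (split-join (inj₂ x)) }

  module Restrict (ν : Matching G₃) where

    module Side {G : Gadget} (into : Gadget.End G → Γ₃.End) (into-injective : ∀ {x y} → into x ≡ into y → x ≡ y)
                (closed : ∀ x → ∃[ y ] mate ν (into x) ≡ into y × Gadget.vertexOf G y ≡ Gadget.vertexOf G x) where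

      matching : Matching G
      matching = record
        { mate            = λ x → proj₁ (closed x)
        ; mate-involutive = λ x → into-injective (trans (sym (proj₁ (proj₂ (closed (proj₁ (closed x))))))
                              (trans (cong (mate ν) (sym (proj₁ (proj₂ (closed x))))) (mate-involutive ν (into x))))
        ; mate-irrefl     = λ x eq → mate-irrefl ν (into x) (trans (proj₁ (proj₂ (closed x))) (cong into eq))
        ; mate-local      = λ x → proj₂ (proj₂ (closed x))
        }

      embedding : (intoE : Gadget.E G → Γ₃.E) → (∀ e s → into (inj₁ (e , s)) ≡ inj₁ (intoE e , s)) → Embedding matching ν
      embedding intoE into-edge = record
        { into = into ; intoE = intoE ; into-edge = into-edge ; into-mate = λ x → proj₁ (proj₂ (closed x)) }

    private
      same-vertex : ∀ y → Sum.map Γ₁.vertexOf Γ₂.vertexOf (split (mate ν (join y))) ≡ Sum.map Γ₁.vertexOf Γ₂.vertexOf y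
      same-vertex y = trans (sym (vertexOf-join (split (mate ν (join y)))))
        (trans (cong Γ₃.vertexOf (join-split (mate ν (join y)))) (trans (mate-local ν (join y)) (vertexOf-join y)))

      -- `mate` keeps an end at its vertex, and the vertices of the glue are tagged with their side.
      closed₁ : ∀ x → ∃[ y ] mate ν (in₁ x) ≡ in₁ y × Γ₁.vertexOf y ≡ Γ₁.vertexOf x
      closed₁ x = stay (split (mate ν (in₁ x))) (same-vertex (inj₁ x)) (join-split (mate ν (in₁ x)))
        where
        stay : ∀ z → Sum.map Γ₁.vertexOf Γ₂.vertexOf z ≡ inj₁ (Γ₁.vertexOf x) → join z ≡ mate ν (in₁ x) →
               ∃[ y ] mate ν (in₁ x) ≡ in₁ y × Γ₁.vertexOf y ≡ Γ₁.vertexOf x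
        stay (inj₁ y) same eq = y , sym eq , inj₁-injective same

      closed₂ : ∀ x → ∃[ y ] mate ν (in₂ x) ≡ in₂ y × Γ₂.vertexOf y ≡ Γ₂.vertexOf x
      closed₂ x = stay (split (mate ν (in₂ x))) (same-vertex (inj₂ x)) (join-split (mate ν (in₂ x)))
        where
        stay : ∀ z → Sum.map Γ₁.vertexOf Γ₂.vertexOf z ≡ inj₂ (Γ₂.vertexOf x) → join z ≡ mate ν (in₂ x) →
               ∃[ y ] mate ν (in₂ x) ≡ in₂ y × Γ₂.vertexOf y ≡ Γ₂.vertexOf x
        stay (inj₂ y) same eq = y , sym eq , inj₂-injective same

    open Side {G₁} in₁ in₁-injective closed₁ public renaming (matching to ν₁; embedding to embed₁)
    open Side {G₂} in₂ in₂-injective closed₂ public renaming (matching to ν₂; embedding to embed₂)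

    embedding₁′ : Embedding ν₁ ν
    embedding₁′ = embed₁ (λ e → inj₁ (inj₁ e)) (λ _ _ → refl)

    embedding₂′ : Embedding ν₂ ν
    embedding₂′ = embed₂ (λ e → inj₁ (inj₂ e)) (λ _ _ → refl)

-- Counting the routes of the glued gadget

-- The multiplication of the Brauer algebra on two strands with loop value 0, in which C is the
-- identity, B the transposition and A the cup-cap element: A A closes a loop and contributes nothing.
data Compose : Kind → Kind → Kind → Set where
  AB : Compose A B A
  AC : Compose A C A
  BA : Compose B A A
  CA : Compose C A A
  BC : Compose B C B
  CB : Compose C B B
  BB : Compose B B C
  CC : Compose C C C

compose? : ∀ k l → (k ≡ A × l ≡ A) ⊎ ∃[ m ] Compose k l m
compose? A A = inj₁ (refl , refl)
compose? A B = inj₂ (_ , AB)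
compose? A C = inj₂ (_ , AC)
compose? B A = inj₂ (_ , BA)
compose? B B = inj₂ (_ , BB)
compose? B C = inj₂ (_ , BC)
compose? C A = inj₂ (_ , CA)
compose? C B = inj₂ (_ , CB)
compose? C C = inj₂ (_ , CC)

Compose-irrelevant : ∀ {k l m} (c c′ : Compose k l m) → c ≡ c′
Compose-irrelevant AB AB = refl
Compose-irrelevant AC AC = refl
Compose-irrelevant BA BA = refl
Compose-irrelevant CA CA = refl
Compose-irrelevant BC BC = refl
Compose-irrelevant CB CB = refl
Compose-irrelevant BB BB = refl
Compose-irrelevant CC CC = refl

-- A half-edge of the first or of the second gadget.
Port : Set
Port = Fin 4 ⊎ Fin 4

-- What lies beyond a port: a half-edge of the glued gadget, or a port of the other gadget.
cross : Port → Fin 4 ⊎ Port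
cross (inj₁ 0F) = inj₁ 0F
cross (inj₁ 1F) = inj₁ 1F
cross (inj₁ 2F) = inj₂ (inj₂ 1F)
cross (inj₁ 3F) = inj₂ (inj₂ 0F)
cross (inj₂ 0F) = inj₂ (inj₁ 3F)
cross (inj₂ 1F) = inj₂ (inj₁ 2F)
cross (inj₂ 2F) = inj₁ 2F
cross (inj₂ 3F) = inj₁ 3F

-- The half-edge where a trail entering at the given port ends, if it crosses fewer than n times.
walk : ℕ → Kind → Kind → Port → Maybe (Fin 4)
walk zero    k l s = nothing
walk (suc n) k l s with cross (Sum.map (partner k) (partner l) s)
... | inj₁ h  = just h
... | inj₂ s′ = walk n k l s′

origin : Fin 4 → Port
origin 0F = inj₁ 0F
origin 1F = inj₁ 1F
origin 2F = inj₂ 2F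
origin 3F = inj₂ 3F

-- A trail that leaves the glue uses each of the two glued edges at most once and so has at most
-- three pieces; the bound 4 is ample. Only the pair `A`, `A` has ports where it runs out.
Halts : Kind → Kind → Port → Set
Halts k l s = ∃[ h ] walk 4 k l s ≡ just h

halts? : ∀ k l s → Dec (Halts k l s)
halts? k l s with walk 4 k l s
... | just h  = yes (h , refl)
... | nothing = no λ ()

all-halt? : ∀ k l → Dec ((∀ a → Halts k l (inj₁ a)) × (∀ a → Halts k l (inj₂ a)))
all-halt? k l = all? (halts? k l ∘ inj₁) ×-dec all? (halts? k l ∘ inj₂)

walk-partner? : ∀ k l m → Dec (∀ h → walk 4 k l (origin h) ≡ just (partner m h))
walk-partner? k l m = all? λ h → Maybe.≡-dec Fin._≟_ (walk 4 k l (origin h)) (just (partner m h))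

all-halt : ∀ {k l m} → Compose k l m → (∀ a → Halts k l (inj₁ a)) × (∀ a → Halts k l (inj₂ a))
all-halt AB = toWitness {a? = all-halt? A B} _
all-halt AC = toWitness {a? = all-halt? A C} _
all-halt BA = toWitness {a? = all-halt? B A} _
all-halt CA = toWitness {a? = all-halt? C A} _
all-halt BC = toWitness {a? = all-halt? B C} _
all-halt CB = toWitness {a? = all-halt? C B} _
all-halt BB = toWitness {a? = all-halt? B B} _
all-halt CC = toWitness {a? = all-halt? C C} _

walk-partner : ∀ {k l m} → Compose k l m → ∀ h → walk 4 k l (origin h) ≡ just (partner m h)
walk-partner AB = toWitness {a? = walk-partner? A B A} _
walk-partner AC = toWitness {a? = walk-partner? A C A} _
walk-partner BA = toWitness {a? = walk-partner? B A A} _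
walk-partner CA = toWitness {a? = walk-partner? C A A} _
walk-partner BC = toWitness {a? = walk-partner? B C B} _
walk-partner CB = toWitness {a? = walk-partner? C B B} _
walk-partner BB = toWitness {a? = walk-partner? B B C} _
walk-partner CC = toWitness {a? = walk-partner? C C C} _

module GlueTrails (G₁ G₂ : Gadget) where
  open GlueEnds G₁ G₂
  open Matching

  place : Port → Γ₃.End
  place s = join (Sum.map inj₂ inj₂ s)

  place-origin : ∀ h → place (origin h) ≡ inj₂ h
  place-origin 0F = refl
  place-origin 1F = refl
  place-origin 2F = refl
  place-origin 3F = refl

  module _ {ν : Matching G₃} where

    leave : ∀ t {h z} → cross t ≡ inj₁ h → mate ν z ≡ place t → Reaches ν z h
    leave (inj₁ 0F) refl p = _ , stop p
    leave (inj₁ 1F) refl p = _ , stop p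
    leave (inj₁ 2F) ()
    leave (inj₁ 3F) ()
    leave (inj₂ 2F) refl p = _ , stop p
    leave (inj₂ 3F) refl p = _ , stop p

    enter : ∀ t {s h z} → cross t ≡ inj₂ s → mate ν z ≡ place t → Reaches ν (place s) h → Reaches ν z h
    enter (inj₁ 2F) refl p (_ , r) = _ , step p r
    enter (inj₁ 3F) refl p (_ , r) = _ , step p r
    enter (inj₂ 0F) refl p (_ , r) = _ , step p r
    enter (inj₂ 1F) refl p (_ , r) = _ , step p r
    enter (inj₂ 2F) ()
    enter (inj₂ 3F) ()

  module _ {μ₁ : Matching G₁} {μ₂ : Matching G₂} {k l} (J₁ : Joins μ₁ k) (J₂ : Joins μ₂ l) where

    private
      ν : Matching G₃
      ν = glueMatching μ₁ μ₂

    through : ∀ s {h} → (∀ z → mate ν z ≡ place (Sum.map (partner k) (partner l) s) → Reaches ν z h) → Reaches ν (place s) h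
    through (inj₁ a) = lift (embedding₁ μ₁ μ₂) (Joins.joins J₁ a)
    through (inj₂ a) = lift (embedding₂ μ₁ μ₂) (Joins.joins J₂ a)

    -- Each unit of the bound stands for a whole trail inside one factor, which `lift` turns into a
    -- segment of a trail of the glue.
    walk-sound : ∀ n s {h} → walk n k l s ≡ just h → Reaches ν (place s) h
    walk-sound (suc n) s eq with cross (Sum.map (partner k) (partner l) s) in c
    walk-sound (suc n) s refl | inj₁ h  = through s λ z → leave _ c
    walk-sound (suc n) s eq   | inj₂ s′ = through s λ z p → enter _ c p (walk-sound n s′ eq)

    glue-joins : ∀ {m} → Compose k l m → Joins ν m
    glue-joins c = record
      { joins = λ h → subst (λ x → Reaches ν x _) (place-origin h) (walk-sound 4 (origin h) (walk-partner c h))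
      ; exits = λ x → subst (λ x → ∃[ h ] Reaches ν x h) (join-split x) (exit (split x))
      }
      where
      reach : ∀ s → ∃[ h ] Reaches ν (place s) h
      reach (inj₁ a) = let h , w = proj₁ (all-halt c) a in h , walk-sound 4 (inj₁ a) w
      reach (inj₂ a) = let h , w = proj₂ (all-halt c) a in h , walk-sound 4 (inj₂ a) w
      onward : ∀ t → ∃[ h ] (∀ z → mate ν z ≡ place t → Reaches ν z h)
      onward t with cross t in c
      ... | inj₁ h = h , λ z → leave t c
      ... | inj₂ s = let h , r = reach s in h , λ z p → enter t c p r
      exit : ∀ y → ∃[ h ] Reaches ν (join y) h
      exit (inj₁ x) = let a , r = Joins.exits J₁ x; h , on = onward (inj₁ a) in h , lift (embedding₁ μ₁ μ₂) r on
      exit (inj₂ x) = let a , r = Joins.exits J₂ x; h , on = onward (inj₂ a) in h , lift (embedding₂ μ₁ μ₂) r on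

  -- The trail entering at half-edge 0 of G₂ would come back to its start.
  ¬joins-AA : ∀ {ν : Matching G₃} → let open Restrict ν in Joins ν₁ A → Joins ν₂ A → Exits ν → ⊥
  ¬joins-AA {ν} J₁ J₂ exits with exits (in₂ (inj₂ 0F))
  ... | h , es , t = go₂ (depart embedding₂′ t refl _ refl)
    where
    open Restrict ν
    go₁ : ∀ {es′} → length es′ ℕ.< length es → Departure embedding₁′ (inj₂ 2F) es′ h → ⊥
    go₁ es′<es D with reaches-unique (Joins.joins J₁ 2F) (Departure.inside D) | Departure.beyond D
    -- The trail is back at its starting end. Being determined by that end, it would again consist
    -- of the edges `es`, but `es″` is shorter.
    ... | refl | inj₂ (_ , _ , es″ , refl , t″ , es″<es′) =
      ℕ.<-irrefl (cong length (proj₁ (trail-unique t″ t))) (ℕ.<-trans es″<es′ es′<es)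
    go₂ : Departure embedding₂′ (inj₂ 0F) es h → ⊥
    go₂ D with reaches-unique (Joins.joins J₂ 0F) (Departure.inside D) | Departure.beyond D
    ... | refl | inj₂ (_ , _ , es′ , refl , t′ , es′<es) = go₁ es′<es (depart embedding₁′ t′ refl _ refl)

  restrict-exits : ∀ {ν : Matching G₃} → let open Restrict ν in Exits ν → Exits ν₁ × Exits ν₂
  restrict-exits {ν} exits =
    (λ x → let h , es , t = exits (in₁ x) in _ , Departure.inside (depart embedding₁′ t refl _ refl)) ,
    (λ x → let h , es , t = exits (in₂ x) in _ , Departure.inside (depart embedding₂′ t refl _ refl))
    where open Restrict ν

_≈ᴹ_ : ∀ {G} → Matching G → Matching G → Set
μ ≈ᴹ ν = ∀ x → Matching.mate μ x ≡ Matching.mate ν x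

reaches-cong : ∀ {G} {μ ν : Matching G} → μ ≈ᴹ ν → ∀ {x h} → Reaches μ x h → Reaches ν x h
reaches-cong μ≈ν (_ , stop p)   = _ , stop (trans (sym (μ≈ν _)) p)
reaches-cong μ≈ν (_ , step p t) = _ , step (trans (sym (μ≈ν _)) p) (proj₂ (reaches-cong μ≈ν (_ , t)))

joins-cong : ∀ {G} {μ ν : Matching G} {k} → μ ≈ᴹ ν → Joins μ k → Joins ν k
joins-cong μ≈ν J = record
  { joins = λ h → reaches-cong μ≈ν (Joins.joins J h)
  ; exits = λ x → let h , r = Joins.exits J x in h , reaches-cong μ≈ν r }

RoutesSetoid : Gadget → Kind → Setoid 0ℓ 0ℓ
RoutesSetoid G k = VR G 0F (end₁ k) (end₂ k) (end₃ k)

cardinality : ∀ {n} {I : Set} {X : Setoid 0ℓ 0ℓ} → let open Setoid X in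
              I ↔ Fin n → (g : I → Carrier) → (∀ i j → g i ≈ g j → i ≡ j) → (∀ x → ∃[ i ] g i ≈ x) → HasCardinality X n
cardinality {n} {I} {X} I↔n g injective surjective = record
  { to        = λ x → to (index x)
  ; from      = λ m → g (from m)
  ; to-cong   = λ {x} {y} x≈y → cong to (injective _ _ (X.trans (g-index x) (X.trans x≈y (X.sym (g-index y)))))
  ; from-cong = λ { refl → X.refl }
  ; inverse   =
      (λ {m} {x} x≈gm → trans (cong to (injective _ _ (X.trans (g-index x) x≈gm))) (strictlyInverseˡ m)) ,
      (λ { {x} refl → X.trans (X.reflexive (cong g (strictlyInverseʳ (index x)))) (g-index x) })
  }
  where
  module X = Setoid X
  open Inverse I↔n using (to; from; strictlyInverseˡ; strictlyInverseʳ)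
  index : X.Carrier → I
  index x = proj₁ (surjective x)
  g-index : ∀ x → g (index x) X.≈ x
  g-index x = proj₂ (surjective x)

module Count (G₁ G₂ : Gadget) (n₁ n₂ : Kind → ℕ)
             (card₁ : ∀ k → HasCardinality (RoutesSetoid G₁ k) (n₁ k))
             (card₂ : ∀ k → HasCardinality (RoutesSetoid G₂ k) (n₂ k)) where
  open GlueEnds G₁ G₂
  open GlueTrails G₁ G₂
  open Matching
  open ValidRoutes

  module C₁ k = Inverse (card₁ k)
  module C₂ k = Inverse (card₂ k)

  m₁ : ∀ k → Fin (n₁ k) → Matching G₁
  m₁ k i = matching (C₁.from k i)

  m₂ : ∀ k → Fin (n₂ k) → Matching G₂
  m₂ k i = matching (C₂.from k i)

  Pairs : Kind → Set
  Pairs m = ∃[ k ] ∃[ l ] Compose k l m × Fin (n₁ k) × Fin (n₂ l)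

  glueRoutes : ∀ {m} → Pairs m → Routes G₃ m
  glueRoutes {m} (k , l , c , i , j) =
    joins⇒routes m (glue-joins (routes⇒joins k (C₁.from k i)) (routes⇒joins l (C₂.from l j)) c)

  glue-cancel₁ : ∀ μ₁ ν₁ μ₂ ν₂ → glueMatching μ₁ μ₂ ≈ᴹ glueMatching ν₁ ν₂ → μ₁ ≈ᴹ ν₁
  glue-cancel₁ μ₁ ν₁ μ₂ ν₂ eq x = in₁-injective (trans (sym (Embedding.into-mate (embedding₁ μ₁ μ₂) x))
    (trans (eq (in₁ x)) (Embedding.into-mate (embedding₁ ν₁ ν₂) x)))

  glue-cancel₂ : ∀ μ₁ ν₁ μ₂ ν₂ → glueMatching μ₁ μ₂ ≈ᴹ glueMatching ν₁ ν₂ → μ₂ ≈ᴹ ν₂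
  glue-cancel₂ μ₁ ν₁ μ₂ ν₂ eq x = in₂-injective (trans (sym (Embedding.into-mate (embedding₂ μ₁ μ₂) x))
    (trans (eq (in₂ x)) (Embedding.into-mate (embedding₂ ν₁ ν₂) x)))

  glue-cong : ∀ μ₁ ν₁ μ₂ ν₂ → μ₁ ≈ᴹ ν₁ → μ₂ ≈ᴹ ν₂ → glueMatching μ₁ μ₂ ≈ᴹ glueMatching ν₁ ν₂
  glue-cong μ₁ ν₁ μ₂ ν₂ eq₁ eq₂ x = cong join (swap≡ (split x))
    where
    swap≡ : ∀ y → Sum.map (mate μ₁) (mate μ₂) y ≡ Sum.map (mate ν₁) (mate ν₂) y
    swap≡ (inj₁ x) = cong inj₁ (eq₁ x)
    swap≡ (inj₂ x) = cong inj₂ (eq₂ x)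

  glue-restrict : ∀ ν → let open Restrict ν in glueMatching ν₁ ν₂ ≈ᴹ ν
  glue-restrict ν x = trans (on-join (split x)) (cong (mate ν) (join-split x))
    where
    open Restrict ν
    on-join : ∀ y → join (Sum.map (mate ν₁) (mate ν₂) y) ≡ mate ν (join y)
    on-join (inj₁ x) = sym (Embedding.into-mate embedding₁′ x)
    on-join (inj₂ x) = sym (Embedding.into-mate embedding₂′ x)

  -- Equal matchings join the half-edges in the same way; the kinds must be identified before the
  -- indices can be compared at all.
  routes-index : ∀ {G} {n : Kind → ℕ} (card : ∀ k → HasCardinality (RoutesSetoid G k) (n k)) {k k′} i i′ →
                 matching (Inverse.from (card k) i) ≈ᴹ matching (Inverse.from (card k′) i′) →
                 _≡_ {A = ∃[ k ] Fin (n k)} (k , i) (k′ , i′)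
  routes-index card {k} {k′} i i′ eq
    with refl ← joins-unique (joins-cong eq (routes⇒joins k (Inverse.from (card k) i))) (routes⇒joins k′ (Inverse.from (card k′) i′)) =
    cong (k ,_) (trans (sym (strictlyInverseˡ i)) (trans (to-cong eq) (strictlyInverseˡ i′)))
    where open Inverse (card k)

  glueRoutes-injective : ∀ {m} (p p′ : Pairs m) → matching (glueRoutes p) ≈ᴹ matching (glueRoutes p′) → p ≡ p′
  glueRoutes-injective (k , l , c , i , j) (k′ , l′ , c′ , i′ , j′) eq
    with routes-index card₁ i i′ (glue-cancel₁ (m₁ k i) (m₁ k′ i′) (m₂ l j) (m₂ l′ j′) eq)
       | routes-index card₂ j j′ (glue-cancel₂ (m₁ k i) (m₁ k′ i′) (m₂ l j) (m₂ l′ j′) eq)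
  ... | refl | refl = cong (λ c → k , l , c , i , j) (Compose-irrelevant c c′)

  glueRoutes-surjective : ∀ {m} (r : Routes G₃ m) → ∃[ p ] matching (glueRoutes {m} p) ≈ᴹ matching r
  glueRoutes-surjective {m} r =
    let J       = routes⇒joins m r
        e₁ , e₂ = restrict-exits (Joins.exits J)
    in found J (exits⇒joins e₁) (exits⇒joins e₂)
    where
    ν : Matching G₃
    ν = matching r
    open Restrict ν
    found : Joins ν m → ∃[ k ] Joins ν₁ k → ∃[ l ] Joins ν₂ l → ∃[ p ] matching (glueRoutes {m} p) ≈ᴹ ν
    found J (k , J₁) (l , J₂) with compose? k l
    ... | inj₁ (refl , refl) = ⊥-elim (¬joins-AA J₁ J₂ (Joins.exits J))
    -- Gluing the two restrictions gives back `ν`, which joins its half-edges as `m`; hence `m′` is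
    -- `m`.
    ... | inj₂ (m′ , c) with refl ← joins-unique (joins-cong (glue-restrict ν) (glue-joins J₁ J₂ c)) J =
      (k , l , c , C₁.to k (joins⇒routes k J₁) , C₂.to l (joins⇒routes l J₂)) ,
      λ x → trans (glue-cong (m₁ k (C₁.to k (joins⇒routes k J₁))) ν₁ (m₂ l (C₂.to l (joins⇒routes l J₂))) ν₂
                    (C₁.strictlyInverseʳ k (joins⇒routes k J₁)) (C₂.strictlyInverseʳ l (joins⇒routes l J₂)) x)
                  (glue-restrict ν x)

  total : Kind → ℕ
  total A = n₁ A ℕ.* n₂ B ℕ.+ n₁ A ℕ.* n₂ C ℕ.+ n₁ B ℕ.* n₂ A ℕ.+ n₁ C ℕ.* n₂ A
  total B = n₁ B ℕ.* n₂ C ℕ.+ n₁ C ℕ.* n₂ B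
  total C = n₁ B ℕ.* n₂ B ℕ.+ n₁ C ℕ.* n₂ C

  private
    infixl 4 _⊞_
    _⊞_ : ∀ {X Y : Set} {m n} → X ↔ Fin m → Y ↔ Fin n → (X ⊎ Y) ↔ Fin (m ℕ.+ n)
    f ⊞ g = ↔-trans (f ⊎-↔ g) (↔-sym +↔⊎)

    box : ∀ k l → (Fin (n₁ k) × Fin (n₂ l)) ↔ Fin (n₁ k ℕ.* n₂ l)
    box k l = ↔-sym *↔×

  Pairs-finite : ∀ m → Pairs m ↔ Fin (total m)
  Pairs-finite A = ↔-trans (mk↔ₛ′
    (λ { (_ , _ , AB , p) → inj₁ (inj₁ (inj₁ p)) ; (_ , _ , AC , p) → inj₁ (inj₁ (inj₂ p))
       ; (_ , _ , BA , p) → inj₁ (inj₂ p) ; (_ , _ , CA , p) → inj₂ p })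
    (λ { (inj₁ (inj₁ (inj₁ p))) → _ , _ , AB , p ; (inj₁ (inj₁ (inj₂ p))) → _ , _ , AC , p
       ; (inj₁ (inj₂ p)) → _ , _ , BA , p ; (inj₂ p) → _ , _ , CA , p })
    (λ { (inj₁ (inj₁ (inj₁ p))) → refl ; (inj₁ (inj₁ (inj₂ p))) → refl ; (inj₁ (inj₂ p)) → refl ; (inj₂ p) → refl })
    (λ { (_ , _ , AB , p) → refl ; (_ , _ , AC , p) → refl ; (_ , _ , BA , p) → refl ; (_ , _ , CA , p) → refl }))
    (box A B ⊞ box A C ⊞ box B A ⊞ box C A)
  Pairs-finite B = ↔-trans (mk↔ₛ′
    (λ { (_ , _ , BC , p) → inj₁ p ; (_ , _ , CB , p) → inj₂ p })
    (λ { (inj₁ p) → _ , _ , BC , p ; (inj₂ p) → _ , _ , CB , p })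
    (λ { (inj₁ p) → refl ; (inj₂ p) → refl })
    (λ { (_ , _ , BC , p) → refl ; (_ , _ , CB , p) → refl }))
    (box B C ⊞ box C B)
  Pairs-finite C = ↔-trans (mk↔ₛ′
    (λ { (_ , _ , BB , p) → inj₁ p ; (_ , _ , CC , p) → inj₂ p })
    (λ { (inj₁ p) → _ , _ , BB , p ; (inj₂ p) → _ , _ , CC , p })
    (λ { (inj₁ p) → refl ; (inj₂ p) → refl })
    (λ { (_ , _ , BB , p) → refl ; (_ , _ , CC , p) → refl }))
    (box B B ⊞ box C C)

  glue-cardinality : ∀ m → HasCardinality (RoutesSetoid G₃ m) (total m)
  glue-cardinality m = cardinality {X = RoutesSetoid G₃ m} (Pairs-finite m) glueRoutes glueRoutes-injective glueRoutes-surjective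

-- From numbers of routes to signatures

fromℕ-* : ∀ m n → fromℕ (m ℕ.* n) ≡ fromℕ m * fromℕ n
fromℕ-* zero    n = sym (*-zeroˡ (fromℕ n))
fromℕ-* (suc m) n = trans (fromℕ-+ n (m ℕ.* n)) (trans (cong (fromℕ n +_) (fromℕ-* m n))
  (trans (solve 2 (λ m n → n :+ m :* n := (m :+ con 1ℚ) :* n) refl (fromℕ m) (fromℕ n))
         (cong (_* fromℕ n) (sym (fromℕ-suc m)))))

/-*-cancel : ∀ a n .{{_ : ℕ.NonZero n}} → (ℤ.+ a / n) * fromℕ n ≡ fromℕ a
/-*-cancel a (suc k) = toℚᵘ-injective (ℚᵘ.≃-trans (toℚᵘ-homo-* (ℤ.+ a / suc k) (fromℕ (suc k)))
  (ℚᵘ.≃-trans (ℚᵘ.*-cong (toℚᵘ-/ (ℤ.+ a) k) (toℚᵘ-/ (ℤ.+ suc k) 0))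
  (ℚᵘ.≃-trans (ℚᵘ.*≡* (trans (ℤ.*-identityʳ _) (cong (λ m → ℤ.+ a ℤ.* ℤ.+ m) (sym (ℕ.*-identityʳ (suc k))))))
              (ℚᵘ.≃-sym (toℚᵘ-/ (ℤ.+ a) 0)))))

0<fromℕ : ∀ n .{{_ : ℕ.NonZero n}} → 0ℚ < fromℕ n
0<fromℕ (suc k) = 0<fromℕ-suc k

nonZero-of-0<fromℕ : ∀ n → 0ℚ < fromℕ n → ℕ.NonZero n
nonZero-of-0<fromℕ zero    0<0 = ⊥-elim (<-irrefl refl 0<0)
nonZero-of-0<fromℕ (suc n) _   = _

-- The equation `x = n / M` without division. Shares of one whole add and shares of two wholes
-- multiply, so the numerators of the glue formula follow the counts term by term.
record Share (M x : ℚ) (n : ℕ) : Set where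
  constructor share
  field
    *-share : x * M ≡ fromℕ n

open Share

infixl 6 _⊕_
infixl 7 _⊗_

_⊕_ : ∀ {M x y m n} → Share M x m → Share M y n → Share M (x + y) (m ℕ.+ n)
_⊕_ {M} {x} {y} {m} {n} (share xM≡m) (share yM≡n) =
  share (trans (*-distribʳ-+ M x y) (trans (cong₂ _+_ xM≡m yM≡n) (sym (fromℕ-+ m n))))

_⊗_ : ∀ {M M′ x y m n} → Share M x m → Share M′ y n → Share (M * M′) (x * y) (m ℕ.* n)
_⊗_ {M} {M′} {x} {y} {m} {n} (share xM≡m) (share yM′≡n) = share (trans
  (solve 4 (λ x y n m → x :* y :* (n :* m) := x :* n :* (y :* m)) refl x y M M′)
  (trans (cong₂ _*_ xM≡m yM′≡n) (sym (fromℕ-* m n))))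

share-nonNeg : ∀ {M x n} → 0ℚ < M → Share M x n → 0ℚ ≤ x
share-nonNeg {M} {x} {n} 0<M (share xM≡n) =
  cancelʳ-≤ M 0<M (subst₂ _≤_ (sym (*-zeroˡ M)) (sym xM≡n) (0≤fromℕ n))

share-unique : ∀ {M x y n} → 0ℚ < M → Share M x n → Share M y n → x ≡ y
share-unique {M} 0<M (share xM≡n) (share yM≡n) = cancelʳ-≡ M 0<M (trans xM≡n (sym yM≡n))

share-/ : ∀ n N .{{_ : ℕ.NonZero N}} → Share (fromℕ N) (ℤ.+ n / N) n
share-/ n N = share (/-*-cancel n N)

module Counts {G α β γ} (H : HasSignature G α β γ) where
  open HasSignature H public

  count : Kind → ℕ
  count A = a
  count B = b
  count C = c

  card : ∀ k → HasCardinality (RoutesSetoid G k) (count k)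
  card A = card-a
  card B = card-b
  card C = card-c

  0<N : 0ℚ < fromℕ N
  0<N = 0<fromℕ N

  share-α : Share (fromℕ N) α a
  share-α = subst (λ x → Share (fromℕ N) x a) (sym α≡a/N) (share-/ a N)

  share-β : Share (fromℕ N) β b
  share-β = subst (λ x → Share (fromℕ N) x b) (sym β≡b/N) (share-/ b N)

  share-γ : Share (fromℕ N) γ c
  share-γ = subst (λ x → Share (fromℕ N) x c) (sym γ≡c/N) (share-/ c N)

  signature : Admissible α β γ → Signature α β γ
  signature adm = record
    { 0≤α = share-nonNeg 0<N share-α ; 0≤β = share-nonNeg 0<N share-β ; 0≤γ = share-nonNeg 0<N share-γ
    ; sum≡1 = share-unique 0<N (share-α ⊕ share-β ⊕ share-γ) (share (*-identityˡ (fromℕ N)))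
    ; admissible = adm
    }

theorem7 : (G₁ G₂ : Gadget) (α₁ β₁ γ₁ α₂ β₂ γ₂ : ℚ) →
    HasSignature G₁ α₁ β₁ γ₁ → S (ι α₁ ∷ ι β₁ ∷ ι γ₁ ∷ []) →
    HasSignature G₂ α₂ β₂ γ₂ → S (ι α₂ ∷ ι β₂ ∷ ι γ₂ ∷ []) →
    (α₁α₂≢1 : α₁ * α₂ ≢ 1ℚ) →
    let instance _ = 1-p≢0 α₁α₂≢1
        α₃ = (α₁ * β₂ + α₁ * γ₂ + β₁ * α₂ + γ₁ * α₂) ÷ (1ℚ - α₁ * α₂)
        β₃ = (β₁ * γ₂ + γ₁ * β₂) ÷ (1ℚ - α₁ * α₂)
        γ₃ = (β₁ * β₂ + γ₁ * γ₂) ÷ (1ℚ - α₁ * α₂)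
    in HasSignature (2-glue G₁ G₂) α₃ β₃ γ₃ × S (ι α₃ ∷ ι β₃ ∷ ι γ₃ ∷ [])
theorem7 G₁ G₂ α₁ β₁ γ₁ α₂ β₂ γ₂ H₁ v₁∈S H₂ v₂∈S α₁α₂≢1 = record
  { a = total A ; b = total B ; c = total C
  ; card-a = glue-cardinality A ; card-b = glue-cardinality B ; card-c = glue-cardinality C
  ; N≢0 = N₃≢0
  ; α≡a/N = ratio a₃ ; β≡b/N = ratio b₃ ; γ≡c/N = ratio c₃
  } , inS
  where
  module H₁ = Counts H₁
  module H₂ = Counts H₂
  open Count G₁ G₂ H₁.count H₂.count H₁.card H₂.card
  σ₁ = H₁.signature (S⇒admissible v₁∈S)
  σ₂ = H₂.signature (S⇒admissible v₂∈S)
  D ω M : ℚ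
  D = 1ℚ - α₁ * α₂
  ω = (1/ D) {{1-p≢0 α₁α₂≢1}}
  M = fromℕ H₁.N * fromℕ H₂.N
  ωD≡1 : ω * D ≡ 1ℚ
  ωD≡1 = *-inverseˡ D {{1-p≢0 α₁α₂≢1}}
  ≤1 : ∀ {α β γ} → Signature α β γ → α ≤ 1ℚ
  ≤1 {α} {β} {γ} σ = ≤-by (0≤+ (Signature.0≤β σ) (Signature.0≤γ σ))
    (trans (sym (Signature.sum≡1 σ)) (+-assoc α β γ))
  0<D : 0ℚ < D
  0<D = ≢0⇒0< (0≤diff (≤-trans (*-mono-0≤ (Signature.0≤α σ₂) 0≤1 (≤1 σ₁) (≤1 σ₂)) (≤-reflexive (*-identityˡ 1ℚ))))
    λ D≡0 → α₁α₂≢1 (trans (solve 1 (λ x → x := con 1ℚ :- (con 1ℚ :- x)) refl (α₁ * α₂)) (cong (λ y → 1ℚ - y) D≡0))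
  0<ω : 0ℚ < ω
  0<ω = *-cancelʳ-<-nonNeg D {{nonNegative (<⇒≤ 0<D)}} (subst₂ _<_ (sym (*-zeroˡ D)) (sym ωD≡1) (positive⁻¹ 1ℚ))
  open GlueSignature σ₁ σ₂ ω 0<ω ωD≡1 using (inS; sum₃)
  0<M : 0ℚ < M
  0<M = 0<* H₁.0<N H₂.0<N
  numα numβ numγ : ℚ
  numα = α₁ * β₂ + α₁ * γ₂ + β₁ * α₂ + γ₁ * α₂
  numβ = β₁ * γ₂ + γ₁ * β₂
  numγ = β₁ * β₂ + γ₁ * γ₂
  a₃ : Share M numα (total A)
  a₃ = H₁.share-α ⊗ H₂.share-β ⊕ H₁.share-α ⊗ H₂.share-γ ⊕ H₁.share-β ⊗ H₂.share-α ⊕ H₁.share-γ ⊗ H₂.share-α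
  b₃ : Share M numβ (total B)
  b₃ = H₁.share-β ⊗ H₂.share-γ ⊕ H₁.share-γ ⊗ H₂.share-β
  c₃ : Share M numγ (total C)
  c₃ = H₁.share-β ⊗ H₂.share-β ⊕ H₁.share-γ ⊗ H₂.share-γ
  N₃ : ℕ
  N₃ = total A ℕ.+ total B ℕ.+ total C
  numerators≡D : numα + numβ + numγ ≡ D
  numerators≡D = trans (sym (*-identityʳ (numα + numβ + numγ))) (trans (cong ((numα + numβ + numγ) *_) (sym ωD≡1))
    (trans (solve 5 (λ x y z ω d → (x :+ y :+ z) :* (ω :* d) := (x :* ω :+ y :* ω :+ z :* ω) :* d) refl numα numβ numγ ω D)
    (trans (cong (_* D) sum₃) (*-identityˡ D))))
  -- Of all pairs of route sets of the factors, exactly the share `α₁ * α₂` closes a loop; since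
  -- that share is not 1, `N₃` is positive.
  DM≡N₃ : D * M ≡ fromℕ N₃
  DM≡N₃ = trans (cong (_* M) (sym numerators≡D)) (*-share (a₃ ⊕ b₃ ⊕ c₃))
  0<N₃ : 0ℚ < fromℕ N₃
  0<N₃ = subst (0ℚ <_) DM≡N₃ (0<* 0<D 0<M)
  N₃≢0 : ℕ.NonZero N₃
  N₃≢0 = nonZero-of-0<fromℕ N₃ 0<N₃
  ratio : ∀ {x n} → Share M x n → x * ω ≡ (ℤ.+ n / N₃) {{N₃≢0}}
  ratio {x} {n} (share xM≡n) = share-unique 0<N₃
    (share (trans (cong (x * ω *_) (sym DM≡N₃)) (trans
      (solve 4 (λ x ω d m → x :* ω :* (d :* m) := ω :* d :* (x :* m)) refl x ω D M)
      (trans (cong₂ _*_ ωD≡1 xM≡n) (*-identityˡ (fromℕ n))))))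
    (share-/ n N₃ {{N₃≢0}})
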